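{- There exist infinitely many quadratic fields $K$ such that for each of them there exist infinitely many Diophantine triples $\{a,b,c\}$ over $K$ for which the induced elliptic curve $E: y^2 = (ax+1)(bx+1)(cx+1)$ has torsion group $E(K)_{\mathrm{tors}} \cong \mathbb{Z}/2\mathbb{Z} \times \mathbb{Z}/10\mathbb{Z}$.
   Context: For a field $K$, a Diophantine triple over $K$ is a set $\{a,b,c\}$ of three distinct nonzero elements of $K$ such that $ab+1$, $ac+1$ and $bc+1$ are all squares of elements of $K$. The elliptic curve induced by the Diophantine triple $\{a,b,c\}$ is $E: y^2 = (ax+1)(bx+1)(cx+1)$, considered over $K$. -}

module Defs where

open import Data.Nat using (ℕ; zero; suc; NonZero)
import Data.Nat as ℕ
open import Data.Nat.Divisibility using (_∣_)
open import Data.Nat.DivMod using (_%_; m%n<n)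
open import Data.Integer as ℤ using (ℤ; ∣_∣)
open import Data.Rational as ℚ using (ℚ; 0ℚ; 1ℚ)
import Data.Rational.Properties as ℚP
open import Data.Fin using (Fin; toℕ; fromℕ<)
open import Data.Product using (Σ; ∃; _×_; _,_; proj₁; proj₂)
open import Data.Product.Properties using (≡-dec)
open import Data.Sum using (_⊎_)
open import Data.Unit using (⊤)
open import Relation.Nullary using (¬_; Dec; yes; no)
open import Relation.Binary.PropositionalEquality using (_≡_; _≢_)

-- Quadratic fields: Q(√d) for a squarefree integer d ∉ {0, 1}.
-- Every quadratic field is isomorphic to exactly one such Q(√d).

SquareFree : ℤ → Set
SquareFree d = ∀ (n : ℕ) → (n ℕ.* n) ∣ ∣ d ∣ → n ≡ 1

IsQuadraticDiscr : ℤ → Set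
IsQuadraticDiscr d = d ≢ ℤ.0ℤ × d ≢ ℤ.1ℤ × SquareFree d

-- Elements a + b√d of Q(√d), represented by the pair (a , b).
K : ℤ → Set
K d = ℚ × ℚ

module Field (d : ℤ) where
  dℚ : ℚ
  dℚ = d ℚ./ 1

  0K : K d
  0K = (0ℚ , 0ℚ)

  1K : K d
  1K = (1ℚ , 0ℚ)

  ofℕ : ℕ → K d
  ofℕ n = (ℤ.+ n ℚ./ 1 , 0ℚ)

  infixl 6 _+K_ _-K_
  infixl 7 _*K_ _/K_

  _+K_ : K d → K d → K d
  (a , b) +K (c , e) = (a ℚ.+ c , b ℚ.+ e)

  -K_ : K d → K d
  -K (a , b) = (ℚ.- a , ℚ.- b)

  _-K_ : K d → K d → K d
  x -K y = x +K (-K y)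

  _*K_ : K d → K d → K d
  (a , b) *K (c , e) = (a ℚ.* c ℚ.+ dℚ ℚ.* (b ℚ.* e) , a ℚ.* e ℚ.+ b ℚ.* c)

  invℚ : ℚ → ℚ
  invℚ p with p ℚP.≟ 0ℚ
  ... | yes _ = 0ℚ
  ... | no p≢0 = ℚ.1/_ p {{ℚ.≢-nonZero p≢0}}

  -- inverse in Q(√d): (a + b√d)⁻¹ = (a - b√d)/(a² - d b²); junk value 0 at 0
  invK : K d → K d
  invK (a , b) = let n = invℚ (a ℚ.* a ℚ.- dℚ ℚ.* (b ℚ.* b)) in
                 (a ℚ.* n , ℚ.- (b ℚ.* n))

  _/K_ : K d → K d → K d
  x /K y = x *K invK y

  _≟K_ : (x y : K d) → Dec (x ≡ y)
  _≟K_ = ≡-dec ℚP._≟_ ℚP._≟_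

  IsSquare : K d → Set
  IsSquare x = ∃ λ t → t *K t ≡ x

  -- an (ordered) triple of elements; the set {a,b,c} is its underlying set
  Triple : Set
  Triple = K d × K d × K d

  IsDiophantineTriple : Triple → Set
  IsDiophantineTriple (a , b , c) =
    a ≢ 0K × b ≢ 0K × c ≢ 0K × a ≢ b × a ≢ c × b ≢ c ×
    IsSquare (a *K b +K 1K) × IsSquare (a *K c +K 1K) × IsSquare (b *K c +K 1K)

  SameSet : Triple → Triple → Set
  SameSet (a , b , c) (a' , b' , c') =
    (∀ x → (x ≡ a ⊎ x ≡ b ⊎ x ≡ c) → (x ≡ a' ⊎ x ≡ b' ⊎ x ≡ c')) ×
    (∀ x → (x ≡ a' ⊎ x ≡ b' ⊎ x ≡ c') → (x ≡ a ⊎ x ≡ b ⊎ x ≡ c))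

  -- The induced curve E : y² = (ax+1)(bx+1)(cx+1) over Q(√d),
  -- i.e. y² = A x³ + B x² + C x + 1 with A = abc, B = ab+ac+bc, C = a+b+c.
  -- Its K-points: the point at infinity O and affine solutions.

  data Point : Set where
    O   : Point
    aff : K d → K d → Point

  OnCurve : Triple → Point → Set
  OnCurve t O = ⊤
  OnCurve (a , b , c) (aff x y) =
    y *K y ≡ (a *K x +K 1K) *K (b *K x +K 1K) *K (c *K x +K 1K)

  -- Chord-and-tangent group law with neutral element O (O is a flex of E).
  -- For a line y = λx + ν, the x-coordinates of the three intersection
  -- points sum to (λ² - B)/A.
  module Law (t : Triple) where
    A B C : K d
    A = proj₁ t *K proj₁ (proj₂ t) *K proj₂ (proj₂ t)
    B = proj₁ t *K proj₁ (proj₂ t) +K proj₁ t *K proj₂ (proj₂ t)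
          +K proj₁ (proj₂ t) *K proj₂ (proj₂ t)
    C = proj₁ t +K proj₁ (proj₂ t) +K proj₂ (proj₂ t)

    third : K d → K d → K d → K d → Point
    third l x₁ y₁ x₂ =
      let x₃ = (l *K l -K B) /K A -K x₁ -K x₂ in
      aff x₃ (-K (y₁ +K l *K (x₃ -K x₁)))

    infixl 6 _⊕_
    _⊕_ : Point → Point → Point
    O ⊕ Q = Q
    P ⊕ O = P
    aff x₁ y₁ ⊕ aff x₂ y₂ with x₁ ≟K x₂
    ... | no _ = third ((y₂ -K y₁) /K (x₂ -K x₁)) x₁ y₁ x₂
    ... | yes _ with (y₁ +K y₂) ≟K 0K
    ...   | yes _ = O
    ...   | no _ = third ((ofℕ 3 *K A *K x₁ *K x₁ +K ofℕ 2 *K B *K x₁ +K C)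
                          /K (ofℕ 2 *K y₁)) x₁ y₁ x₁

    mul : ℕ → Point → Point
    mul zero P = O
    mul (suc n) P = P ⊕ mul n P

    IsTorsion : Point → Set
    IsTorsion P = OnCurve t P × ∃ λ n → mul (suc n) P ≡ O

_+mod_ : ∀ {n} .{{_ : NonZero n}} → Fin n → Fin n → Fin n
_+mod_ {n} i j = fromℕ< (m%n<n (toℕ i ℕ.+ toℕ j) n)

Z2×Z10 : Set
Z2×Z10 = Fin 2 × Fin 10

_⊞_ : Z2×Z10 → Z2×Z10 → Z2×Z10
(i , j) ⊞ (k , l) = (i +mod k , j +mod l)

module _ (d : ℤ) where
  open Field d

  TorsionIsZ2×Z10 : Triple → Set
  TorsionIsZ2×Z10 t =
    let open Law t in
    Σ (Z2×Z10 → Point) λ ψ →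
      (∀ u → OnCurve t (ψ u)) ×
      (∀ u v → ψ (u ⊞ v) ≡ ψ u ⊕ ψ v) ×
      (∀ u v → ψ u ≡ ψ v → u ≡ v) ×
      (∀ P → IsTorsion P → ∃ λ u → ψ u ≡ P)

  InfinitelyManyTriples : Set
  InfinitelyManyTriples =
    Σ (ℕ → Triple) λ f →
      (∀ n → IsDiophantineTriple (f n) × TorsionIsZ2×Z10 (f n)) ×
      (∀ m n → SameSet (f m) (f n) → m ≡ n)

{-# OPTIONS --safe #-}

-- The triples used here are regular, (a + b - c)² = 4(ab + 1), and satisfy 2abc(2abc + a + b + c) = 1, which says
-- that (0 , 1) is a point of order 5 on the induced curve; the 2-torsion being rational, this gives a subgroup
-- ℤ/2 × ℤ/10. Such triples over ℚ(√h) come from rational points on h y² = 1 + σ² - σ⁴, with a = 2σ³/(1 - σ⁴).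
-- Starting from σ = 3/v and h = v⁴ + 9v² - 81, multiplication by -3 yields infinitely many points, told apart by
-- the 3-adic valuation of σ, and suitable v yield nonsquare and pairwise coprime h, hence distinct fields.
--
-- To see that there is no further torsion, v is chosen such that 17 splits in ℚ(√h) and that all the induced curves
-- have the same good reduction at a place above 17, a curve with exactly 20 points over 𝔽₁₇. The kernel of reduction
-- is torsion free (z = x/y is additive up to cubic terms), so 21 torsion points would contain two equal ones.
module Submission where

open import Defs
open import Data.Nat using (ℕ)
open import Data.Integer using (ℤ)
open import Data.Product using (Σ; _×_)
open import Relation.Binary.PropositionalEquality using (_≡_)

-- By Mazur's theorem ℤ/2 × ℤ/10 does not occur over ℚ, so the points on h y² = 1 + σ² - σ⁴ have to
-- come from nonsquare h. The quartic expresses regularity: if a = 2σ³/(1 - σ⁴) and b + c = a + σ +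
-- σ⁻¹, then (b - c)² must be 4(1 + σ² - σ⁴)/(1 - σ⁴)². Thus a is rational while b and c are
-- conjugate, and triples with the same elements share a. The obstacle is to exclude further torsion
-- in infinitely many fields at once without the classification of torsion over quadratic fields. By
-- Hasse's bound a curve over 𝔽₁₇ has between 10 and 26 points, so a subgroup of order 20 leaves
-- only 20; what remains is good reduction at a place of degree one. Congruences achieve this: σ ≡ 8
-- fixes A modulo 17, and the conditions of order five and regularity then fix C and B. The prime 3
-- enters because σ is a local parameter at (0 , 1): multiplication by -3 multiplies σ by -3 to
-- first order, and so raises its 3-adic valuation by exactly one.

-- Polynomial identities with integer coefficients in commutative rings

module FieldSolver where
  open import Algebra.Structures using (IsCommutativeRing)
  open import Algebra.Bundles using (CommutativeRing)
  open import Data.Bool using (Bool; true; false; if_then_else_)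
  open import Data.Integer as ℤ using (ℤ; -[1+_])
  import Data.Integer.Properties as ℤP
  open import Data.Fin using (toℕ)
  open import Data.List using (List; []; _∷_)
  open import Data.Vec using (Vec; []; _∷_; tabulate; toList)
  open import Data.Vec.N-ary using (N-ary; _$ⁿ_)
  open import Data.Nat as ℕ using (ℕ; zero; suc)
  import Data.Nat.Properties as ℕP
  open import Data.Product using (_×_; _,_; proj₁; proj₂)
  open import Relation.Binary.PropositionalEquality
  open import Relation.Nullary using (Dec; yes; no)

  -- The law for `inv` leaves its value at `0#` free, so that pairs of rationals with the junk
  -- inverse `invK` form an instance.
  record DecField : Set₁ where
    infixl 6 _+_
    infixl 7 _*_
    infix 8 -_
    field
      F : Set
      _+_ _*_ : F → F → F
      -_ inv : F → F
      0# 1# : F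
      isCommutativeRing : IsCommutativeRing _≡_ _+_ _*_ -_ 0# 1#
      *-inv : ∀ x → x ≢ 0# → x * inv x ≡ 1#
      1≢0 : 1# ≢ 0#
      _≟_ : (x y : F) → Dec (x ≡ y)

    commutativeRing : CommutativeRing _ _
    commutativeRing = record { isCommutativeRing = isCommutativeRing }

    infixl 6 _-_
    _-_ : F → F → F
    x - y = x + (- y)

  module FromIntegers {F : Set} {_+_ _*_ : F → F → F} { -_ : F → F} {0# 1# : F}
    (isCommutativeRing : IsCommutativeRing _≡_ _+_ _*_ -_ 0# 1#) where
    commutativeRing : CommutativeRing _ _
    commutativeRing = record { isCommutativeRing = isCommutativeRing }
    private
      infixl 6 _-_
      _-_ : F → F → F
      x - y = x + (- y)
    open CommutativeRing commutativeRing using (semiring; +-comm; +-assoc; +-identityˡ; +-identityʳ; -‿inverseʳ; ring)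
    open import Algebra.Properties.Ring ring using (-‿distribˡ-*; -‿distribʳ-*; -0#≈0#; -‿involutive; -‿+-comm)
    open import Algebra.Properties.Semiring.Mult.TCOptimised semiring
      renaming (_×_ to _×ᵐ_)

    -- With the optimised multiple, 1 ×ᵐ 1# computes to 1# and 3 ×ᵐ 1# to 1# + 1# + 1#, so a numeral
    -- `con n` matches the sums of ones that occur in goals.
    ι : ℤ → F
    ι (ℤ.+ n) = n ×ᵐ 1#
    ι -[1+ n ] = - (suc n ×ᵐ 1#)

    ι-neg : ∀ m → ι (ℤ.- m) ≡ - ι m
    ι-neg (ℤ.+ zero) = sym -0#≈0#
    ι-neg (ℤ.+ suc n) = refl
    ι-neg -[1+ n ] = sym (-‿involutive _)

    ι-⊖ : ∀ m n → ι (m ℤ.⊖ n) ≡ (m ×ᵐ 1#) - (n ×ᵐ 1#)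
    ι-⊖ m zero = sym (trans (cong (λ z → (m ×ᵐ 1#) + z) -0#≈0#) (+-identityʳ _))
    ι-⊖ zero (suc n) = sym (+-identityˡ _)
    ι-⊖ (suc m) (suc n) = begin
        ι (suc m ℤ.⊖ suc n)   ≡⟨ cong ι (ℤP.[1+m]⊖[1+n]≡m⊖n m n) ⟩
        ι (m ℤ.⊖ n)           ≡⟨ ι-⊖ m n ⟩
        m′ - n′                     ≡⟨ cong (_- n′) (sym (+-identityʳ m′)) ⟩
        (m′ + 0#) - n′              ≡⟨ cong (λ z → (m′ + z) - n′) (sym (-‿inverseʳ 1#)) ⟩
        (m′ + (1# - 1#)) - n′       ≡⟨ cong (_- n′) (sym (+-assoc m′ 1# _)) ⟩
        ((m′ + 1#) - 1#) - n′       ≡⟨ +-assoc _ _ _ ⟩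
        (m′ + 1#) + ((- 1#) - n′)     ≡⟨ cong₂ _+_ (+-comm m′ 1#) (-‿+-comm 1# n′) ⟩
        (1# + m′) - (1# + n′)       ≡⟨ cong₂ _-_ (sym (1+× m 1#)) (sym (1+× n 1#)) ⟩
        (suc m ×ᵐ 1#) - (suc n ×ᵐ 1#) ∎
      where
      open ≡-Reasoning
      m′ = m ×ᵐ 1#
      n′ = n ×ᵐ 1#

    ι-+ : ∀ m n → ι (m ℤ.+ n) ≡ ι m + ι n
    ι-+ (ℤ.+ m) (ℤ.+ n) = ×-homo-+ 1# m n
    ι-+ (ℤ.+ m) -[1+ n ] = ι-⊖ m (suc n)
    ι-+ -[1+ m ] (ℤ.+ n) = trans (ι-⊖ n (suc m)) (+-comm _ _)
    ι-+ -[1+ m ] -[1+ n ] = trans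
      (cong (λ k → - (k ×ᵐ 1#)) (sym (ℕP.+-suc (suc m) n)))
      (trans (cong -_ (×-homo-+ 1# (suc m) (suc n))) (sym (-‿+-comm _ _)))

    private
      ι-*-pos : ∀ m n → ι (ℤ.+ m ℤ.* ℤ.+ n) ≡ ι (ℤ.+ m) * ι (ℤ.+ n)
      ι-*-pos m n = trans (cong ι (sym (ℤP.pos-* m n))) (×1-homo-* m n)

      ι-*-posˡ : ∀ m n → ι (ℤ.+ m ℤ.* n) ≡ ι (ℤ.+ m) * ι n
      ι-*-posˡ m (ℤ.+ n) = ι-*-pos m n
      ι-*-posˡ m -[1+ n ] = begin
        ι (ℤ.+ m ℤ.* (ℤ.- ℤ.+ suc n))      ≡⟨ cong ι (sym (ℤP.neg-distribʳ-* (ℤ.+ m) (ℤ.+ suc n))) ⟩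
        ι (ℤ.- (ℤ.+ m ℤ.* ℤ.+ suc n))      ≡⟨ ι-neg (ℤ.+ m ℤ.* ℤ.+ suc n) ⟩
        - ι (ℤ.+ m ℤ.* ℤ.+ suc n)          ≡⟨ cong -_ (ι-*-pos m (suc n)) ⟩
        - (ι (ℤ.+ m) * ι (ℤ.+ suc n))      ≡⟨ -‿distribʳ-* _ _ ⟩
        ι (ℤ.+ m) * ι -[1+ n ]           ∎
        where open ≡-Reasoning

    ι-* : ∀ m n → ι (m ℤ.* n) ≡ ι m * ι n
    ι-* (ℤ.+ m) n = ι-*-posˡ m n
    ι-* -[1+ m ] n = begin
        ι ((ℤ.- ℤ.+ suc m) ℤ.* n)      ≡⟨ cong ι (sym (ℤP.neg-distribˡ-* (ℤ.+ suc m) n)) ⟩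
        ι (ℤ.- (ℤ.+ suc m ℤ.* n))      ≡⟨ ι-neg (ℤ.+ suc m ℤ.* n) ⟩
        - ι (ℤ.+ suc m ℤ.* n)          ≡⟨ cong -_ (ι-*-posˡ (suc m) n) ⟩
        - (ι (ℤ.+ suc m) * ι n)        ≡⟨ -‿distribˡ-* _ _ ⟩
        ι -[1+ m ] * ι n             ∎
        where open ≡-Reasoning

  -- A polynomial in normal form is a list of terms sorted by monomial, a monomial being the sorted
  -- list of its variables.
  module Polynomials where
    infixl 6 _:+_ _:-_
    infixl 7 _:*_
    infix 8 :-_
    infix 4 _:=_

    data Expr : Set where
      _:+_ _:*_ : Expr → Expr → Expr
      :-_ : Expr → Expr
      con : ℕ → Expr
      var : ℕ → Expr

    _:-_ : Expr → Expr → Expr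
    e :- f = e :+ :- f

    _:=_ : Expr → Expr → Expr × Expr
    _:=_ = _,_

    data Comparison (m n : List ℕ) : Set where
      less greater : Comparison m n
      equal : m ≡ n → Comparison m n

    compare : ∀ m n → Comparison m n
    compare [] [] = equal refl
    compare [] (_ ∷ _) = less
    compare (_ ∷ _) [] = greater
    compare (i ∷ m) (j ∷ n) with i ℕ.≟ j
    ... | no _ = if i ℕ.<ᵇ j then less else greater
    ... | yes refl with compare m n
    ...   | less = less
    ...   | greater = greater
    ...   | equal refl = equal refl

    mergeInto : ℕ → List ℕ → List ℕ
    mergeInto i [] = i ∷ []
    mergeInto i (j ∷ m) = if i ℕ.<ᵇ j then i ∷ j ∷ m else j ∷ mergeInto i m

    merge : List ℕ → List ℕ → List ℕ
    merge [] n = n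
    merge (i ∷ m) n = mergeInto i (merge m n)

    insert : ℤ → List ℕ → List (ℤ × List ℕ) → List (ℤ × List ℕ)
    insert c m [] = (c , m) ∷ []
    insert c m ((b , n) ∷ p) with compare m n
    ... | less = (c , m) ∷ (b , n) ∷ p
    ... | greater = (b , n) ∷ insert c m p
    ... | equal _ = (c ℤ.+ b , n) ∷ p

    sum product : List (ℤ × List ℕ) → List (ℤ × List ℕ) → List (ℤ × List ℕ)
    sum [] q = q
    sum ((c , m) ∷ p) q = insert c m (sum p q)

    scale : ℤ → List ℕ → List (ℤ × List ℕ) → List (ℤ × List ℕ) → List (ℤ × List ℕ)
    scale c m [] r = r
    scale c m ((b , n) ∷ q) r = insert (c ℤ.* b) (merge m n) (scale c m q r)

    product [] q = []
    product ((c , m) ∷ p) q = scale c m q (product p q)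

    opposite : List (ℤ × List ℕ) → List (ℤ × List ℕ)
    opposite [] = []
    opposite ((c , m) ∷ p) = (ℤ.- c , m) ∷ opposite p

    normalForm : Expr → List (ℤ × List ℕ)
    normalForm (e :+ f) = sum (normalForm e) (normalForm f)
    normalForm (e :* f) = product (normalForm e) (normalForm f)
    normalForm (:- e) = opposite (normalForm e)
    normalForm (con n) = (ℤ.+ n , []) ∷ []
    normalForm (var i) = (ℤ.+ 1 , i ∷ []) ∷ []

    -- Cancelled terms stay in a normal form with coefficient 0, so vanishing is tested coefficient
    -- by coefficient.
    allZero : List (ℤ × List ℕ) → Bool
    allZero [] = true
    allZero ((ℤ.+ zero , _) ∷ p) = allZero p
    allZero _ = false

    module Soundness {F : Set} {_+_ _*_ : F → F → F} { -_ : F → F} {0# 1# : F}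
      (isCommutativeRing : IsCommutativeRing _≡_ _+_ _*_ -_ 0# 1#) (ρ : List F) where
      open FromIntegers isCommutativeRing
      open CommutativeRing commutativeRing
        using (ring; +-comm; +-assoc; *-comm; *-assoc; +-identityˡ; +-identityʳ; *-identityˡ; *-identityʳ; zeroˡ; zeroʳ; distribˡ; distribʳ; -‿inverseʳ)
      open import Algebra.Properties.Ring ring using (-‿distribˡ-*; -‿+-comm; -0#≈0#)
      open ≡-Reasoning

      lookup : ℕ → List F → F
      lookup _ [] = 0#
      lookup zero (x ∷ _) = x
      lookup (suc i) (_ ∷ xs) = lookup i xs

      ⟦_⟧ : Expr → F
      ⟦ e :+ f ⟧ = ⟦ e ⟧ + ⟦ f ⟧
      ⟦ e :* f ⟧ = ⟦ e ⟧ * ⟦ f ⟧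
      ⟦ :- e ⟧ = - ⟦ e ⟧
      ⟦ con n ⟧ = ι (ℤ.+ n)
      ⟦ var i ⟧ = lookup i ρ

      ⟦_⟧ᵐ : List ℕ → F
      ⟦ [] ⟧ᵐ = 1#
      ⟦ i ∷ m ⟧ᵐ = lookup i ρ * ⟦ m ⟧ᵐ

      ⟦_⟧ᵖ : List (ℤ × List ℕ) → F
      ⟦ [] ⟧ᵖ = 0#
      ⟦ (c , m) ∷ p ⟧ᵖ = (ι c * ⟦ m ⟧ᵐ) + ⟦ p ⟧ᵖ

      private
        swap+ : ∀ x y z → x + (y + z) ≡ y + (x + z)
        swap+ x y z = trans (sym (+-assoc x y z)) (trans (cong (_+ z) (+-comm x y)) (+-assoc y x z))

        swap* : ∀ x y z → x * (y * z) ≡ y * (x * z)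
        swap* x y z = trans (sym (*-assoc x y z)) (trans (cong (_* z) (*-comm x y)) (*-assoc y x z))

      mergeInto-sound : ∀ i m → ⟦ mergeInto i m ⟧ᵐ ≡ lookup i ρ * ⟦ m ⟧ᵐ
      mergeInto-sound i [] = refl
      mergeInto-sound i (j ∷ m) with i ℕ.<ᵇ j
      ... | true = refl
      ... | false = trans (cong (lookup j ρ *_) (mergeInto-sound i m)) (swap* _ _ _)

      merge-sound : ∀ m n → ⟦ merge m n ⟧ᵐ ≡ ⟦ m ⟧ᵐ * ⟦ n ⟧ᵐ
      merge-sound [] n = sym (*-identityˡ _)
      merge-sound (i ∷ m) n = trans (mergeInto-sound i (merge m n))
        (trans (cong (lookup i ρ *_) (merge-sound m n)) (sym (*-assoc _ _ _)))

      insert-sound : ∀ c m p → ⟦ insert c m p ⟧ᵖ ≡ (ι c * ⟦ m ⟧ᵐ) + ⟦ p ⟧ᵖ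
      insert-sound c m [] = refl
      insert-sound c m ((b , n) ∷ p) with compare m n
      ... | less = refl
      ... | greater = trans (cong ((ι b * ⟦ n ⟧ᵐ) +_) (insert-sound c m p)) (swap+ _ _ _)
      ... | equal refl = begin
        (ι (c ℤ.+ b) * ⟦ n ⟧ᵐ) + ⟦ p ⟧ᵖ                ≡⟨ cong (λ k → (k * ⟦ n ⟧ᵐ) + ⟦ p ⟧ᵖ) (ι-+ c b) ⟩
        ((ι c + ι b) * ⟦ n ⟧ᵐ) + ⟦ p ⟧ᵖ                ≡⟨ cong (_+ ⟦ p ⟧ᵖ) (distribʳ _ _ _) ⟩
        ((ι c * ⟦ n ⟧ᵐ) + (ι b * ⟦ n ⟧ᵐ)) + ⟦ p ⟧ᵖ     ≡⟨ +-assoc _ _ _ ⟩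
        (ι c * ⟦ n ⟧ᵐ) + ((ι b * ⟦ n ⟧ᵐ) + ⟦ p ⟧ᵖ)     ∎

      sum-sound : ∀ p q → ⟦ sum p q ⟧ᵖ ≡ ⟦ p ⟧ᵖ + ⟦ q ⟧ᵖ
      sum-sound [] q = sym (+-identityˡ _)
      sum-sound ((c , m) ∷ p) q = trans (insert-sound c m (sum p q))
        (trans (cong ((ι c * ⟦ m ⟧ᵐ) +_) (sum-sound p q)) (sym (+-assoc _ _ _)))

      scale-sound : ∀ c m q r → ⟦ scale c m q r ⟧ᵖ ≡ ((ι c * ⟦ m ⟧ᵐ) * ⟦ q ⟧ᵖ) + ⟦ r ⟧ᵖ
      scale-sound c m [] r = sym (trans (cong (_+ ⟦ r ⟧ᵖ) (zeroʳ _)) (+-identityˡ _))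
      scale-sound c m ((b , n) ∷ q) r = begin
        ⟦ insert (c ℤ.* b) (merge m n) (scale c m q r) ⟧ᵖ
          ≡⟨ insert-sound (c ℤ.* b) (merge m n) (scale c m q r) ⟩
        (ι (c ℤ.* b) * ⟦ merge m n ⟧ᵐ) + ⟦ scale c m q r ⟧ᵖ
          ≡⟨ cong₂ _+_ (trans (cong₂ _*_ (ι-* c b) (merge-sound m n))
               (trans (*-assoc _ _ _) (trans (cong (ι c *_) (swap* _ _ _)) (sym (*-assoc _ _ _)))))
               (scale-sound c m q r) ⟩
        (t * (ι b * ⟦ n ⟧ᵐ)) + ((t * ⟦ q ⟧ᵖ) + ⟦ r ⟧ᵖ)
          ≡⟨ sym (+-assoc _ _ _) ⟩
        ((t * (ι b * ⟦ n ⟧ᵐ)) + (t * ⟦ q ⟧ᵖ)) + ⟦ r ⟧ᵖ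
          ≡⟨ cong (_+ ⟦ r ⟧ᵖ) (sym (distribˡ t _ _)) ⟩
        (t * ((ι b * ⟦ n ⟧ᵐ) + ⟦ q ⟧ᵖ)) + ⟦ r ⟧ᵖ ∎
        where t = ι c * ⟦ m ⟧ᵐ

      product-sound : ∀ p q → ⟦ product p q ⟧ᵖ ≡ ⟦ p ⟧ᵖ * ⟦ q ⟧ᵖ
      product-sound [] q = sym (zeroˡ _)
      product-sound ((c , m) ∷ p) q = trans (scale-sound c m q (product p q))
        (trans (cong (((ι c * ⟦ m ⟧ᵐ) * ⟦ q ⟧ᵖ) +_) (product-sound p q)) (sym (distribʳ _ _ _)))

      opposite-sound : ∀ p → ⟦ opposite p ⟧ᵖ ≡ - ⟦ p ⟧ᵖ
      opposite-sound [] = sym -0#≈0#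
      opposite-sound ((c , m) ∷ p) = trans
        (cong₂ _+_ (trans (cong (_* ⟦ m ⟧ᵐ) (ι-neg c)) (sym (-‿distribˡ-* _ _))) (opposite-sound p))
        (-‿+-comm _ _)

      normalForm-sound : ∀ e → ⟦ normalForm e ⟧ᵖ ≡ ⟦ e ⟧
      normalForm-sound (e :+ f) = trans (sum-sound (normalForm e) (normalForm f))
        (cong₂ _+_ (normalForm-sound e) (normalForm-sound f))
      normalForm-sound (e :* f) = trans (product-sound (normalForm e) (normalForm f))
        (cong₂ _*_ (normalForm-sound e) (normalForm-sound f))
      normalForm-sound (:- e) = trans (opposite-sound (normalForm e)) (cong -_ (normalForm-sound e))
      normalForm-sound (con n) = trans (+-identityʳ _) (*-identityʳ _)
      normalForm-sound (var i) = trans (+-identityʳ _) (trans (*-identityˡ _) (*-identityʳ _))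

      allZero-sound : ∀ p → allZero p ≡ true → ⟦ p ⟧ᵖ ≡ 0#
      allZero-sound [] _ = refl
      allZero-sound ((ℤ.+ zero , m) ∷ p) h = trans (cong₂ _+_ (zeroˡ _) (allZero-sound p h)) (+-identityˡ _)
      allZero-sound ((ℤ.+ suc _ , _) ∷ _) ()
      allZero-sound ((-[1+ _ ] , _) ∷ _) ()

      prove : ∀ e f → allZero (normalForm (e :- f)) ≡ true → ⟦ e ⟧ ≡ ⟦ f ⟧
      prove e f h = begin
        ⟦ e ⟧                       ≡⟨ sym (+-identityʳ _) ⟩
        ⟦ e ⟧ + 0#                  ≡⟨ cong (⟦ e ⟧ +_) (sym (trans (+-comm _ _) (-‿inverseʳ _))) ⟩
        ⟦ e ⟧ + ((- ⟦ f ⟧) + ⟦ f ⟧)   ≡⟨ sym (+-assoc _ _ _) ⟩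
        (⟦ e ⟧ + (- ⟦ f ⟧)) + ⟦ f ⟧   ≡⟨ cong (_+ ⟦ f ⟧) (trans (sym (normalForm-sound (e :- f)))
                                       (allZero-sound (normalForm (e :- f)) h)) ⟩
        0# + ⟦ f ⟧                  ≡⟨ +-identityˡ _ ⟩
        ⟦ f ⟧                       ∎

    Π : {F : Set} → ∀ n → (Vec F n → Set) → Set
    Π zero P = P []
    Π (suc n) P = ∀ x → Π n (λ xs → P (x ∷ xs))

    curryΠ : {F : Set} → ∀ n {P : Vec F n → Set} → (∀ xs → P xs) → Π n P
    curryΠ zero p = p []
    curryΠ (suc n) p = λ x → curryΠ n (λ xs → p (x ∷ xs))

    module Solver {F : Set} {_+_ _*_ : F → F → F} { -_ : F → F} {0# 1# : F}
      (isCommutativeRing : IsCommutativeRing _≡_ _+_ _*_ -_ 0# 1#) where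
      open Soundness isCommutativeRing

      equation : ∀ n → N-ary n Expr (Expr × Expr) → Expr × Expr
      equation n f = f $ⁿ tabulate (λ i → var (toℕ i))

      -- The two sides agree as soon as all coefficients of their difference vanish, which is
      -- decided over ℤ without evaluating in F.
      solve : ∀ n (f : N-ary n Expr (Expr × Expr)) → allZero (normalForm (proj₁ (equation n f) :- proj₂ (equation n f))) ≡ true →
        Π n λ ρ → ⟦_⟧ (toList ρ) (proj₁ (equation n f)) ≡ ⟦_⟧ (toList ρ) (proj₂ (equation n f))
      solve n f h = curryΠ n λ ρ → prove (toList ρ) (proj₁ (equation n f)) (proj₂ (equation n f)) h

-- The cubic curve and its group law

module EllipticCurves where
  open FieldSolver
  open import Algebra.Bundles using (CommutativeRing)
  open import Data.Empty using (⊥-elim)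
  open import Data.Nat using (ℕ; zero; suc)
  open import Data.Product using (∃; _×_; _,_)
  open import Data.Sum using (_⊎_; inj₁; inj₂)
  open import Data.Unit using (⊤; tt)
  open import Relation.Binary.PropositionalEquality
  open import Relation.Nullary using (¬_; Dec; yes; no)

  module FieldLemmas (𝔽 : DecField) where
    open DecField 𝔽
    open CommutativeRing commutativeRing public
      using (+-comm; *-comm; +-identityˡ; +-identityʳ; *-identityˡ; *-identityʳ; zeroˡ; zeroʳ; -‿inverseʳ; -‿inverseˡ)

    open Polynomials public using (_:+_; _:*_; _:-_; :-_; con; _:=_)
    open Polynomials.Solver isCommutativeRing public using (solve)

    x-y≡0⇒x≡y : ∀ {x y} → x - y ≡ 0# → x ≡ y
    x-y≡0⇒x≡y {x} {y} p = trans (x≡x-y+y x y) (trans (cong (_+ y) p) (+-identityˡ y))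
      where
      x≡x-y+y = solve 2 (λ x y → x := x :- y :+ y) refl

    x≡y⇒x-y≡0 : ∀ {x y} → x ≡ y → x - y ≡ 0#
    x≡y⇒x-y≡0 {x} refl = -‿inverseʳ x

    inv-* : ∀ {x} → x ≢ 0# → ∀ y → x * (y * inv x) ≡ y
    inv-* {x} x≢0 y = trans (rearrange x y (inv x)) (trans (cong (y *_) (*-inv x x≢0)) (*-identityʳ y))
      where
      rearrange = solve 3 (λ x y z → x :* (y :* z) := y :* (x :* z)) refl

    cancelˡ : ∀ {x y z} → x ≢ 0# → x * y ≡ x * z → y ≡ z
    cancelˡ {x} {y} {z} x≢0 p = trans (sym (simplify y)) (trans (cong (_* inv x) p) (simplify z))
      where
      rearrange = solve 3 (λ x y z → x :* y :* z := y :* (x :* z)) refl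
      simplify : ∀ y → x * y * inv x ≡ y
      simplify y = trans (rearrange x y (inv x)) (trans (cong (y *_) (*-inv x x≢0)) (*-identityʳ y))

    zeroProduct : ∀ {x y} → x ≢ 0# → x * y ≡ 0# → y ≡ 0#
    zeroProduct x≢0 p = cancelˡ x≢0 (trans p (sym (zeroʳ _)))

    *-≢0 : ∀ {x y} → x ≢ 0# → y ≢ 0# → x * y ≢ 0#
    *-≢0 x≢0 y≢0 p = y≢0 (zeroProduct x≢0 p)

    -- X ≡ Y follows once X - Y is a combination of the differences of known equations.
    linear₁ : ∀ {X Y} c {L R} → L ≡ R → X - Y ≡ c * (L - R) → X ≡ Y
    linear₁ c {L} refl h = x-y≡0⇒x≡y (trans h (vanish c L))
      where
      vanish = solve 2 (λ c L → c :* (L :- L) := con 0) refl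

    linear₂ : ∀ {X Y} c₁ {L₁ R₁} → L₁ ≡ R₁ → ∀ c₂ {L₂ R₂} → L₂ ≡ R₂ →
              X - Y ≡ c₁ * (L₁ - R₁) + c₂ * (L₂ - R₂) → X ≡ Y
    linear₂ {X} {Y} c₁ {L₁} e₁ c₂ {L₂} refl h = linear₁ {X} {Y} c₁ e₁ (trans h (vanish _ c₂ L₂))
      where
      vanish = solve 3 (λ z c L → z :+ c :* (L :- L) := z) refl

    linear₃ : ∀ {X Y} c₁ {L₁ R₁} → L₁ ≡ R₁ → ∀ c₂ {L₂ R₂} → L₂ ≡ R₂ → ∀ c₃ {L₃ R₃} → L₃ ≡ R₃ →
              X - Y ≡ c₁ * (L₁ - R₁) + c₂ * (L₂ - R₂) + c₃ * (L₃ - R₃) → X ≡ Y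
    linear₃ {X} {Y} c₁ e₁ c₂ e₂ c₃ {L₃} refl h = linear₂ {X} {Y} c₁ e₁ c₂ e₂ (trans h (vanish _ c₃ L₃))
      where
      vanish = solve 3 (λ z c L → z :+ c :* (L :- L) := z) refl

    linear₄ : ∀ {X Y} c₁ {L₁ R₁} → L₁ ≡ R₁ → ∀ c₂ {L₂ R₂} → L₂ ≡ R₂ → ∀ c₃ {L₃ R₃} → L₃ ≡ R₃ →
              ∀ c₄ {L₄ R₄} → L₄ ≡ R₄ →
              X - Y ≡ c₁ * (L₁ - R₁) + c₂ * (L₂ - R₂) + c₃ * (L₃ - R₃) + c₄ * (L₄ - R₄) → X ≡ Y
    linear₄ {X} {Y} c₁ e₁ c₂ e₂ c₃ e₃ c₄ {L₄} refl h = linear₃ {X} {Y} c₁ e₁ c₂ e₂ c₃ e₃ (trans h (vanish _ c₄ L₄))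
      where
      vanish = solve 3 (λ z c L → z :+ c :* (L :- L) := z) refl

    linear₅ : ∀ {X Y} c₁ {L₁ R₁} → L₁ ≡ R₁ → ∀ c₂ {L₂ R₂} → L₂ ≡ R₂ → ∀ c₃ {L₃ R₃} → L₃ ≡ R₃ →
              ∀ c₄ {L₄ R₄} → L₄ ≡ R₄ → ∀ c₅ {L₅ R₅} → L₅ ≡ R₅ →
              X - Y ≡ c₁ * (L₁ - R₁) + c₂ * (L₂ - R₂) + c₃ * (L₃ - R₃) + c₄ * (L₄ - R₄) + c₅ * (L₅ - R₅) → X ≡ Y
    linear₅ {X} {Y} c₁ e₁ c₂ e₂ c₃ e₃ c₄ e₄ c₅ {L₅} refl h = linear₄ {X} {Y} c₁ e₁ c₂ e₂ c₃ e₃ c₄ e₄ (trans h (vanish _ c₅ L₅))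
      where
      vanish = solve 3 (λ z c L → z :+ c :* (L :- L) := z) refl

  CharacteristicNot2 : DecField → Set
  CharacteristicNot2 𝔽 = 1# + 1# ≢ 0#
    where
    open DecField 𝔽

  module Curve (𝔽 : DecField) (A B C : DecField.F 𝔽) where
    open DecField 𝔽
    open FieldLemmas 𝔽

    cubic : F → F
    cubic x = A * x * x * x + B * x * x + C * x + 1#

    -- The quotient of cubic x - cubic y by x - y, which on the diagonal is the derivative; one
    -- expression thus serves chords and tangents.
    dividedDifference : F → F → F
    dividedDifference x y = A * (x * x + x * y + y * y) + B * (x + y) + C

    Nonsingular : Set
    Nonsingular = ∀ x → cubic x ≡ 0# → dividedDifference x x ≢ 0#

    data Point : Set where
      O : Point
      aff : F → F → Point

    aff-injective : ∀ {x y u v} → aff x y ≡ aff u v → x ≡ u × y ≡ v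
    aff-injective refl = refl , refl

    OnCurve : Point → Set
    OnCurve O = ⊤
    OnCurve (aff x y) = y * y ≡ cubic x

    third : F → F → F → F → Point
    third l x₁ y₁ x₂ =
      let x₃ = (l * l - B) * inv A - x₁ - x₂ in
      aff x₃ (- (y₁ + l * (x₃ - x₁)))

    infixl 6 _⊕_
    -- The case distinction enters the group law only through `opposite-⊕`, `line-⊕` and the
    -- identity laws; it is opened once more for the comparison with `Law`.
    opaque
      _⊕_ : Point → Point → Point
      O ⊕ Q = Q
      P ⊕ O = P
      aff x₁ y₁ ⊕ aff x₂ y₂ with x₁ ≟ x₂
      ... | no _ = third ((y₂ - y₁) * inv (x₂ - x₁)) x₁ y₁ x₂
      ... | yes _ with (y₁ + y₂) ≟ 0#
      ...   | yes _ = O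
      ...   | no _ = third (((1# + 1# + 1#) * A * x₁ * x₁ + (1# + 1#) * B * x₁ + C) * inv ((1# + 1#) * y₁)) x₁ y₁ x₁

    mul : ℕ → Point → Point
    mul zero P = O
    mul (suc n) P = P ⊕ mul n P

    neg : Point → Point
    neg O = O
    neg (aff x y) = aff x (- y)

    neg-neg : ∀ P → neg (neg P) ≡ P
    neg-neg O = refl
    neg-neg (aff x y) = cong (aff x) (involutive y)
      where
      involutive = solve 1 (λ y → :- (:- y) := y) refl

    neg-onCurve : ∀ P → OnCurve P → OnCurve (neg P)
    neg-onCurve O _ = tt
    neg-onCurve (aff x y) p = trans (square y) p
      where
      square = solve 1 (λ y → :- y :* :- y := y :* y) refl

    opaque
      unfolding _⊕_

      ⊕-identityˡ : ∀ P → O ⊕ P ≡ P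
      ⊕-identityˡ P = refl

      ⊕-identityʳ : ∀ P → P ⊕ O ≡ P
      ⊕-identityʳ O = refl
      ⊕-identityʳ (aff _ _) = refl

    Opposite : F → F → F → F → Set
    Opposite x₁ y₁ x₂ y₂ = x₁ ≡ x₂ × y₁ + y₂ ≡ 0#

    opposite? : ∀ x₁ y₁ x₂ y₂ → Dec (Opposite x₁ y₁ x₂ y₂)
    opposite? x₁ y₁ x₂ y₂ with x₁ ≟ x₂ | (y₁ + y₂) ≟ 0#
    ... | yes p | yes q = yes (p , q)
    ... | no ¬p | _ = no λ (p , _) → ¬p p
    ... | _ | no ¬q = no λ (_ , q) → ¬q q

    opaque
      unfolding _⊕_

      opposite-⊕ : ∀ {x₁ y₁ x₂ y₂} → Opposite x₁ y₁ x₂ y₂ → aff x₁ y₁ ⊕ aff x₂ y₂ ≡ O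
      opposite-⊕ {x₁} {y₁} {x₂} {y₂} (p , q) with x₁ ≟ x₂
      ... | no ¬p = ⊥-elim (¬p p)
      ... | yes _ with (y₁ + y₂) ≟ 0#
      ...   | yes _ = refl
      ...   | no ¬q = ⊥-elim (¬q q)

    opposite-sym : ∀ {x₁ y₁ x₂ y₂} → Opposite x₁ y₁ x₂ y₂ → Opposite x₂ y₂ x₁ y₁
    opposite-sym (p , q) = sym p , trans (+-comm _ _) q

    ⊕-inverseʳ : ∀ P → P ⊕ neg P ≡ O
    ⊕-inverseʳ O = ⊕-identityˡ O
    ⊕-inverseʳ (aff x y) = opposite-⊕ (refl , -‿inverseʳ y)

    -- The three points are the intersections, with multiplicity, of the curve with the line
    -- y = l x + m: cubic X - (l X + m)² = A (X - x₁)(X - x₂)(X - x₃).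
    record Line (l m x₁ y₁ x₂ y₂ x₃ y₃ : F) : Set where
      constructor mkLine
      field
        on₁ : y₁ ≡ l * x₁ + m
        on₂ : y₂ ≡ l * x₂ + m
        on₃ : y₃ ≡ l * x₃ + m
        vieta₁ : A * (x₁ + x₂ + x₃) ≡ l * l - B
        vieta₂ : A * (x₁ * x₂ + x₁ * x₃ + x₂ * x₃) ≡ C - (1# + 1#) * (l * m)
        vieta₃ : A * (x₁ * x₂ * x₃) ≡ m * m - 1#
    open Line

    module _ {l m x₁ y₁ x₂ y₂ x₃ y₃ : F} (L : Line l m x₁ y₁ x₂ y₂ x₃ y₃) where

      swap₁₂ : Line l m x₂ y₂ x₁ y₁ x₃ y₃
      swap₁₂ = mkLine (on₂ L) (on₁ L) (on₃ L)
        (trans (s₁ A x₂ x₁ x₃) (vieta₁ L)) (trans (s₂ A x₂ x₁ x₃) (vieta₂ L)) (trans (s₃ A x₂ x₁ x₃) (vieta₃ L))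
        where
        s₁ = solve 4 (λ A x y z → A :* (x :+ y :+ z) := A :* (y :+ x :+ z)) refl
        s₂ = solve 4 (λ A x y z → A :* (x :* y :+ x :* z :+ y :* z) := A :* (y :* x :+ y :* z :+ x :* z)) refl
        s₃ = solve 4 (λ A x y z → A :* (x :* y :* z) := A :* (y :* x :* z)) refl

      swap₂₃ : Line l m x₁ y₁ x₃ y₃ x₂ y₂
      swap₂₃ = mkLine (on₁ L) (on₃ L) (on₂ L)
        (trans (s₁ A x₁ x₃ x₂) (vieta₁ L)) (trans (s₂ A x₁ x₃ x₂) (vieta₂ L)) (trans (s₃ A x₁ x₃ x₂) (vieta₃ L))
        where
        s₁ = solve 4 (λ A x y z → A :* (x :+ y :+ z) := A :* (x :+ z :+ y)) refl
        s₂ = solve 4 (λ A x y z → A :* (x :* y :+ x :* z :+ y :* z) := A :* (x :* z :+ x :* y :+ z :* y)) refl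
        s₃ = solve 4 (λ A x y z → A :* (x :* y :* z) := A :* (x :* z :* y)) refl

      negate : Line (- l) (- m) x₁ (- y₁) x₂ (- y₂) x₃ (- y₃)
      negate = mkLine (on (on₁ L)) (on (on₂ L)) (on (on₃ L))
        (trans (vieta₁ L) (sq l B)) (trans (vieta₂ L) (product C l m)) (trans (vieta₃ L) (sq m 1#))
        where
        on : ∀ {x y} → y ≡ l * x + m → - y ≡ - l * x + - m
        on {x} refl = solve 3 (λ l x m → :- (l :* x :+ m) := :- l :* x :- m) refl l x m
        sq = solve 2 (λ l B → l :* l :- B := :- l :* :- l :- B) refl
        product = solve 3 (λ C l m → C :- con 2 :* (l :* m) := C :- con 2 :* (:- l :* :- m)) refl

      onCurve₁ : y₁ * y₁ ≡ cubic x₁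
      onCurve₁ = linear₄ (y₁ + (l * x₁ + m)) (on₁ L) (- (x₁ * x₁)) (vieta₁ L) x₁ (vieta₂ L) (- 1#) (vieta₃ L) (solve 9 (λ y₁ A x₁ B C l m x₂ x₃ → y₁
          :* y₁ :- (A :* x₁ :* x₁ :* x₁ :+ B :* x₁ :* x₁ :+ C :* x₁ :+ con 1) := (y₁ :+ (l :* x₁ :+ m)) :* (y₁ :- (l
          :* x₁ :+ m)) :+ :- (x₁ :* x₁) :* (A :* (x₁ :+ x₂ :+ x₃) :- (l :* l :- B)) :+ x₁ :* (A :* (x₁ :* x₂ :+ x₁ :* x₃
          :+ x₂ :* x₃) :- (C :- con 2 :* (l :* m))) :+ :- con 1 :* (A :* (x₁ :* x₂ :* x₃) :- (m :* m :- con 1)))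
          refl y₁ A x₁ B C l m x₂ x₃)

      chordSlope : y₁ - y₂ ≡ l * (x₁ - x₂)
      chordSlope = linear₂ 1# (on₁ L) (- 1#) (on₂ L) (solve 6 (λ y₁ y₂ l x₁ x₂ m → y₁ :- y₂ :- l :* (x₁ :- x₂)
          := con 1 :* (y₁ :- (l :* x₁ :+ m)) :+ :- con 1 :* (y₂ :- (l :* x₂ :+ m))) refl y₁ y₂ l x₁ x₂ m)

      -- This is y₁² - y₂² = cubic x₁ - cubic x₂ divided by x₁ - x₂. Unlike `chordSlope` it still
      -- determines l when the two points coincide.
      tangentSlope : l * (y₁ + y₂) ≡ dividedDifference x₁ x₂
      tangentSlope = linear₄ l (on₁ L) l (on₂ L) (- (x₁ + x₂)) (vieta₁ L) 1# (vieta₂ L) (solve 10 (λ l y₁ y₂ A x₁ x₂ B C m x₃ → l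
          :* (y₁ :+ y₂) :- (A :* (x₁ :* x₁ :+ x₁ :* x₂ :+ x₂ :* x₂) :+ B :* (x₁ :+ x₂) :+ C) := l :* (y₁ :- (l :* x₁
          :+ m)) :+ l :* (y₂ :- (l :* x₂ :+ m)) :+ :- (x₁ :+ x₂) :* (A :* (x₁ :+ x₂ :+ x₃) :- (l :* l :- B)) :+ con 1
          :* (A :* (x₁ :* x₂ :+ x₁ :* x₃ :+ x₂ :* x₃) :- (C :- con 2 :* (l :* m)))) refl l y₁ y₂ A x₁ x₂ B C m x₃)

    rotate : ∀ {l m x₁ y₁ x₂ y₂ x₃ y₃} → Line l m x₁ y₁ x₂ y₂ x₃ y₃ → Line l m x₃ y₃ x₁ y₁ x₂ y₂
    rotate L = swap₁₂ (swap₂₃ L)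

    module GroupLaw (A≢0 : A ≢ 0#) (2≢0 : CharacteristicNot2 𝔽) (nonsingular : Nonsingular) where

      third-line : ∀ {l m x₁ y₁ x₂ y₂ x₃ y₃} → Line l m x₁ y₁ x₂ y₂ x₃ y₃ →
                   third l x₁ y₁ x₂ ≡ aff x₃ (- y₃)
      third-line {l} {m} {x₁} {y₁} {x₂} {y₂} {x₃} {y₃} L = cong₂ aff x-eq y-eq
        where
        i = inv A
        x-eq : (l * l - B) * i - x₁ - x₂ ≡ x₃
        x-eq = linear₂ (- i) (vieta₁ L) (x₁ + x₂ + x₃) (*-inv A A≢0) (solve 7 (λ l B i x₁ x₂ x₃ A → (l :* l :- B) :* i
            :- x₁ :- x₂ :- x₃ := :- i :* (A :* (x₁ :+ x₂ :+ x₃) :- (l :* l :- B)) :+ (x₁ :+ x₂ :+ x₃) :* (A :* i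
            :- con 1)) refl l B i x₁ x₂ x₃ A)
        y-eq : - (y₁ + l * ((l * l - B) * i - x₁ - x₂ - x₁)) ≡ - y₃
        y-eq = linear₃ (- l) x-eq 1# (on₃ L) (- 1#) (on₁ L) (solve 9 (λ y₁ l B i x₁ x₂ y₃ x₃ m → :- (y₁ :+ l :* ((l :* l
            :- B) :* i :- x₁ :- x₂ :- x₁)) :- :- y₃ := :- l :* ((l :* l :- B) :* i :- x₁ :- x₂ :- x₃) :+ con 1 :* (y₃
            :- (l :* x₃ :+ m)) :+ :- con 1 :* (y₁ :- (l :* x₁ :+ m))) refl y₁ l B i x₁ x₂ y₃ x₃ m)

      opaque
        unfolding _⊕_

        line-⊕ : ∀ {l m x₁ y₁ x₂ y₂ x₃ y₃} → Line l m x₁ y₁ x₂ y₂ x₃ y₃ → ¬ Opposite x₁ y₁ x₂ y₂ →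
                 aff x₁ y₁ ⊕ aff x₂ y₂ ≡ aff x₃ (- y₃)
        line-⊕ {l} {m} {x₁} {y₁} {x₂} {y₂} {x₃} {y₃} L ¬opp with x₁ ≟ x₂
        ... | no x₁≢x₂ = trans (cong (λ k → third k x₁ y₁ x₂) slope) (third-line L)
          where
          d≢0 : x₂ - x₁ ≢ 0#
          d≢0 p = x₁≢x₂ (sym (x-y≡0⇒x≡y p))
          slope : (y₂ - y₁) * inv (x₂ - x₁) ≡ l
          slope = cancelˡ d≢0 (trans (inv-* d≢0 (y₂ - y₁)) (linear₁ (- 1#) (chordSlope L) (solve 5 (λ y₂ y₁ x₂ x₁ l → y₂
              :- y₁ :- (x₂ :- x₁) :* l := :- con 1 :* (y₁ :- y₂ :- l :* (x₁ :- x₂))) refl y₂ y₁ x₂ x₁ l)))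
        ... | yes refl with (y₁ + y₂) ≟ 0#
        ...   | yes q = ⊥-elim (¬opp (refl , q))
        ...   | no y₁+y₂≢0 = trans (cong (λ k → third k x₁ y₁ x₁) slope) (third-line L)
          where
          same : y₁ ≡ y₂
          same = trans (on₁ L) (sym (on₂ L))
          2y≢0 : (1# + 1#) * y₁ ≢ 0#
          2y≢0 p = y₁+y₂≢0 (linear₂ 1# p (- 1#) same (solve 2 (λ y₁ y₂ → y₁ :+ y₂ :- con 0 := con 1 :* (con 2
              :* y₁ :- con 0) :+ :- con 1 :* (y₁ :- y₂)) refl y₁ y₂))
          slope : ((1# + 1# + 1#) * A * x₁ * x₁ + (1# + 1#) * B * x₁ + C) * inv ((1# + 1#) * y₁) ≡ l
          slope = cancelˡ 2y≢0 (trans (inv-* 2y≢0 _)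
            (linear₂ (- 1#) (tangentSlope L) (- l) same (solve 7 (λ A x₁ B C y₁ l y₂ → con 3 :* A :* x₁ :* x₁
                :+ con 2 :* B :* x₁ :+ C :- con 2 :* y₁ :* l := :- con 1 :* (l :* (y₁ :+ y₂) :- (A :* (x₁ :* x₁
                :+ x₁ :* x₁ :+ x₁ :* x₁) :+ B :* (x₁ :+ x₁) :+ C)) :+ :- l :* (y₁ :- y₂)) refl A x₁ B C y₁ l y₂)))

      -- If x₁ ≠ x₂ the first equation defines l, and if x₁ = x₂ the second does, because y₁ + y₂ is
      -- then nonzero. The other equation follows from the difference of the two curve equations.
      slopeOf : ∀ {x₁ y₁ x₂ y₂} → y₁ * y₁ ≡ cubic x₁ → y₂ * y₂ ≡ cubic x₂ → ¬ Opposite x₁ y₁ x₂ y₂ →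
                ∃ λ l → y₁ - y₂ ≡ l * (x₁ - x₂) × l * (y₁ + y₂) ≡ dividedDifference x₁ x₂
      slopeOf {x₁} {y₁} {x₂} {y₂} p₁ p₂ ¬opp with x₁ ≟ x₂
      ... | no x₁≢x₂ = l , sym (trans (*-comm l (x₁ - x₂)) chord) ,
          cancelˡ d≢0 (linear₃ (y₁ + y₂) chord 1# p₁ (- 1#) p₂ (solve 8 (λ x₁ x₂ y₁ y₂ i A B C → (x₁ :- x₂) :* ((y₁
              :- y₂) :* i :* (y₁ :+ y₂)) :- (x₁ :- x₂) :* (A :* (x₁ :* x₁ :+ x₁ :* x₂ :+ x₂ :* x₂) :+ B :* (x₁ :+ x₂)
              :+ C) := (y₁ :+ y₂) :* ((x₁ :- x₂) :* ((y₁ :- y₂) :* i) :- (y₁ :- y₂)) :+ con 1 :* (y₁ :* y₁ :- (A :* x₁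
              :* x₁ :* x₁ :+ B :* x₁ :* x₁ :+ C :* x₁ :+ con 1)) :+ :- con 1 :* (y₂ :* y₂ :- (A :* x₂ :* x₂ :* x₂
              :+ B :* x₂ :* x₂ :+ C :* x₂ :+ con 1))) refl x₁ x₂ y₁ y₂ (inv (x₁ - x₂)) A B C))
        where
        d≢0 : x₁ - x₂ ≢ 0#
        d≢0 p = x₁≢x₂ (x-y≡0⇒x≡y p)
        l = (y₁ - y₂) * inv (x₁ - x₂)
        chord : (x₁ - x₂) * l ≡ y₁ - y₂
        chord = inv-* d≢0 (y₁ - y₂)
      ... | yes refl = l , linear₁ 1# same (solve 7 (λ y₁ y₂ A x₁ B C i → y₁ :- y₂ :- (A :* (x₁ :* x₁ :+ x₁ :* x₁ :+ x₁
          :* x₁) :+ B :* (x₁ :+ x₁) :+ C) :* i :* (x₁ :- x₁) := con 1 :* (y₁ :- y₂))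
          refl y₁ y₂ A x₁ B C (inv (y₁ + y₂))) ,
          trans (*-comm l (y₁ + y₂)) (inv-* s≢0 _)
        where
        s≢0 : y₁ + y₂ ≢ 0#
        s≢0 q = ¬opp (refl , q)
        l = dividedDifference x₁ x₁ * inv (y₁ + y₂)
        same : y₁ ≡ y₂
        same = cancelˡ s≢0 (linear₂ 1# p₁ (- 1#) p₂ (solve 6 (λ y₁ y₂ A x₁ B C → (y₁ :+ y₂) :* y₁ :- (y₁ :+ y₂) :* y₂
            := con 1 :* (y₁ :* y₁ :- (A :* x₁ :* x₁ :* x₁ :+ B :* x₁ :* x₁ :+ C :* x₁ :+ con 1)) :+ :- con 1
            :* (y₂ :* y₂ :- (A :* x₁ :* x₁ :* x₁ :+ B :* x₁ :* x₁ :+ C :* x₁ :+ con 1))) refl y₁ y₂ A x₁ B C))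

      lineFromSlope : ∀ {l m x₁ y₁ x₂ y₂ x₃} → y₁ * y₁ ≡ cubic x₁ →
        y₁ - y₂ ≡ l * (x₁ - x₂) → l * (y₁ + y₂) ≡ dividedDifference x₁ x₂ →
        y₁ ≡ l * x₁ + m → A * (x₁ + x₂ + x₃) ≡ l * l - B →
        Line l m x₁ y₁ x₂ y₂ x₃ (l * x₃ + m)
      lineFromSlope {l} {m} {x₁} {y₁} {x₂} {y₂} {x₃} p₁ chord tangent o₁ v₁ = mkLine o₁ o₂ refl v₁ v₂ v₃
        where
        o₂ : y₂ ≡ l * x₂ + m
        o₂ = linear₂ (- 1#) chord 1# o₁ (solve 6 (λ y₂ l x₂ m y₁ x₁ → y₂ :- (l :* x₂ :+ m) := :- con 1 :* (y₁ :- y₂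
            :- l :* (x₁ :- x₂)) :+ con 1 :* (y₁ :- (l :* x₁ :+ m))) refl y₂ l x₂ m y₁ x₁)
        v₂ : A * (x₁ * x₂ + x₁ * x₃ + x₂ * x₃) ≡ C - (1# + 1#) * (l * m)
        v₂ = linear₄ (x₁ + x₂) v₁ 1# tangent (- l) o₁ (- l) o₂ (solve 10 (λ A x₁ x₂ x₃ C l m B y₁ y₂ → A :* (x₁ :* x₂
            :+ x₁ :* x₃ :+ x₂ :* x₃) :- (C :- con 2 :* (l :* m)) := (x₁ :+ x₂) :* (A :* (x₁ :+ x₂ :+ x₃) :- (l :* l
            :- B)) :+ con 1 :* (l :* (y₁ :+ y₂) :- (A :* (x₁ :* x₁ :+ x₁ :* x₂ :+ x₂ :* x₂) :+ B :* (x₁ :+ x₂) :+ C))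
            :+ :- l :* (y₁ :- (l :* x₁ :+ m)) :+ :- l :* (y₂ :- (l :* x₂ :+ m))) refl A x₁ x₂ x₃ C l m B y₁ y₂)
        v₃ : A * (x₁ * x₂ * x₃) ≡ m * m - 1#
        v₃ = linear₄ (y₁ + (l * x₁ + m)) o₁ (- (x₁ * x₁)) v₁ x₁ v₂ (- 1#) p₁ (solve 9 (λ A x₁ x₂ x₃ m y₁ l B C → A
            :* (x₁ :* x₂ :* x₃) :- (m :* m :- con 1) := (y₁ :+ (l :* x₁ :+ m)) :* (y₁ :- (l :* x₁ :+ m)) :+ :- (x₁
            :* x₁) :* (A :* (x₁ :+ x₂ :+ x₃) :- (l :* l :- B)) :+ x₁ :* (A :* (x₁ :* x₂ :+ x₁ :* x₃ :+ x₂ :* x₃) :- (C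
            :- con 2 :* (l :* m))) :+ :- con 1 :* (y₁ :* y₁ :- (A :* x₁ :* x₁ :* x₁ :+ B :* x₁ :* x₁ :+ C :* x₁
            :+ con 1))) refl A x₁ x₂ x₃ m y₁ l B C)

      abstract
        lineThrough : ∀ {x₁ y₁ x₂ y₂} → y₁ * y₁ ≡ cubic x₁ → y₂ * y₂ ≡ cubic x₂ → ¬ Opposite x₁ y₁ x₂ y₂ →
                      ∃ λ l → ∃ λ m → ∃ λ x₃ → ∃ λ y₃ → Line l m x₁ y₁ x₂ y₂ x₃ y₃
        lineThrough {x₁} {y₁} {x₂} {y₂} p₁ p₂ ¬opp =
          let (l , chord , tangent) = slopeOf p₁ p₂ ¬opp in
          l , y₁ - l * x₁ , (l * l - B) * inv A - x₁ - x₂ , _ ,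
          lineFromSlope p₁ chord tangent (line x₁ y₁ l) (sum A B x₁ x₂ l (inv A) (*-inv A A≢0))
          where
          line : ∀ x₁ y₁ l → y₁ ≡ l * x₁ + (y₁ - l * x₁)
          line = solve 3 (λ x₁ y₁ l → y₁ := l :* x₁ :+ (y₁ :- l :* x₁)) refl
          sum : ∀ A B x₁ x₂ l i → A * i ≡ 1# → A * (x₁ + x₂ + ((l * l - B) * i - x₁ - x₂)) ≡ l * l - B
          sum A B x₁ x₂ l i A*i≡1 = linear₁ (l * l - B) A*i≡1 (solve 6 (λ A x₁ x₂ l B i → A :* (x₁ :+ x₂ :+ ((l :* l
              :- B) :* i :- x₁ :- x₂)) :- (l :* l :- B) := (l :* l :- B) :* (A :* i :- con 1)) refl A x₁ x₂ l B i)

      ⊕-closed : ∀ P Q → OnCurve P → OnCurve Q → OnCurve (P ⊕ Q)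
      ⊕-closed O Q _ q = subst OnCurve (sym (⊕-identityˡ Q)) q
      ⊕-closed P@(aff _ _) O p _ = subst OnCurve (sym (⊕-identityʳ P)) p
      ⊕-closed (aff x₁ y₁) (aff x₂ y₂) p q with opposite? x₁ y₁ x₂ y₂
      ... | yes opp = subst OnCurve (sym (opposite-⊕ opp)) tt
      ... | no ¬opp with lineThrough p q ¬opp
      ...   | l , m , x₃ , y₃ , L = subst OnCurve (sym (line-⊕ L ¬opp))
                (neg-onCurve (aff x₃ y₃) (onCurve₁ (rotate L)))

      ⊕-comm : ∀ P Q → OnCurve P → OnCurve Q → P ⊕ Q ≡ Q ⊕ P
      ⊕-comm O Q _ _ = trans (⊕-identityˡ Q) (sym (⊕-identityʳ Q))
      ⊕-comm P@(aff _ _) O _ _ = trans (⊕-identityʳ P) (sym (⊕-identityˡ P))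
      ⊕-comm (aff x₁ y₁) (aff x₂ y₂) p q with opposite? x₁ y₁ x₂ y₂
      ... | yes opp = trans (opposite-⊕ opp) (sym (opposite-⊕ (opposite-sym opp)))
      ... | no ¬opp with lineThrough p q ¬opp
      ...   | l , m , x₃ , y₃ , L = trans (line-⊕ L ¬opp)
                (sym (line-⊕ (swap₁₂ L) (λ o → ¬opp (opposite-sym o))))

      2y≡0⇒y≡0 : ∀ {y} → y + y ≡ 0# → y ≡ 0#
      2y≡0⇒y≡0 {y} p = zeroProduct 2≢0 (trans (double y) p)
        where
        double = solve 1 (λ y → con 2 :* y := y :+ y) refl

      -- A line through P and its opposite is vertical, unless the curve is singular there.
      ¬line-opposite : ∀ {l m x₁ y₁ x₂ y₂ x₃ y₃} → Line l m x₁ y₁ x₂ y₂ x₃ y₃ → ¬ Opposite x₁ y₁ x₂ y₂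
      ¬line-opposite {l} {m} {x₁} {y₁} {_} {y₂} L (refl , s) =
        nonsingular x₁ (trans (sym (onCurve₁ L)) (trans (cong (_* y₁) y₁≡0) (zeroˡ _)))
          (trans (sym (tangentSlope L)) (trans (cong (l *_) s) (zeroʳ _)))
        where
        y₁≡0 : y₁ ≡ 0#
        y₁≡0 = 2y≡0⇒y≡0 (linear₂ 1# s 1# (chordSlope L) (solve 4 (λ y₁ y₂ l x₁ → y₁ :+ y₁ :- con 0 := con 1 :* (y₁
            :+ y₂ :- con 0) :+ con 1 :* (y₁ :- y₂ :- l :* (x₁ :- x₁))) refl y₁ y₂ l x₁))

      -- The line through P and Q, reflected, passes through -P, P ⊕ Q and -Q; so cancellation is
      -- available before associativity.
      neg-⊕-cancel : ∀ P Q → OnCurve P → OnCurve Q → neg P ⊕ (P ⊕ Q) ≡ Q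
      neg-⊕-cancel O Q _ _ = trans (⊕-identityˡ _) (⊕-identityˡ Q)
      neg-⊕-cancel (aff x y) O p _ = trans (cong (aff x (- y) ⊕_) (⊕-identityʳ (aff x y)))
        (opposite-⊕ (refl , -‿inverseˡ y))
      neg-⊕-cancel (aff x₁ y₁) (aff x₂ y₂) p q with opposite? x₁ y₁ x₂ y₂
      ... | yes (refl , s) = trans (cong (aff x₁ (- y₁) ⊕_) (opposite-⊕ (refl , s)))
              (trans (⊕-identityʳ _) (cong (aff x₁) (linear₁ (- 1#) s (solve 2 (λ y₁ y₂ → :- y₁ :- y₂ := :- con 1
                  :* (y₁ :+ y₂ :- con 0)) refl y₁ y₂))))
      ... | no ¬opp with lineThrough p q ¬opp
      ...   | l , m , x₃ , y₃ , L = trans (cong (aff x₁ (- y₁) ⊕_) (line-⊕ L ¬opp))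
                (trans (line-⊕ L′ (¬line-opposite L′)) (neg-neg (aff x₂ y₂)))
        where
        L′ = swap₂₃ (negate L)

      ⊕-neg-cancel : ∀ P Q → OnCurve P → OnCurve Q → (P ⊕ Q) ⊕ neg Q ≡ P
      ⊕-neg-cancel P Q p q = trans (⊕-comm _ _ (⊕-closed P Q p q) (neg-onCurve Q q))
        (trans (cong (neg Q ⊕_) (⊕-comm P Q p q)) (neg-⊕-cancel Q P q p))

      -- At R the line L₁ gives yR² - (l₁ xR + m₁)² = A (xR - xP)(xR - xQ)(xR - xS). The factors on
      -- the left are (l₂ - l₁)(xR - xQ) and (l₁ + l′)(xR - xS), the second because `L′` joins R to
      -- the reflection of S; cancelling the common factors leaves the claim.
      slopeCocycle : ∀ {l₁ m₁ l₂ m₂ l′ m′ xP yP xQ yQ xR yR xS yS xV yV xU yU} →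
        Line l₁ m₁ xP yP xQ yQ xS yS → Line l₂ m₂ xQ yQ xR yR xV yV →
        Line l′ m′ xS (- yS) xR yR xU yU →
        (l₁ + l′) * (l₂ - l₁) ≡ A * (xR - xP)
      slopeCocycle {l₁} {m₁} {l₂} {m₂} {l′} {m′} {xP} {yP} {xQ} {yQ} {xR} {yR} {xS} {yS} L₁ L₂ L′ with xR ≟ xQ
      ... | no xR≢xQ = cancelˡ {xR - xQ} (λ p → xR≢xQ (x-y≡0⇒x≡y p))
            (linear₃ 1# star (l₁ + l′) (chordSlope L₂) (- (l₁ + l′)) (on₂ L₁) (solve 10 (λ xR xQ l₁ l′ l₂ A xP yR m₁ yQ → (xR
                :- xQ) :* ((l₁ :+ l′) :* (l₂ :- l₁)) :- (xR :- xQ) :* (A :* (xR :- xP)) := con 1 :* ((l₁ :+ l′) :* (yR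
                :- (l₁ :* xR :+ m₁)) :- A :* (xR :- xP) :* (xR :- xQ)) :+ (l₁ :+ l′) :* (yQ :- yR :- l₂ :* (xQ :- xR))
                :+ :- (l₁ :+ l′) :* (yQ :- (l₁ :* xQ :+ m₁))) refl xR xQ l₁ l′ l₂ A xP yR m₁ yQ))
        where
        -- The identity already divided by xR - xS, which the tangent form of the slope l′ permits
        -- even when xR = xS.
        star : (l₁ + l′) * (yR - (l₁ * xR + m₁)) ≡ A * (xR - xP) * (xR - xQ)
        star = linear₅ 1# (tangentSlope L′) (l′ - l₁) (on₃ L₁) (- l₁) (chordSlope L′)
          (xS + xR) (vieta₁ L₁) (- 1#) (vieta₂ L₁) (solve 12 (λ l₁ l′ yR xR m₁ A xP xQ yS xS B C → (l₁ :+ l′) :* (yR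
              :- (l₁ :* xR :+ m₁)) :- A :* (xR :- xP) :* (xR :- xQ) := con 1 :* (l′ :* (:- yS :+ yR) :- (A :* (xS
              :* xS :+ xS :* xR :+ xR :* xR) :+ B :* (xS :+ xR) :+ C)) :+ (l′ :- l₁) :* (yS :- (l₁ :* xS :+ m₁)) :+
              :- l₁ :* (:- yS :- yR :- l′ :* (xS :- xR)) :+ (xS :+ xR) :* (A :* (xP :+ xQ :+ xS) :- (l₁ :* l₁ :- B)) :+
              :- con 1 :* (A :* (xP :* xQ :+ xP :* xS :+ xQ :* xS) :- (C :- con 2 :* (l₁ :* m₁))))
              refl l₁ l′ yR xR m₁ A xP xQ yS xS B C)
      -- Here Q = R and l₂ is a tangent slope. The factor xR - xQ vanishes, so xR - xS is cancelled
      -- instead; it is nonzero, since otherwise `L′` would join opposite points.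
      ... | yes refl = cancelˡ {xR - xS} xR≢xS
            (linear₅ (l₂ - l₁) (chordSlope L′) (- (l₂ - l₁)) (chordSlope (rotate (rotate L₁))) 1# tangent
              l₁ same 1# derivative (solve 12 (λ xQ xS l₁ l′ l₂ A xP yS yR yQ B C → (xQ :- xS) :* ((l₁ :+ l′) :* (l₂
                  :- l₁)) :- (xQ :- xS) :* (A :* (xQ :- xP)) := (l₂ :- l₁) :* (:- yS :- yR :- l′ :* (xS :- xQ)) :+
                  :- (l₂ :- l₁) :* (yQ :- yS :- l₁ :* (xQ :- xS)) :+ con 1 :* (l₂ :* (yQ :+ yR) :- (A :* (xQ :* xQ
                  :+ xQ :* xQ :+ xQ :* xQ) :+ B :* (xQ :+ xQ) :+ C)) :+ l₁ :* (yQ :- yR) :+ con 1 :* (A :* (xQ :* xQ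
                  :+ xQ :* xQ :+ xQ :* xQ) :+ B :* (xQ :+ xQ) :+ C :- con 2 :* yQ :* l₁ :- A :* (xQ :- xP) :* (xQ
                  :- xS))) refl xQ xS l₁ l′ l₂ A xP yS yR yQ B C))
        where
        same : yQ ≡ yR
        same = linear₁ 1# (chordSlope L₂) (solve 4 (λ yQ yR l₂ xQ → yQ :- yR := con 1 :* (yQ :- yR :- l₂ :* (xQ
            :- xQ))) refl yQ yR l₂ xQ)
        tangent : l₂ * (yQ + yR) ≡ dividedDifference xR xR
        tangent = tangentSlope L₂
        derivative : dividedDifference xR xR - (1# + 1#) * yQ * l₁ ≡ A * (xR - xP) * (xR - xS)
        derivative = linear₃ ((1# + 1#) * xR) (vieta₁ L₁) (- 1#) (vieta₂ L₁) (- ((1# + 1#) * l₁)) (on₂ L₁) (solve 9 (λ A xQ B C yQ l₁ xP xS m₁ → A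
            :* (xQ :* xQ :+ xQ :* xQ :+ xQ :* xQ) :+ B :* (xQ :+ xQ) :+ C :- con 2 :* yQ :* l₁ :- A :* (xQ :- xP)
            :* (xQ :- xS) := con 2 :* xQ :* (A :* (xP :+ xQ :+ xS) :- (l₁ :* l₁ :- B)) :+ :- con 1 :* (A :* (xP
            :* xQ :+ xP :* xS :+ xQ :* xS) :- (C :- con 2 :* (l₁ :* m₁))) :+ :- (con 2 :* l₁) :* (yQ :- (l₁ :* xQ
            :+ m₁))) refl A xQ B C yQ l₁ xP xS m₁)
        xR≢xS : xR - xS ≢ 0#
        xR≢xS p = ¬line-opposite L′ (sym (x-y≡0⇒x≡y p) ,
          linear₃ 1# (chordSlope (rotate (rotate L₁))) (- 1#) same l₁ p (solve 6 (λ yS yR yQ l₁ xQ xS → :- yS :+ yR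
              :- con 0 := con 1 :* (yQ :- yS :- l₁ :* (xQ :- xS)) :+ :- con 1 :* (yQ :- yR) :+ l₁ :* (xQ :- xS
              :- con 0)) refl yS yR yQ l₁ xQ xS))

      -- For (P, Q, R) and (R, Q, P) the cocycle has opposite right-hand sides, whence l₁ + l′ = l₂
      -- + l″, an element that is nonzero as xP ≠ xR. Then `vieta₁` on the four lines equates the
      -- abscissae, and the ordinates agree after multiplication by this element.
      lines-agree : ∀ {l₁ m₁ l₂ m₂ l′ m′ l″ m″ xP yP xQ yQ xR yR xS yS xV yV xU yU xW yW} →
        Line l₁ m₁ xP yP xQ yQ xS yS → Line l₂ m₂ xQ yQ xR yR xV yV →
        Line l′ m′ xS (- yS) xR yR xU yU → Line l″ m″ xP yP xV (- yV) xW yW →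
        xP ≢ xR → xU ≡ xW × yU ≡ yW
      lines-agree {l₁} {m₁} {l₂} {m₂} {l′} {m′} {l″} {m″} {xP} {yP} {xQ} {yQ} {xR} {yR} {xS} {yS} {xV} {yV} {xU} {yU} {xW} {yW}
        L₁ L₂ L′ L″ xP≢xR = x-eq , x-y≡0⇒x≡y (zeroProduct κ≢0 (trans (cong (κ *_) difference) vanish))
        where
        κ = l₁ + l′
        cocycle : κ * (l₂ - l₁) ≡ A * (xR - xP)
        cocycle = slopeCocycle L₁ L₂ L′
        cocycle≢0 : κ * (l₂ - l₁) ≢ 0#
        cocycle≢0 p = *-≢0 A≢0 (λ q → xP≢xR (sym (x-y≡0⇒x≡y q))) (trans (sym cocycle) p)
        κ≢0 : κ ≢ 0#
        κ≢0 p = cocycle≢0 (trans (cong (_* (l₂ - l₁)) p) (zeroˡ _))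
        l₂-l₁≢0 : l₂ - l₁ ≢ 0#
        l₂-l₁≢0 p = cocycle≢0 (trans (cong (κ *_) p) (zeroʳ _))
        κ-sym : κ ≡ l₂ + l″
        κ-sym = cancelˡ l₂-l₁≢0 (linear₂ 1# cocycle 1# (slopeCocycle (swap₁₂ L₂) (swap₁₂ L₁) (swap₁₂ L″)) (solve 7 (λ l₂ l₁ l′ l″ A xR xP → (l₂
            :- l₁) :* (l₁ :+ l′) :- (l₂ :- l₁) :* (l₂ :+ l″) := con 1 :* ((l₁ :+ l′) :* (l₂ :- l₁) :- A :* (xR :- xP))
            :+ con 1 :* ((l₂ :+ l″) :* (l₁ :- l₂) :- A :* (xP :- xR))) refl l₂ l₁ l′ l″ A xR xP))
        slopes : (l′ * l′ - l₁ * l₁) - (l″ * l″ - l₂ * l₂) ≡ (1# + 1#) * A * (xR - xP)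
        slopes = linear₂ (κ + l″ - l₂) κ-sym (1# + 1#) cocycle (solve 7 (λ l′ l₁ l″ l₂ A xR xP → l′ :* l′ :- l₁ :* l₁
            :- (l″ :* l″ :- l₂ :* l₂) :- con 2 :* A :* (xR :- xP) := (l₁ :+ l′ :+ l″ :- l₂) :* (l₁ :+ l′ :- (l₂
            :+ l″)) :+ con 2 :* ((l₁ :+ l′) :* (l₂ :- l₁) :- A :* (xR :- xP))) refl l′ l₁ l″ l₂ A xR xP)
        x-eq : xU ≡ xW
        x-eq = cancelˡ A≢0 (linear₅ 1# (vieta₁ L′) (- 1#) (vieta₁ L₁) (- 1#) (vieta₁ L″) 1# (vieta₁ L₂) 1# slopes (solve 13 (λ A xU xW xS xR l′ B xP xQ l₁ xV l″ l₂ → A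
            :* xU :- A :* xW := con 1 :* (A :* (xS :+ xR :+ xU) :- (l′ :* l′ :- B)) :+ :- con 1 :* (A :* (xP :+ xQ
            :+ xS) :- (l₁ :* l₁ :- B)) :+ :- con 1 :* (A :* (xP :+ xV :+ xW) :- (l″ :* l″ :- B)) :+ con 1 :* (A
            :* (xQ :+ xR :+ xV) :- (l₂ :* l₂ :- B)) :+ con 1 :* (l′ :* l′ :- l₁ :* l₁ :- (l″ :* l″ :- l₂ :* l₂)
            :- con 2 :* A :* (xR :- xP))) refl A xU xW xS xR l′ B xP xQ l₁ xV l″ l₂))
        difference : yU - yW ≡ - (l₂ * (xQ - xR)) - l₁ * (xP - xQ) - l′ * (xR - xU) + l″ * (xP - xU)
        difference = linear₅ (- 1#) (chordSlope L₂) (- 1#) (chordSlope L₁) (- 1#) (chordSlope (rotate (rotate L′)))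
          1# (chordSlope (swap₂₃ L″)) (- l″) (sym x-eq) (solve 14 (λ yU yW l₂ xQ xR l₁ xP l′ xU l″ yQ yR yP xW → yU
              :- yW :- (:- (l₂ :* (xQ :- xR)) :- l₁ :* (xP :- xQ) :- l′ :* (xR :- xU) :+ l″ :* (xP :- xU)) := :- con 1
              :* (yQ :- yR :- l₂ :* (xQ :- xR)) :+ :- con 1 :* (yP :- yQ :- l₁ :* (xP :- xQ)) :+ :- con 1 :* (yR
              :- yU :- l′ :* (xR :- xU)) :+ con 1 :* (yP :- yW :- l″ :* (xP :- xW)) :+ :- l″ :* (xW :- xU))
              refl yU yW l₂ xQ xR l₁ xP l′ xU l″ yQ yR yP xW)
        vanish : κ * (- (l₂ * (xQ - xR)) - l₁ * (xP - xQ) - l′ * (xR - xU) + l″ * (xP - xU)) ≡ 0#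
        vanish = linear₄ (- (κ * (xP - xU))) κ-sym (xR - xQ - xP + xU) cocycle (xR - xP) (vieta₁ L′) (- (xR - xP)) (vieta₁ L₁) (solve 11 (λ l₁ l′ l₂ xQ xR xP xU l″ A xS B → (l₁
            :+ l′) :* (:- (l₂ :* (xQ :- xR)) :- l₁ :* (xP :- xQ) :- l′ :* (xR :- xU) :+ l″ :* (xP :- xU)) :- con 0 :=
            :- ((l₁ :+ l′) :* (xP :- xU)) :* (l₁ :+ l′ :- (l₂ :+ l″)) :+ (xR :- xQ :- xP :+ xU) :* ((l₁ :+ l′) :* (l₂
            :- l₁) :- A :* (xR :- xP)) :+ (xR :- xP) :* (A :* (xS :+ xR :+ xU) :- (l′ :* l′ :- B)) :+ :- (xR :- xP)
            :* (A :* (xP :+ xQ :+ xS) :- (l₁ :* l₁ :- B))) refl l₁ l′ l₂ xQ xR xP xU l″ A xS B)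

      -- If S = R then V = P, since a line is determined by two of its points.
      line-unique : ∀ {l m x₁ y₁ x₂ y₂ x₃ y₃} → Line l m x₁ y₁ x₂ y₂ x₃ y₃ → ∀ {l′ m′ x₄ y₄ x₅ y₅} →
        Line l′ m′ x₂ y₂ x₄ y₄ x₅ y₅ → ¬ Opposite x₂ y₂ x₄ y₄ → Opposite x₃ (- y₃) x₄ y₄ →
        aff x₁ (- y₁) ≡ aff x₅ (- y₅)
      line-unique {y₃ = y₃} L {y₄ = y₄} M ¬opp (refl , e) = helper L y₃≡y₄
        where
        y₃≡y₄ : y₃ ≡ y₄
        y₃≡y₄ = linear₁ (- 1#) e (solve 2 (λ y₃ y₄ → y₃ :- y₄ := :- con 1 :* (:- y₃ :+ y₄ :- con 0)) refl y₃ y₄)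
        helper : ∀ {l m x₁ y₁ y₃} → Line l m x₁ y₁ _ _ _ y₃ → y₃ ≡ y₄ → aff x₁ (- y₁) ≡ _
        helper L refl = trans (sym (line-⊕ (swap₂₃ (swap₁₂ L)) ¬opp)) (line-⊕ M ¬opp)

      -y≡ : ∀ {y z} → y + z ≡ 0# → z ≡ - y
      -y≡ {y} {z} e = linear₁ 1# e (solve 2 (λ z y → z :- :- y := con 1 :* (y :+ z :- con 0)) refl z y)

      equal-or-opposite : ∀ {x y z} → y * y ≡ cubic x → z * z ≡ cubic x → y ≡ z ⊎ y + z ≡ 0#
      equal-or-opposite {x} {y} {z} p q with y ≟ z
      ... | yes e = inj₁ e
      ... | no ¬e = inj₂ (zeroProduct (λ e → ¬e (x-y≡0⇒x≡y e)) (linear₂ 1# p (- 1#) q (solve 6 (λ y z A x B C → (y :- z)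
          :* (y :+ z) :- con 0 := con 1 :* (y :* y :- (A :* x :* x :* x :+ B :* x :* x :+ C :* x :+ con 1)) :+
          :- con 1 :* (z :* z :- (A :* x :* x :* x :+ B :* x :* x :+ C :* x :+ con 1))) refl y z A x B C)))

      opposite-neg : ∀ {x y z} → y + z ≡ 0# → aff x z ≡ neg (aff x y)
      opposite-neg e = cong (aff _) (-y≡ e)

      assoc-opposite : ∀ P Q → OnCurve P → OnCurve Q → (P ⊕ Q) ⊕ neg P ≡ P ⊕ (Q ⊕ neg P)
      assoc-opposite P Q p q = trans (trans (cong (_⊕ neg P) (⊕-comm P Q p q)) (⊕-neg-cancel Q P q p))
        (sym (trans (cong (P ⊕_) (⊕-comm Q (neg P) q np))
          (subst (λ z → z ⊕ (neg P ⊕ Q) ≡ Q) (neg-neg P) (neg-⊕-cancel (neg P) Q np q))))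
        where np = neg-onCurve P p

      assoc-lines : ∀ {l₁ m₁ l₂ m₂ xP yP xQ yQ xR yR xS yS xV yV} →
        Line l₁ m₁ xP yP xQ yQ xS yS → Line l₂ m₂ xQ yQ xR yR xV yV →
        ¬ Opposite xP yP xQ yQ → ¬ Opposite xQ yQ xR yR → xP ≢ xR →
        aff xS (- yS) ⊕ aff xR yR ≡ aff xP yP ⊕ aff xV (- yV)
      assoc-lines {xP = xP} {yP} {xQ} {yQ} {xR} {yR} {xS} {yS} {xV} {yV} L₁ L₂ ¬PQ ¬QR xP≢xR =
        cases (opposite? xS (- yS) xR yR) (opposite? xP yP xV (- yV))
        where
        P = aff xP yP
        R = aff xR yR
        r : OnCurve R
        r = onCurve₁ (swap₁₂ L₂)
        s : OnCurve (aff xS (- yS))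
        s = neg-onCurve (aff xS yS) (onCurve₁ (rotate L₁))
        v : OnCurve (aff xV (- yV))
        v = neg-onCurve (aff xV yV) (onCurve₁ (rotate L₂))
        generic : ∀ {l′ m′ xU yU l″ m″ xW yW} → Line l′ m′ xS (- yS) xR yR xU yU →
          Line l″ m″ xP yP xV (- yV) xW yW → xU ≡ xW × yU ≡ yW →
          ¬ Opposite xS (- yS) xR yR → ¬ Opposite xP yP xV (- yV) →
          aff xS (- yS) ⊕ R ≡ P ⊕ aff xV (- yV)
        generic L′ L″ (refl , refl) ¬SR ¬PV = trans (line-⊕ L′ ¬SR) (sym (line-⊕ L″ ¬PV))
        cases : Dec (Opposite xS (- yS) xR yR) → Dec (Opposite xP yP xV (- yV)) →
          aff xS (- yS) ⊕ R ≡ P ⊕ aff xV (- yV)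
        cases (yes o) _ = trans (opposite-⊕ o)
          (sym (trans (cong (P ⊕_) (sym (line-unique L₁ L₂ ¬QR o))) (⊕-inverseʳ P)))
        cases (no _) (yes o) = trans (cong (_⊕ R) negS≡negR)
          (trans (⊕-comm (neg R) R (neg-onCurve R r) r) (trans (⊕-inverseʳ R) (sym (opposite-⊕ o))))
          where
          negS≡negR : aff xS (- yS) ≡ neg R
          negS≡negR = sym (line-unique (swap₁₂ L₂) (swap₁₂ L₁) (λ o → ¬PQ (opposite-sym o)) (opposite-sym o))
        cases (no ¬SR) (no ¬PV) =
          let (_ , _ , _ , _ , L′) = lineThrough s r ¬SR
              (_ , _ , _ , _ , L″) = lineThrough (onCurve₁ L₁) v ¬PV
          in generic L′ L″ (lines-agree L₁ L₂ L′ L″ xP≢xR) ¬SR ¬PV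

      -- Equal abscissae of P and R mean R = P or R = -P, and these cases as well as opposite
      -- neighbours reduce to commutativity and cancellation. Slopes are compared only when xP ≠ xR,
      -- as the cocycle requires.
      ⊕-assoc : ∀ P Q R → OnCurve P → OnCurve Q → OnCurve R → (P ⊕ Q) ⊕ R ≡ P ⊕ (Q ⊕ R)
      ⊕-assoc O Q R _ _ _ = trans (cong (_⊕ R) (⊕-identityˡ Q)) (sym (⊕-identityˡ (Q ⊕ R)))
      ⊕-assoc P@(aff _ _) O R _ _ _ = trans (cong (_⊕ R) (⊕-identityʳ P)) (cong (P ⊕_) (sym (⊕-identityˡ R)))
      ⊕-assoc P@(aff _ _) Q@(aff _ _) O p q r =
        trans (⊕-identityʳ (P ⊕ Q)) (cong (P ⊕_) (sym (⊕-identityʳ Q)))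
      ⊕-assoc P@(aff xP yP) Q@(aff xQ yQ) R@(aff xR yR) p q r =
        cases (xP ≟ xR) (opposite? xP yP xQ yQ) (opposite? xQ yQ xR yR)
        where
        cases : Dec (xP ≡ xR) → Dec (Opposite xP yP xQ yQ) → Dec (Opposite xQ yQ xR yR) → (P ⊕ Q) ⊕ R ≡ P ⊕ (Q ⊕ R)
        cases (yes refl) _ _ with equal-or-opposite p r
        ... | inj₁ refl = trans (cong (_⊕ P) (⊕-comm P Q p q)) (⊕-comm (Q ⊕ P) P (⊕-closed Q P q p) p)
        ... | inj₂ e = subst (λ z → (P ⊕ Q) ⊕ z ≡ P ⊕ (Q ⊕ z)) (sym (opposite-neg e)) (assoc-opposite P Q p q)
        cases (no _) (yes (refl , e)) _ = trans (cong (_⊕ R) (opposite-⊕ (refl , e)))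
          (trans (⊕-identityˡ R) (sym (subst (λ z → z ⊕ (Q ⊕ R) ≡ R) (sym (opposite-neg (trans (+-comm _ _) e))) (neg-⊕-cancel Q R q r))))
        cases (no _) (no _) (yes (refl , e)) = trans
          (subst (λ z → (P ⊕ Q) ⊕ z ≡ P) (sym (opposite-neg e)) (⊕-neg-cancel P Q p q))
          (sym (trans (cong (P ⊕_) (opposite-⊕ (refl , e))) (⊕-identityʳ P)))
        cases (no xP≢xR) (no ¬PQ) (no ¬QR) =
          let (_ , _ , _ , _ , L₁) = lineThrough p q ¬PQ
              (_ , _ , _ , _ , L₂) = lineThrough q r ¬QR
          in trans (cong (_⊕ R) (line-⊕ L₁ ¬PQ)) (trans (assoc-lines L₁ L₂ ¬PQ ¬QR xP≢xR)
               (cong (P ⊕_) (sym (line-⊕ L₂ ¬QR))))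

-- Places with prime residue field, integrality and valuations

module Places where
  open FieldSolver
  open EllipticCurves
  open import Data.Empty using (⊥; ⊥-elim)
  open import Data.Integer as ℤ using (ℤ)
  import Data.Integer.Properties as ℤP
  open import Data.Integer.Divisibility.Signed using (_∣_; divides; ∣ᵤ⇒∣; ∣⇒∣ᵤ; ∣m∣n⇒∣m+n; ∣n⇒∣m*n; ∣m⇒∣m*n; ∣-reflexive)
  open import Data.Integer.Tactic.RingSolver using (solve-∀)
  open import Data.Nat as ℕ using (ℕ; zero; suc)
  import Data.Nat.Divisibility as ℕD
  open import Data.Nat.Primality using (Prime; euclidsLemma; prime⇒nonTrivial)
  open import Data.Product using (∃; _×_; _,_)
  open import Data.Sum using (_⊎_; inj₁; inj₂; [_,_]′)
  open import Relation.Binary.PropositionalEquality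
  open import Relation.Nullary using (¬_; yes; no)

  module Powers (𝔽 : DecField) where
    open DecField 𝔽
    open FieldLemmas 𝔽

    power : F → ℕ → F
    power x zero = 1#
    power x (suc k) = x * power x k

    power-+ : ∀ x j k → power x (j ℕ.+ k) ≡ power x j * power x k
    power-+ x zero k = sym (*-identityˡ _)
    power-+ x (suc j) k = trans (cong (x *_) (power-+ x j k))
      (solve 3 (λ a b c → a :* (b :* c) := a :* b :* c) refl x (power x j) (power x k))

    power-≢0 : ∀ {x} → x ≢ 0# → ∀ k → power x k ≢ 0#
    power-≢0 x≢0 zero = 1≢0
    power-≢0 x≢0 (suc k) = *-≢0 x≢0 (power-≢0 x≢0 k)

  -- A place of the field with residue field ℤ/p and uniformiser p; `Res x n` says that x is
  -- integral at the place with residue n mod p.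
  record Place (𝔽 : DecField) (p : ℕ) : Set₁ where
    open DecField 𝔽
    open FromIntegers isCommutativeRing using (ι)
    ϖ : F
    ϖ = ι (ℤ.+ p)
    open Powers 𝔽
    ϖ^ : ℕ → F
    ϖ^ k = power ϖ k
    field
      prime : Prime p
      ϖ≢0 : ϖ ≢ 0#
      Res : F → ℤ → Set
      res-ι : ∀ n → Res (ι n) n
      res-+ : ∀ {x y m n} → Res x m → Res y n → Res (x + y) (m ℤ.+ n)
      res-* : ∀ {x y m n} → Res x m → Res y n → Res (x * y) (m ℤ.* n)
      res-neg : ∀ {x m} → Res x m → Res (- x) (ℤ.- m)
      res-unique : ∀ {x m n} → Res x m → Res x n → ℤ.+ p ∣ m ℤ.- n
      res-shift : ∀ {x m n} → Res x m → ℤ.+ p ∣ m ℤ.- n → Res x n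
      res-inv : ∀ {x y m} → Res x m → ¬ ℤ.+ p ∣ m → x * y ≡ 1# → ∃ (Res y)
      -- The second alternative is the case of negative valuation -k, so that exponents stay natural
      -- numbers.
      decompose : ∀ {x} → x ≢ 0# → ∃ λ k → ∃ λ u → ∃ λ m →
        Res u m × ¬ ℤ.+ p ∣ m × (x ≡ ϖ^ k * u ⊎ ϖ^ k * x ≡ u)

  module PlaceLemmas {𝔽 : DecField} {p : ℕ} (place : Place 𝔽 p) where
    open DecField 𝔽
    open FieldLemmas 𝔽
    open FromIntegers isCommutativeRing using (ι)
    open Place place
    open Powers 𝔽 using (power-+; power-≢0)

    P : ℤ
    P = ℤ.+ p

    P∤1 : ¬ P ∣ ℤ.1ℤ
    P∤1 d = ℕD.>⇒∤ (1<p prime) (∣⇒∣ᵤ d)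
      where
      1<p : Prime p → 1 ℕ.< p
      1<p pr = ℕ.nonTrivial⇒n>1 p {{prime⇒nonTrivial pr}}

    euclid : ∀ m n → P ∣ m ℤ.* n → P ∣ m ⊎ P ∣ n
    euclid m n d with euclidsLemma ℤ.∣ m ∣ ℤ.∣ n ∣ prime (subst (p ℕD.∣_) (ℤP.abs-* m n) (∣⇒∣ᵤ d))
    ... | inj₁ e = inj₁ (∣ᵤ⇒∣ e)
    ... | inj₂ e = inj₂ (∣ᵤ⇒∣ e)

    ∣-cong : ∀ {m n} → m ≡ n → P ∣ m → P ∣ n
    ∣-cong refl d = d

    P∣0 : P ∣ ℤ.0ℤ
    P∣0 = divides ℤ.0ℤ refl

    Integral : F → Set
    Integral x = ∃ (Res x)

    Unit : F → Set
    Unit x = ∃ λ n → Res x n × ¬ P ∣ n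

    -- Membership in the k-th power of the maximal ideal: valuation at least k, or x = 0.
    record D (k : ℕ) (x : F) : Set where
      constructor mkD
      field
        quotient : F
        integral : Integral quotient
        equation : x ≡ ϖ^ k * quotient

    int-ι : ∀ n → Integral (ι n)
    int-ι n = n , res-ι n
    int-+ : ∀ {x y} → Integral x → Integral y → Integral (x + y)
    int-+ (_ , a) (_ , b) = _ , res-+ a b
    int-* : ∀ {x y} → Integral x → Integral y → Integral (x * y)
    int-* (_ , a) (_ , b) = _ , res-* a b
    int-neg : ∀ {x} → Integral x → Integral (- x)
    int-neg (_ , a) = _ , res-neg a

    ϖ^-+ : ∀ j k → ϖ^ (j ℕ.+ k) ≡ ϖ^ j * ϖ^ k
    ϖ^-+ = power-+ ϖ

    ϖ^≢0 : ∀ k → ϖ^ k ≢ 0#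
    ϖ^≢0 = power-≢0 ϖ≢0

    int-ϖ^ : ∀ k → Integral (ϖ^ k)
    int-ϖ^ zero = int-ι ℤ.1ℤ
    int-ϖ^ (suc k) = int-* (int-ι P) (int-ϖ^ k)

    D-+ : ∀ {k x y} → D k x → D k y → D k (x + y)
    D-+ {k} (mkD a ia refl) (mkD b ib refl) = mkD (a + b) (int-+ ia ib) (distrib (ϖ^ k) a b)
      where
      distrib = solve 3 (λ q a b → q :* a :+ q :* b := q :* (a :+ b)) refl

    D-neg : ∀ {k x} → D k x → D k (- x)
    D-neg {k} (mkD a ia refl) = mkD (- a) (int-neg ia) (move (ϖ^ k) a)
      where
      move = solve 2 (λ q a → :- (q :* a) := q :* :- a) refl

    D-* : ∀ {j k x y} → D j x → D k y → D (j ℕ.+ k) (x * y)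
    D-* {j} {k} (mkD a ia refl) (mkD b ib refl) = mkD (a * b) (int-* ia ib)
      (trans (rearrange (ϖ^ j) (ϖ^ k) a b) (cong (_* (a * b)) (sym (ϖ^-+ j k))))
      where
      rearrange = solve 4 (λ q r a b → q :* a :* (r :* b) := q :* r :* (a :* b)) refl

    D-scale : ∀ {k x y} → Integral x → D k y → D k (x * y)
    D-scale {k} {x} ix (mkD b ib refl) = mkD (x * b) (int-* ix ib) (rearrange x (ϖ^ k) b)
      where
      rearrange = solve 3 (λ x q b → x :* (q :* b) := q :* (x :* b)) refl

    D-scaleʳ : ∀ {k x y} → D k x → Integral y → D k (x * y)
    D-scaleʳ {k} {x} {y} dx iy = subst (D k) (*-comm y x) (D-scale iy dx)

    D-weaken : ∀ k j {x} → D (k ℕ.+ j) x → D k x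
    D-weaken k j (mkD a ia refl) = mkD (ϖ^ j * a) (int-* (int-ϖ^ j) ia)
      (trans (cong (_* a) (ϖ^-+ k j)) (assoc (ϖ^ k) (ϖ^ j) a))
      where
      assoc = solve 3 (λ a b c → a :* b :* c := a :* (b :* c)) refl

    D-0 : ∀ k → D k 0#
    D-0 k = mkD 0# (int-ι ℤ.0ℤ) (sym (zeroʳ _))

    D⇒int : ∀ {k x} → D k x → Integral x
    D⇒int {k} (mkD a ia refl) = int-* (int-ϖ^ k) ia

    D₁⇒res : ∀ {k x} → D (suc k) x → Res x ℤ.0ℤ
    D₁⇒res {k} (mkD a (m , ra) refl) with int-ϖ^ k
    ... | n , rn = res-shift (res-* (res-* (res-ι P) rn) ra)
      (∣-cong (regroup P n m) (∣m⇒∣m*n {i = P} (n ℤ.* m) (∣-reflexive refl)))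
      where
      regroup : ∀ a b c → a ℤ.* (b ℤ.* c) ≡ a ℤ.* b ℤ.* c ℤ.- ℤ.0ℤ
      regroup = solve-∀

    ¬D₁-1 : ∀ {k} → ¬ D (suc k) 1#
    ¬D₁-1 d = P∤1 (∣-cong refl (res-unique (res-ι ℤ.1ℤ) (D₁⇒res d)))

    unit-≢0 : ∀ {x} → Unit x → x ≢ 0#
    unit-≢0 (n , r , ∤n) refl = ∤n (∣-cong (ℤP.+-identityʳ n) (res-unique r (res-ι ℤ.0ℤ)))

    unit-D₁ : ∀ {k x} → Unit x → ¬ D (suc k) x
    unit-D₁ (n , r , ∤n) d = ∤n (∣-cong (ℤP.+-identityʳ n) (res-unique r (D₁⇒res d)))

    unit-+ : ∀ {k x y} → Unit x → D (suc k) y → Unit (x + y)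
    unit-+ (n , r , ∤n) d = n , res-shift (res-+ r (D₁⇒res d)) (∣-cong (cancel n) P∣0) , ∤n
      where
      cancel : ∀ n → ℤ.0ℤ ≡ n ℤ.+ ℤ.0ℤ ℤ.- n
      cancel = solve-∀

    unit-1 : Unit 1#
    unit-1 = ℤ.1ℤ , res-ι ℤ.1ℤ , P∤1

    unit-inv : ∀ {u} → Unit u → Integral (inv u)
    unit-inv {u} unit@(n , r , ∤n) = res-inv r ∤n (*-inv u (unit-≢0 unit))

    D-divide : ∀ {k u x} → Unit u → D k (u * x) → D k x
    D-divide {k} {u} {x} unit d = subst (D k)
      (trans (assoc (inv u) u x) (trans (cong (_* x) (*-inv u (unit-≢0 unit))) (*-identityˡ x)))
      (D-scale (unit-inv unit) d)
      where
      assoc = solve 3 (λ v u x → v :* (u :* x) := u :* v :* x) refl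

    D-cancel : ∀ k {x} → D (k ℕ.+ 1) (ϖ^ k * x) → D 1 x
    D-cancel k {x} (mkD a ia e) = mkD a ia (cancelˡ (ϖ^≢0 k)
      (trans e (trans (cong (_* a) (ϖ^-+ k 1)) (assoc (ϖ^ k) (ϖ^ 1) a))))
      where
      assoc = solve 3 (λ a b c → a :* b :* c := a :* (b :* c)) refl

    -- By `decompose` only powers of ϖ times units occur. Exponent 0 would make x a unit, with
    -- residue prime to p, and a pole would give the unit ϖ^k x a residue divisible by p; a positive
    -- power is left.
    kernel : ∀ {x m} → Res x m → P ∣ m → D 1 x
    kernel {x} {m} r d with x ≟ 0#
    ... | yes refl = D-0 1
    ... | no x≢0 with decompose x≢0
    ...   | zero , u , n , ru , ∤n , inj₁ refl = ⊥-elim (unit-D₁-1 (trans (sym (*-identityˡ u)) refl))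
            where
            unit-D₁-1 : u ≡ 1# * u → ⊥
            unit-D₁-1 e = ∤n (∣-cong (sub n m) (∣m∣n⇒∣m+n (res-unique ru (subst (λ z → Res z m) (sym e) r)) d))
              where
              sub : ∀ n m → n ℤ.- m ℤ.+ m ≡ n
              sub = solve-∀
    ...   | suc k , u , n , ru , ∤n , inj₁ refl = mkD (ϖ^ k * u) (int-* (int-ϖ^ k) (n , ru)) (assoc ϖ (ϖ^ k) u)
            where
            assoc = solve 3 (λ a b c → a :* b :* c := a :* con 1 :* (b :* c)) refl
    ...   | k , u , n , ru , ∤n , inj₂ e with int-ϖ^ k
    ...     | j , rj = ⊥-elim (∤n (∣-cong (sub n (j ℤ.* m)) (∣m∣n⇒∣m+n
              (res-unique ru (subst (λ z → Res z _) e (res-* rj r))) (∣n⇒∣m*n j d))))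
            where
            sub : ∀ n m → n ℤ.- m ℤ.+ m ≡ n
            sub = solve-∀

    -- The valuation ring property. The inverse is taken in the maximal ideal, which makes the two
    -- alternatives exclusive.
    integral-or-inverse : ∀ x → Integral x ⊎ ∃ λ y → x * y ≡ 1# × D 1 y
    integral-or-inverse x with x ≟ 0#
    ... | yes refl = inj₁ (int-ι ℤ.0ℤ)
    ... | no x≢0 with decompose x≢0
    ...   | k , u , n , ru , ∤n , inj₁ refl = inj₁ (int-* (int-ϖ^ k) (n , ru))
    ...   | zero , u , n , ru , ∤n , inj₂ e = inj₁ (n , subst (λ z → Res z n) (trans (sym e) (*-identityˡ x)) ru)
    ...   | suc k , u , n , ru , ∤n , inj₂ e = inj₂ (ϖ^ (suc k) * inv u ,
            trans (rearrange x (ϖ^ (suc k)) (inv u)) (trans (cong (_* inv u) e) (*-inv u u≢0)) ,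
            D-weaken 1 k (mkD (inv u) (unit-inv (n , ru , ∤n)) refl))
            where
            u≢0 = unit-≢0 (n , ru , ∤n)
            rearrange = solve 3 (λ x y z → x :* (y :* z) := y :* x :* z) refl

    ¬integral-inverse : ∀ {x y} → Integral x → x * y ≡ 1# → ¬ D 1 y
    ¬integral-inverse ix e d = ¬D₁-1 (subst (D 1) e (D-scale ix d))

    D₁-sqrt : ∀ {z} → D 1 (z * z) → D 1 z
    D₁-sqrt {z} d with integral-or-inverse z
    ... | inj₁ (n , r) = kernel r ([ (λ e → e) , (λ e → e) ]′ (euclid n n
            (∣-cong (ℤP.+-identityʳ _) (res-unique (res-* r r) (D₁⇒res d)))))
    ... | inj₂ (y , e , dy) = ⊥-elim (¬D₁-1 (subst (D 3) (trans (rearrange z y) (trans (cong₂ _*_ e e) (*-identityˡ _))) (D-* d (D-* dy dy))))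
      where
      rearrange = solve 2 (λ z y → z :* z :* (y :* y) := z :* y :* (z :* y)) refl

    -- If z had a pole, then z = 1/y with y in the maximal ideal, and 1 = z² y² would lie there as
    -- well.
    integral-sqrt : ∀ {z} → Integral (z * z) → Integral z
    integral-sqrt {z} i with integral-or-inverse z
    ... | inj₁ r = r
    ... | inj₂ (y , e , dy) = ⊥-elim (¬D₁-1 (subst (D 2) (trans (rearrange z y) (trans (cong₂ _*_ e e) (*-identityˡ _))) (D-scale i (D-* dy dy))))
      where
      rearrange = solve 2 (λ z y → z :* z :* (y :* y) := z :* y :* (z :* y)) refl

    valuation : ∀ {z} → D 1 z → z ≢ 0# → ∃ λ k → ∃ λ u → Unit u × z ≡ ϖ^ (suc k) * u
    valuation {z} d z≢0 with decompose z≢0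
    ... | zero , u , n , ru , ∤n , inj₁ refl = ⊥-elim (unit-D₁ (n , ru , ∤n) (subst (D 1) (*-identityˡ u) d))
    ... | suc k , u , n , ru , ∤n , inj₁ e = k , u , (n , ru , ∤n) , e
    ... | k , u , n , ru , ∤n , inj₂ refl = ⊥-elim (unit-D₁ (n , ru , ∤n) (D-scale (int-ϖ^ k) d))

-- The formal group, reduction modulo p and torsion

module ReductionModP where
  open FieldSolver
  open EllipticCurves
  open Places
  open import Data.Empty using (⊥; ⊥-elim)
  open import Data.Integer as ℤ using (ℤ)
  open import Data.Integer.Divisibility.Signed using (_∣_; divides; ∣⇒∣ᵤ; ∣n⇒∣m*n; ∣m⇒∣-m; ∣m∣n⇒∣m-n)
  open import Data.Integer.Tactic.RingSolver using (solve-∀)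
  open import Data.Nat as ℕ using (ℕ; zero; suc)
  import Data.Nat.Properties as ℕP
  import Data.Nat.Divisibility as ℕD
  import Data.Nat.Tactic.RingSolver as ℕSolver
  open import Data.Nat.Induction using (<-rec)
  open import Data.Nat.Primality using (prime⇒nonTrivial)
  open import Data.Maybe using (Maybe; just; nothing)
  open import Data.Product using (∃; _×_; _,_; proj₁; proj₂)
  open import Data.Sum using (inj₁; inj₂; [_,_]′)
  open import Data.Unit using (tt)
  open import Relation.Binary.PropositionalEquality
  open import Relation.Nullary using (¬_; Dec; yes; no)

  module Reduction {𝔽 : DecField} {p : ℕ} (place : Place 𝔽 p) (A B C : DecField.F 𝔽)
    (unit-A : PlaceLemmas.Unit place A) (int-B : PlaceLemmas.Integral place B) (int-C : PlaceLemmas.Integral place C)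
    (2≢0 : CharacteristicNot2 𝔽) (nonsingular : Curve.Nonsingular 𝔽 A B C) where
    open DecField 𝔽
    open FieldLemmas 𝔽
    open FromIntegers isCommutativeRing using (ι; ι-+)
    open Place place
    open PlaceLemmas place
    open Curve 𝔽 A B C
    open GroupLaw (unit-≢0 unit-A) 2≢0 nonsingular

    int-A : Integral A
    int-A = proj₁ unit-A , proj₁ (proj₂ unit-A)

    -- In the coordinates z = x/y, w = 1/y around the point at infinity, the line y = l x + m has
    -- slope -l/m = N/U.
    chartSlope : ∀ {l m x₁ y₁ x₂ y₂ x₃ y₃ w₁ w₂} → Line l m x₁ y₁ x₂ y₂ x₃ y₃ →
      y₁ * w₁ ≡ 1# → y₂ * w₂ ≡ 1# →
      let z₁ = x₁ * w₁ ; z₂ = x₂ * w₂ in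
      m * (A * (z₁ * z₁ + z₁ * z₂ + z₂ * z₂) + B * ((z₁ + z₂) * w₁) + C * (w₁ * w₁))
        + l * (1# - (B * (z₂ * z₂) + C * (z₂ * (w₁ + w₂)) + (w₁ * w₁ + w₁ * w₂ + w₂ * w₂))) ≡ 0#
    chartSlope {l} {m} {x₁} {y₁} {x₂} {y₂} {w₁ = w₁} {w₂} L e₁ e₂ =
      zeroProduct y≢0 (trans (scaled A B C l m x₁ y₁ x₂ y₂ w₁ w₂)
        (trans (cong₂ (λ a b → h A B C l m x₁ y₁ x₂ y₂ a b) e₁ e₂)
          (combination {l} {m} {x₁} {y₁} {x₂} {y₂} (Line.on₁ L) (Line.on₂ L) (onCurve₁ L) (tangentSlope L))))
      where
      y₁≢0 : y₁ ≢ 0#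
      y₁≢0 e = 1≢0 (trans (sym e₁) (trans (cong (_* w₁) e) (zeroˡ _)))
      y₂≢0 : y₂ ≢ 0#
      y₂≢0 e = 1≢0 (trans (sym e₂) (trans (cong (_* w₂) e) (zeroˡ _)))
      y≢0 : y₁ * y₁ * (y₂ * y₂) ≢ 0#
      y≢0 = *-≢0 (*-≢0 y₁≢0 y₁≢0) (*-≢0 y₂≢0 y₂≢0)
      -- The products y₁ w₁ and y₂ w₂ are kept as variables a and b: multiplying by y₁² y₂² clears
      -- all denominators, and only then is a = b = 1 substituted.
      h : (A B C l m x₁ y₁ x₂ y₂ a b : F) → F
      h A B C l m x₁ y₁ x₂ y₂ a b =
        m * (A * (x₁ * x₁ * (y₂ * y₂) * (a * a) + x₁ * x₂ * (y₁ * y₂) * (a * b) + x₂ * x₂ * (y₁ * y₁) * (b * b))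
          + B * ((x₁ * y₂ * a + x₂ * y₁ * b) * (y₂ * a)) + C * (y₂ * y₂ * (a * a)))
        + l * (y₁ * y₁ * (y₂ * y₂) - (B * (x₂ * x₂ * (y₁ * y₁) * (b * b)) + C * (x₂ * y₁ * b * (y₂ * a + y₁ * b))
          + (y₂ * y₂ * (a * a) + y₁ * y₂ * (a * b) + y₁ * y₁ * (b * b))))
      scaled = solve 11 (λ A B C l m x₁ y₁ x₂ y₂ w₁ w₂ → y₁ :* y₁ :* (y₂ :* y₂) :* (m :* (A :* (x₁ :* w₁ :* (x₁ :* w₁)
          :+ x₁ :* w₁ :* (x₂ :* w₂) :+ x₂ :* w₂ :* (x₂ :* w₂)) :+ B :* ((x₁ :* w₁ :+ x₂ :* w₂) :* w₁) :+ C :* (w₁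
          :* w₁)) :+ l :* (con 1 :- (B :* (x₂ :* w₂ :* (x₂ :* w₂)) :+ C :* (x₂ :* w₂ :* (w₁ :+ w₂)) :+ (w₁ :* w₁ :+ w₁
          :* w₂ :+ w₂ :* w₂)))) := m :* (A :* (x₁ :* x₁ :* (y₂ :* y₂) :* (y₁ :* w₁ :* (y₁ :* w₁)) :+ x₁ :* x₂ :* (y₁
          :* y₂) :* (y₁ :* w₁ :* (y₂ :* w₂)) :+ x₂ :* x₂ :* (y₁ :* y₁) :* (y₂ :* w₂ :* (y₂ :* w₂))) :+ B :* ((x₁ :* y₂
          :* (y₁ :* w₁) :+ x₂ :* y₁ :* (y₂ :* w₂)) :* (y₂ :* (y₁ :* w₁))) :+ C :* (y₂ :* y₂ :* (y₁ :* w₁ :* (y₁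
          :* w₁)))) :+ l :* (y₁ :* y₁ :* (y₂ :* y₂) :- (B :* (x₂ :* x₂ :* (y₁ :* y₁) :* (y₂ :* w₂ :* (y₂ :* w₂))) :+ C
          :* (x₂ :* y₁ :* (y₂ :* w₂) :* (y₂ :* (y₁ :* w₁) :+ y₁ :* (y₂ :* w₂))) :+ (y₂ :* y₂ :* (y₁ :* w₁ :* (y₁ :* w₁))
          :+ y₁ :* y₂ :* (y₁ :* w₁ :* (y₂ :* w₂)) :+ y₁ :* y₁ :* (y₂ :* w₂ :* (y₂ :* w₂)))))) refl
      combination : ∀ {l m x₁ y₁ x₂ y₂} → y₁ ≡ l * x₁ + m → y₂ ≡ l * x₂ + m →
        y₁ * y₁ ≡ cubic x₁ → l * (y₁ + y₂) ≡ dividedDifference x₁ x₂ → h A B C l m x₁ y₁ x₂ y₂ 1# 1# ≡ 0#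
      combination {l} {m} {x₁} {_} {x₂} refl refl p t =
        let y₁ = l * x₁ + m
            y₂ = l * x₂ + m
            s = y₁ * y₁ + y₁ * y₂ + y₂ * y₂ in
        linear₂ (l * s) p (- (m * (y₂ * y₂) - l * x₂ * y₁ * (y₁ + y₂) + l * x₁ * s)) t (solve 7 (λ m A x₁ l x₂ B C → m
            :* (A :* (x₁ :* x₁ :* ((l :* x₂ :+ m) :* (l :* x₂ :+ m)) :* (con 1 :* con 1) :+ x₁ :* x₂ :* ((l :* x₁
            :+ m) :* (l :* x₂ :+ m)) :* (con 1 :* con 1) :+ x₂ :* x₂ :* ((l :* x₁ :+ m) :* (l :* x₁ :+ m))
            :* (con 1 :* con 1)) :+ B :* ((x₁ :* (l :* x₂ :+ m) :* con 1 :+ x₂ :* (l :* x₁ :+ m) :* con 1)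
            :* ((l :* x₂ :+ m) :* con 1)) :+ C :* ((l :* x₂ :+ m) :* (l :* x₂ :+ m) :* (con 1 :* con 1))) :+ l
            :* ((l :* x₁ :+ m) :* (l :* x₁ :+ m) :* ((l :* x₂ :+ m) :* (l :* x₂ :+ m)) :- (B :* (x₂ :* x₂ :* ((l :* x₁
            :+ m) :* (l :* x₁ :+ m)) :* (con 1 :* con 1)) :+ C :* (x₂ :* (l :* x₁ :+ m) :* con 1 :* ((l :* x₂
            :+ m) :* con 1 :+ (l :* x₁ :+ m) :* con 1)) :+ ((l :* x₂ :+ m) :* (l :* x₂ :+ m) :* (con 1 :* con 1)
            :+ (l :* x₁ :+ m) :* (l :* x₂ :+ m) :* (con 1 :* con 1) :+ (l :* x₁ :+ m) :* (l :* x₁ :+ m) :* (con 1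
            :* con 1)))) :- con 0 := l :* ((l :* x₁ :+ m) :* (l :* x₁ :+ m) :+ (l :* x₁ :+ m) :* (l :* x₂ :+ m)
            :+ (l :* x₂ :+ m) :* (l :* x₂ :+ m)) :* ((l :* x₁ :+ m) :* (l :* x₁ :+ m) :- (A :* x₁ :* x₁ :* x₁ :+ B :* x₁
            :* x₁ :+ C :* x₁ :+ con 1)) :+ :- (m :* ((l :* x₂ :+ m) :* (l :* x₂ :+ m)) :- l :* x₂ :* (l :* x₁ :+ m)
            :* (l :* x₁ :+ m :+ (l :* x₂ :+ m)) :+ l :* x₁ :* ((l :* x₁ :+ m) :* (l :* x₁ :+ m) :+ (l :* x₁ :+ m) :* (l
            :* x₂ :+ m) :+ (l :* x₂ :+ m) :* (l :* x₂ :+ m))) :* (l :* (l :* x₁ :+ m :+ (l :* x₂ :+ m)) :- (A :* (x₁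
            :* x₁ :+ x₁ :* x₂ :+ x₂ :* x₂) :+ B :* (x₁ :+ x₂) :+ C))) refl m A x₁ l x₂ B C)

    -- The filtration of the kernel of reduction by the order of z = x/y. The index is shifted,
    -- order at least k + 1, so that `Chart 0` is the whole kernel.
    data Chart (k : ℕ) : Point → F → Set where
      origin : Chart k O 0#
      affine : ∀ {x y w} → y * w ≡ 1# → D 1 w → D (suc k) (x * w) → Chart k (aff x y) (x * w)

    tripleLevel : ℕ → ℕ
    tripleLevel k = suc k ℕ.+ suc k ℕ.+ suc k

    -- Dividing the curve equation by y³ gives w = A z³ + B z² w + C z w² + w³. The last three terms
    -- are w times an element of the maximal ideal, so w is a unit times z³.
    w-level : ∀ {k x y w} → y * y ≡ cubic x → y * w ≡ 1# → D 1 w → D (suc k) (x * w) → D (tripleLevel k) w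
    w-level {k} {x} {y} {w} p e dw dz = D-divide unit (subst (D _) (sym equation) (D-scale int-A (D-* (D-* dz dz) dz)))
      where
      z = x * w
      dz₁ : D 1 z
      dz₁ = D-weaken 1 k dz
      int-w = D⇒int dw
      int-z = D⇒int dz
      factor = 1# + - (B * (z * z) + C * (z * w) + w * w)
      unit : Unit factor
      unit = unit-+ unit-1 (D-neg (D-+ (D-+ (D-scale int-B (D-scale int-z dz₁)) (D-scale int-C (D-scale int-z dw)))
        (D-scale int-w dw)))
      equation : factor * w ≡ A * (z * z * z)
      equation = trans (expand A B C x w) (linear₂ (w * w * w) p (- (w * (1# + y * w))) e (solve 6 (λ w B x C A y → w
          :- w :* w :* w :* (B :* x :* x :+ C :* x :+ con 1) :- A :* (x :* w :* (x :* w) :* (x :* w)) := w :* w :* w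
          :* (y :* y :- (A :* x :* x :* x :+ B :* x :* x :+ C :* x :+ con 1)) :+ :- (w :* (con 1 :+ y :* w)) :* (y
          :* w :- con 1)) refl w B x C A y))
        where
        expand = solve 5 (λ A B C x w → (con 1 :- (B :* (x :* w :* (x :* w)) :+ C :* (x :* w :* w) :+ w :* w)) :* w
            := w :- w :* w :* w :* (B :* x :* x :+ C :* x :+ con 1)) refl

    -- The z-coordinate is additive up to terms of three times the order.
    chart-line : ∀ {k l m x₁ y₁ x₂ y₂ x₃ y₃ w₁ w₂} → Line l m x₁ y₁ x₂ y₂ x₃ y₃ →
      y₁ * w₁ ≡ 1# → y₂ * w₂ ≡ 1# → D 1 w₁ → D 1 w₂ → D (suc k) (x₁ * w₁) → D (suc k) (x₂ * w₂) →
      ∃ λ w₃ → y₃ * w₃ ≡ 1# × D 1 w₃ × D (suc k) (x₃ * w₃) × D (tripleLevel k) (x₁ * w₁ + x₂ * w₂ + x₃ * w₃)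
    chart-line {k} {l} {m} {x₁} {y₁} {x₂} {y₂} {x₃} {y₃} {w₁} {w₂} L e₁ e₂ dw₁ dw₂ dz₁ dz₂ =
      w₃ , e₃ , dw₃ , dz₃ , dΣ
      where
      open Line L
      z₁ = x₁ * w₁
      z₂ = x₂ * w₂
      N = A * (z₁ * z₁ + z₁ * z₂ + z₂ * z₂) + B * ((z₁ + z₂) * w₁) + C * (w₁ * w₁)
      S = B * (z₂ * z₂) + C * (z₂ * (w₁ + w₂)) + (w₁ * w₁ + w₁ * w₂ + w₂ * w₂)
      U = 1# - S
      slope : m * N + l * U ≡ 0#
      slope = chartSlope L e₁ e₂
      D¹ : ∀ {x} → D (suc k) x → D 1 x
      D¹ = D-weaken 1 k
      level₃ : ∀ {x} → D (tripleLevel k) x → D (suc k) x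
      level₃ {x} d = D-weaken (suc k) (suc k ℕ.+ suc k) (subst (λ j → D j x) (ℕP.+-assoc (suc k) (suc k) (suc k)) d)
      dw₁³ = w-level (onCurve₁ L) e₁ dw₁ dz₁
      dw₁ᵏ = level₃ dw₁³
      dN : D (suc k ℕ.+ suc k) N
      dN = D-+ (D-+ (D-scale int-A (D-+ (D-+ (D-* dz₁ dz₁) (D-* dz₁ dz₂)) (D-* dz₂ dz₂)))
        (D-scale int-B (D-* (D-+ dz₁ dz₂) dw₁ᵏ))) (D-scale int-C (D-* dw₁ᵏ dw₁ᵏ))
      unit-U : Unit U
      unit-U = unit-+ unit-1 (D-neg (D-+ (D-+ (D-scale int-B (D-scale (D⇒int dz₂) (D¹ dz₂)))
        (D-scale int-C (D-scale (D⇒int dz₂) (D-+ dw₁ dw₂))))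
        (D-+ (D-+ (D-scale (D⇒int dw₁) dw₁) (D-scale (D⇒int dw₁) dw₂)) (D-scale (D⇒int dw₂) dw₂))))
      onLine₁ : l * z₁ + m * w₁ ≡ 1#
      onLine₁ = linear₂ (- w₁) on₁ 1# e₁ (solve 5 (λ l x₁ w₁ m y₁ → l :* (x₁ :* w₁) :+ m :* w₁ :- con 1 := :- w₁
          :* (y₁ :- (l :* x₁ :+ m)) :+ con 1 :* (y₁ :* w₁ :- con 1)) refl l x₁ w₁ m y₁)
      m≢0 : m ≢ 0#
      m≢0 m≡0 = 1≢0 (linear₃ (- 1#) onLine₁ z₁ l≡0 w₁ m≡0 (solve 4 (λ l x₁ w₁ m → con 1 :- con 0 := :- con 1 :* (l
          :* (x₁ :* w₁) :+ m :* w₁ :- con 1) :+ x₁ :* w₁ :* (l :- con 0) :+ w₁ :* (m :- con 0)) refl l x₁ w₁ m))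
        where
        l≡0 : l ≡ 0#
        l≡0 = zeroProduct (unit-≢0 unit-U) (trans (*-comm U l) (linear₂ 1# slope (- N) m≡0 (solve 9 (λ l B x₂ w₂ C w₁ m A x₁ → l
            :* (con 1 :- (B :* (x₂ :* w₂ :* (x₂ :* w₂)) :+ C :* (x₂ :* w₂ :* (w₁ :+ w₂)) :+ (w₁ :* w₁ :+ w₁ :* w₂
            :+ w₂ :* w₂))) :- con 0 := con 1 :* (m :* (A :* (x₁ :* w₁ :* (x₁ :* w₁) :+ x₁ :* w₁ :* (x₂ :* w₂) :+ x₂
            :* w₂ :* (x₂ :* w₂)) :+ B :* ((x₁ :* w₁ :+ x₂ :* w₂) :* w₁) :+ C :* (w₁ :* w₁)) :+ l :* (con 1 :- (B
            :* (x₂ :* w₂ :* (x₂ :* w₂)) :+ C :* (x₂ :* w₂ :* (w₁ :+ w₂)) :+ (w₁ :* w₁ :+ w₁ :* w₂ :+ w₂ :* w₂)))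
            :- con 0) :+ :- (A :* (x₁ :* w₁ :* (x₁ :* w₁) :+ x₁ :* w₁ :* (x₂ :* w₂) :+ x₂ :* w₂ :* (x₂ :* w₂)) :+ B
            :* ((x₁ :* w₁ :+ x₂ :* w₂) :* w₁) :+ C :* (w₁ :* w₁)) :* (m :- con 0)) refl l B x₂ w₂ C w₁ m A x₁)))
      -- In the chart the line y = l x + m becomes w = α z + β, with α = -l/m and β = 1/m.
      β = inv m
      m*β : m * β ≡ 1#
      m*β = *-inv m m≢0
      α = - l * β
      α*U : U * α ≡ N
      α*U = linear₂ (- β) slope N m*β (solve 10 (λ B x₂ w₂ C w₁ l β A x₁ m → (con 1 :- (B :* (x₂ :* w₂ :* (x₂ :* w₂))
          :+ C :* (x₂ :* w₂ :* (w₁ :+ w₂)) :+ (w₁ :* w₁ :+ w₁ :* w₂ :+ w₂ :* w₂))) :* (:- l :* β) :- (A :* (x₁ :* w₁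
          :* (x₁ :* w₁) :+ x₁ :* w₁ :* (x₂ :* w₂) :+ x₂ :* w₂ :* (x₂ :* w₂)) :+ B :* ((x₁ :* w₁ :+ x₂ :* w₂) :* w₁) :+ C
          :* (w₁ :* w₁)) := :- β :* (m :* (A :* (x₁ :* w₁ :* (x₁ :* w₁) :+ x₁ :* w₁ :* (x₂ :* w₂) :+ x₂ :* w₂ :* (x₂
          :* w₂)) :+ B :* ((x₁ :* w₁ :+ x₂ :* w₂) :* w₁) :+ C :* (w₁ :* w₁)) :+ l :* (con 1 :- (B :* (x₂ :* w₂ :* (x₂
          :* w₂)) :+ C :* (x₂ :* w₂ :* (w₁ :+ w₂)) :+ (w₁ :* w₁ :+ w₁ :* w₂ :+ w₂ :* w₂))) :- con 0) :+ (A :* (x₁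
          :* w₁ :* (x₁ :* w₁) :+ x₁ :* w₁ :* (x₂ :* w₂) :+ x₂ :* w₂ :* (x₂ :* w₂)) :+ B :* ((x₁ :* w₁ :+ x₂ :* w₂)
          :* w₁) :+ C :* (w₁ :* w₁)) :* (m :* β :- con 1)) refl B x₂ w₂ C w₁ l β A x₁ m)
      dα : D (suc k ℕ.+ suc k) α
      dα = D-divide unit-U (subst (D _) (sym α*U) dN)
      dα₁ : D 1 α
      dα₁ = D-weaken 1 (k ℕ.+ suc k) dα
      l+mα : l + m * α ≡ 0#
      l+mα = linear₁ (- l) m*β (solve 3 (λ l m β → l :+ m :* (:- l :* β) :- con 0 := :- l :* (m :* β :- con 1))
          refl l m β)
      β≡ : β ≡ w₁ - α * z₁
      β≡ = linear₂ (- β) onLine₁ w₁ m*β (solve 5 (λ β w₁ l x₁ m → β :- (w₁ :- :- l :* β :* (x₁ :* w₁)) := :- β :* (l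
          :* (x₁ :* w₁) :+ m :* w₁ :- con 1) :+ w₁ :* (m :* β :- con 1)) refl β w₁ l x₁ m)
      dβ : D (tripleLevel k) β
      dβ = subst (D _) (sym β≡) (D-+ dw₁³ (D-neg (D-* dα dz₁)))
      dβ₁ : D 1 β
      dβ₁ = D-weaken 1 (k ℕ.+ suc k ℕ.+ suc k) dβ
      int-α = D⇒int dα
      -- Substituting w = α z + β in the curve equation gives a cubic in z with leading coefficient
      -- c and z²-coefficient β (B + 2 C α + 3 α²). This explains `Σz≡`, and the order of β is what
      -- makes the sum of the three z so small.
      c = A + (B * α + C * (α * α) + α * α * α)
      unit-c : Unit c
      unit-c = unit-+ unit-A (D-+ (D-+ (D-scale int-B dα₁) (D-scale int-C (D-scale int-α dα₁)))
        (D-scale (int-* int-α int-α) dα₁))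
      height : ∀ {x y} → y ≡ l * x + m → β * y ≡ 1# - α * x
      height {x} {y} e = linear₂ β e 1# m*β (solve 5 (λ β y l x m → β :* y :- (con 1 :- :- l :* β :* x) := β :* (y
          :- (l :* x :+ m)) :+ con 1 :* (m :* β :- con 1)) refl β y l x m)
      b₁ = height on₁
      b₂ = height on₂
      b₃ = height on₃
      c≡ : c ≡ A * (1# - α * x₁) * (1# - α * x₂) * (1# - α * x₃)
      c≡ = linear₄ α vieta₁ (- (α * α)) vieta₂ (α * α * α) vieta₃ (α * (l + m * α)) l+mα (solve 9 (λ A B l β C x₁ x₂ x₃ m → A
          :+ (B :* (:- l :* β) :+ C :* (:- l :* β :* (:- l :* β)) :+ :- l :* β :* (:- l :* β) :* (:- l :* β)) :- A
          :* (con 1 :- :- l :* β :* x₁) :* (con 1 :- :- l :* β :* x₂) :* (con 1 :- :- l :* β :* x₃) := :- l :* β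
          :* (A :* (x₁ :+ x₂ :+ x₃) :- (l :* l :- B)) :+ :- (:- l :* β :* (:- l :* β)) :* (A :* (x₁ :* x₂ :+ x₁ :* x₃
          :+ x₂ :* x₃) :- (C :- con 2 :* (l :* m))) :+ :- l :* β :* (:- l :* β) :* (:- l :* β) :* (A :* (x₁ :* x₂
          :* x₃) :- (m :* m :- con 1)) :+ :- l :* β :* (l :+ m :* (:- l :* β)) :* (l :+ m :* (:- l :* β) :- con 0))
          refl A B l β C x₁ x₂ x₃ m)
      -- The third point stays in the chart: β y₃ = 1 - α x₃ is a factor of c, and c is a unit.
      y₃≢0 : y₃ ≢ 0#
      y₃≢0 e = unit-≢0 unit-c (linear₃ 1# c≡ (- (A * (1# - α * x₁) * (1# - α * x₂))) b₃
        (β * (A * (1# - α * x₁) * (1# - α * x₂))) e (solve 9 (λ A B l β C x₁ x₂ x₃ y₃ → A :+ (B :* (:- l :* β) :+ C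
            :* (:- l :* β :* (:- l :* β)) :+ :- l :* β :* (:- l :* β) :* (:- l :* β)) :- con 0 := con 1 :* (A :+ (B
            :* (:- l :* β) :+ C :* (:- l :* β :* (:- l :* β)) :+ :- l :* β :* (:- l :* β) :* (:- l :* β)) :- A
            :* (con 1 :- :- l :* β :* x₁) :* (con 1 :- :- l :* β :* x₂) :* (con 1 :- :- l :* β :* x₃)) :+ :- (A
            :* (con 1 :- :- l :* β :* x₁) :* (con 1 :- :- l :* β :* x₂)) :* (β :* y₃ :- (con 1 :- :- l :* β
            :* x₃)) :+ β :* (A :* (con 1 :- :- l :* β :* x₁) :* (con 1 :- :- l :* β :* x₂)) :* (y₃ :- con 0))
            refl A B l β C x₁ x₂ x₃ y₃))
      w₃ = inv y₃
      e₃ : y₃ * w₃ ≡ 1#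
      e₃ = *-inv y₃ y₃≢0
      recover : ∀ {x y w} → β * y ≡ 1# - α * x → y * w ≡ 1# → (1# - α * x) * w ≡ β
      recover {x} {y} {w} b e = linear₂ (- w) b β e (solve 5 (λ l β x w y → (con 1 :- :- l :* β :* x) :* w :- β :=
          :- w :* (β :* y :- (con 1 :- :- l :* β :* x)) :+ β :* (y :* w :- con 1)) refl l β x w y)
      Σz≡ : c * (z₁ + z₂ + x₃ * w₃) ≡ - (β * (B + (1# + 1#) * (C * α) + (1# + 1# + 1#) * (α * α)))
      Σz≡ = trans (cong (_* (z₁ + z₂ + x₃ * w₃)) c≡) (trans
        (linear₃ (A * (1# - α * x₂) * (1# - α * x₃) * x₁) (recover b₁ e₁)
                 (A * (1# - α * x₁) * (1# - α * x₃) * x₂) (recover b₂ e₂)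
                 (A * (1# - α * x₁) * (1# - α * x₂) * x₃) (recover b₃ e₃) (solve 9 (λ A l β x₁ x₂ x₃ w₁ w₂ w₃ → A
                     :* (con 1 :- :- l :* β :* x₁) :* (con 1 :- :- l :* β :* x₂) :* (con 1 :- :- l :* β :* x₃)
                     :* (x₁ :* w₁ :+ x₂ :* w₂ :+ x₃ :* w₃) :- (A :* (con 1 :- :- l :* β :* x₂) :* (con 1 :- :- l
                     :* β :* x₃) :* x₁ :* β :+ A :* (con 1 :- :- l :* β :* x₁) :* (con 1 :- :- l :* β :* x₃) :* x₂
                     :* β :+ A :* (con 1 :- :- l :* β :* x₁) :* (con 1 :- :- l :* β :* x₂) :* x₃ :* β) := A
                     :* (con 1 :- :- l :* β :* x₂) :* (con 1 :- :- l :* β :* x₃) :* x₁ :* ((con 1 :- :- l :* β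
                     :* x₁) :* w₁ :- β) :+ A :* (con 1 :- :- l :* β :* x₁) :* (con 1 :- :- l :* β :* x₃) :* x₂
                     :* ((con 1 :- :- l :* β :* x₂) :* w₂ :- β) :+ A :* (con 1 :- :- l :* β :* x₁) :* (con 1 :-
                     :- l :* β :* x₂) :* x₃ :* ((con 1 :- :- l :* β :* x₃) :* w₃ :- β)) refl A l β x₁ x₂ x₃ w₁ w₂ w₃))
        rest)
        where
        rest : A * (1# - α * x₂) * (1# - α * x₃) * x₁ * β + A * (1# - α * x₁) * (1# - α * x₃) * x₂ * β
          + A * (1# - α * x₁) * (1# - α * x₂) * x₃ * β
          ≡ - (β * (B + (1# + 1#) * (C * α) + (1# + 1# + 1#) * (α * α)))
        rest = linear₄ β vieta₁ (- (β * (1# + 1#) * α)) vieta₂ (β * (1# + 1# + 1#) * (α * α)) vieta₃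
          (β * (l + (1# + 1# + 1#) * (m * α))) l+mα (solve 9 (λ A l β x₂ x₃ x₁ B C m → A :* (con 1 :- :- l :* β :* x₂)
              :* (con 1 :- :- l :* β :* x₃) :* x₁ :* β :+ A :* (con 1 :- :- l :* β :* x₁) :* (con 1 :- :- l :* β
              :* x₃) :* x₂ :* β :+ A :* (con 1 :- :- l :* β :* x₁) :* (con 1 :- :- l :* β :* x₂) :* x₃ :* β :- :- (β
              :* (B :+ con 2 :* (C :* (:- l :* β)) :+ con 3 :* (:- l :* β :* (:- l :* β)))) := β :* (A :* (x₁ :+ x₂
              :+ x₃) :- (l :* l :- B)) :+ :- (β :* con 2 :* (:- l :* β)) :* (A :* (x₁ :* x₂ :+ x₁ :* x₃ :+ x₂ :* x₃)
              :- (C :- con 2 :* (l :* m))) :+ β :* con 3 :* (:- l :* β :* (:- l :* β)) :* (A :* (x₁ :* x₂ :* x₃)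
              :- (m :* m :- con 1)) :+ β :* (l :+ con 3 :* (m :* (:- l :* β))) :* (l :+ m :* (:- l :* β)
              :- con 0)) refl A l β x₂ x₃ x₁ B C m)
      dΣ : D (tripleLevel k) (z₁ + z₂ + x₃ * w₃)
      dΣ = D-divide unit-c (subst (D _) (sym Σz≡) (D-neg (D-scaleʳ dβ
        (int-+ (int-+ int-B (int-* (int-+ (int-ι ℤ.1ℤ) (int-ι ℤ.1ℤ)) (int-* int-C int-α)))
          (int-* (int-+ (int-+ (int-ι ℤ.1ℤ) (int-ι ℤ.1ℤ)) (int-ι ℤ.1ℤ)) (int-* int-α int-α))))))
      dz₃ : D (suc k) (x₃ * w₃)
      dz₃ = subst (D (suc k)) (isolate z₁ z₂ (x₃ * w₃)) (D-+ (level₃ dΣ) (D-neg (D-+ dz₁ dz₂)))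
        where
        isolate = solve 3 (λ a b c → a :+ b :+ c :- (a :+ b) := c) refl
      w₃≡ : w₃ ≡ α * (x₃ * w₃) + β
      w₃≡ = linear₁ 1# (recover b₃ e₃) (solve 4 (λ w₃ l β x₃ → w₃ :- (:- l :* β :* (x₃ :* w₃) :+ β) := con 1
          :* ((con 1 :- :- l :* β :* x₃) :* w₃ :- β)) refl w₃ l β x₃)
      dw₃ : D 1 w₃
      dw₃ = subst (D 1) (sym w₃≡) (D-+ (D-scaleʳ dα₁ (D⇒int dz₃)) dβ₁)

    chart-neg : ∀ {k P z} → Chart k P z → Chart k (neg P) (- z)
    chart-neg origin = subst (Chart _ O) (zero-neg 0# refl) origin
      where
      zero-neg : ∀ x → x ≡ 0# → x ≡ - x
      zero-neg x refl = solve 0 (con 0 := :- con 0) refl 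
    chart-neg {k} (affine {x} {y} {w} e dw dz) = subst (Chart k (aff x (- y))) (sym (move x w))
      (affine (trans (cancel y w) e) (D-neg dw) (subst (D (suc k)) (move x w) (D-neg dz)))
      where
      move = solve 2 (λ x w → :- (x :* w) := x :* :- w) refl
      cancel = solve 2 (λ y w → :- y :* :- w := y :* w) refl

    chart-⊕ : ∀ {k P Q z z′} → OnCurve P → OnCurve Q → Chart k P z → Chart k Q z′ →
      ∃ λ z″ → Chart k (P ⊕ Q) z″ × D (tripleLevel k) (z″ - (z + z′))
    chart-⊕ {k} {_} {Q} {_} {z′} p q origin c = z′ , subst (λ R → Chart k R z′) (sym (⊕-identityˡ Q)) c ,
      subst (D _) (vanish z′) (D-0 _)
      where
      vanish = solve 1 (λ z → con 0 := z :- (con 0 :+ z)) refl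
    chart-⊕ {k} {P} {_} {z} p q c@(affine _ _ _) origin = z , subst (λ R → Chart k R z) (sym (⊕-identityʳ P)) c ,
      subst (D _) (vanish z) (D-0 _)
      where
      vanish = solve 1 (λ z → con 0 := z :- (z :+ con 0)) refl
    chart-⊕ {k} p q (affine {x₁} {y₁} {w₁} e₁ dw₁ dz₁) (affine {x₂} {y₂} {w₂} e₂ dw₂ dz₂) =
      cases (opposite? x₁ y₁ x₂ y₂)
      where
      Goal = ∃ λ z″ → Chart k (aff x₁ y₁ ⊕ aff x₂ y₂) z″ × D (tripleLevel k) (z″ - (x₁ * w₁ + x₂ * w₂))
      cases : Dec (Opposite x₁ y₁ x₂ y₂) → Goal
      cases (yes (x₁≡x₂ , s)) = 0# , subst (λ R → Chart k R 0#) (sym (opposite-⊕ (x₁≡x₂ , s))) origin ,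
        subst (D _) (sym sum≡0) (D-0 _)
        where
        sum≡0 : 0# - (x₁ * w₁ + x₂ * w₂) ≡ 0#
        sum≡0 = linear₄ (- w₁) x₁≡x₂ (- (x₂ * w₁ * w₂)) s (x₂ * w₂) e₁ (x₂ * w₁) e₂ (solve 6 (λ x₁ w₁ x₂ w₂ y₁ y₂ → con 0
            :- (x₁ :* w₁ :+ x₂ :* w₂) :- con 0 := :- w₁ :* (x₁ :- x₂) :+ :- (x₂ :* w₁ :* w₂) :* (y₁ :+ y₂ :- con 0)
            :+ x₂ :* w₂ :* (y₁ :* w₁ :- con 1) :+ x₂ :* w₁ :* (y₂ :* w₂ :- con 1)) refl x₁ w₁ x₂ w₂ y₁ y₂)
      cases (no ¬opp) = finish (lineThrough p q ¬opp)
        where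
        finish : (∃ λ l → ∃ λ m → ∃ λ x₃ → ∃ λ y₃ → Line l m x₁ y₁ x₂ y₂ x₃ y₃) → Goal
        finish (l , m , x₃ , y₃ , L) =
          let (w₃ , e₃ , dw₃ , dz₃ , dΣ) = chart-line L e₁ e₂ dw₁ dw₂ dz₁ dz₂ in
          - (x₃ * w₃) , subst (λ R → Chart k R (- (x₃ * w₃))) (sym (line-⊕ L ¬opp)) (chart-neg (affine e₃ dw₃ dz₃)) ,
          subst (D _) (negated (x₁ * w₁) (x₂ * w₂) (x₃ * w₃)) (D-neg dΣ)
          where
          negated = solve 3 (λ a b c → :- (a :+ b :+ c) := :- c :- (a :+ b)) refl

    mul-closed : ∀ n {P} → OnCurve P → OnCurve (mul n P)
    mul-closed zero p = tt
    mul-closed (suc n) {P} p = ⊕-closed P (mul n P) p (mul-closed n p)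

    mul-+ : ∀ m n {P} → OnCurve P → mul (m ℕ.+ n) P ≡ mul m P ⊕ mul n P
    mul-+ zero n p = sym (⊕-identityˡ _)
    mul-+ (suc m) n {P} p = trans (cong (P ⊕_) (mul-+ m n p))
      (sym (⊕-assoc P (mul m P) (mul n P) p (mul-closed m p) (mul-closed n p)))

    mul-* : ∀ m n {P} → OnCurve P → mul (m ℕ.* n) P ≡ mul m (mul n P)
    mul-* zero n p = refl
    mul-* (suc m) n {P} p = trans (mul-+ n (m ℕ.* n) p) (cong (mul n P ⊕_) (mul-* m n p))

    chart-mul : ∀ n {k P z} → OnCurve P → Chart k P z →
      ∃ λ z′ → Chart k (mul n P) z′ × D (tripleLevel k) (z′ - ι (ℤ.+ n) * z)
    chart-mul zero {z = z} p c = 0# , origin , subst (D _) (vanish z) (D-0 _)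
      where
      vanish = solve 1 (λ z → con 0 := con 0 :- con 0 :* z) refl
    chart-mul (suc n) {k} {P} {z} p c =
      let (z′ , c′ , d′) = chart-mul n p c
          (z″ , c″ , d″) = chart-⊕ p (mul-closed n p) c c′
      in z″ , c″ , subst (D _) (trans (regroup z″ z z′ (ι (ℤ.+ n)))
           (cong (λ i → z″ - i * z) (sym (ι-+ (ℤ.+ 1) (ℤ.+ n))))) (D-+ d″ d′)
      where
      regroup = solve 4 (λ z″ z z′ i → z″ :- (z :+ z′) :+ (z′ :- i :* z) := z″ :- (con 1 :+ i) :* z) refl

    -- Since 3(k + 1) ≥ k + 3, the cubic error lies beyond the order k + 2 of p z already for k = 0.
    next-level : ∀ k {x} → D (tripleLevel k) x → D (suc (suc k) ℕ.+ 1) x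
    next-level k {x} d = D-weaken (suc (suc k) ℕ.+ 1) (k ℕ.+ k) (subst (λ j → D j x) (levels k) d)
      where
      levels : ∀ k → suc k ℕ.+ suc k ℕ.+ suc k ≡ suc (suc k) ℕ.+ 1 ℕ.+ (k ℕ.+ k)
      levels = ℕSolver.solve-∀

    chart-O : ∀ {k P z} → Chart k P z → P ≡ O → z ≡ 0#
    chart-O origin refl = refl

    unit-* : ∀ {x y} → Unit x → Unit y → Unit (x * y)
    unit-* (m , rx , ∤m) (n , ry , ∤n) = m ℤ.* n , res-* rx ry , λ d → [ ∤m , ∤n ]′ (euclid m n d)

    -- Multiplication by n keeps the order of z if p ∤ n, and multiplication by p raises it by one.
    no-torsion : ∀ n → ∀ {k P z u} → OnCurve P → Chart k P z → z ≡ ϖ^ (suc k) * u → Unit u →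
      n ≢ 0 → mul n P ≢ O
    no-torsion = <-rec (λ n → ∀ {k P z u} → OnCurve P → Chart k P z → z ≡ ϖ^ (suc k) * u → Unit u →
        n ≢ 0 → mul n P ≢ O) step
      where
      step : ∀ n → (∀ {m} → m ℕ.< n → ∀ {k P z u} → OnCurve P → Chart k P z → z ≡ ϖ^ (suc k) * u → Unit u →
        m ≢ 0 → mul m P ≢ O) → ∀ {k P z u} → OnCurve P → Chart k P z → z ≡ ϖ^ (suc k) * u → Unit u →
        n ≢ 0 → mul n P ≢ O
      step n rec {k} {P} {z} {u} on c z≡ unit n≢0 = cases (p ℕD.∣? n)
        where
        cases : Dec (p ℕD.∣ n) → mul n P ≢ O
        cases (no p∤n) nP≡O =
          let (z′ , c′ , d) = chart-mul n on c in
          unit-D₁ {0} (unit-* (ℤ.+ n , res-ι (ℤ.+ n) , λ d → p∤n (∣⇒∣ᵤ d)) unit)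
            (D-cancel (suc k) (subst (D _) (trans (cong (λ t → - (t - ι (ℤ.+ n) * z)) (chart-O c′ nP≡O))
              (trans (cong (λ t → - (0# - ι (ℤ.+ n) * t)) z≡) (rearrange (ι (ℤ.+ n)) (ϖ^ (suc k)) u)))
              (D-neg (D-weaken (suc k ℕ.+ 1) 1 (subst (λ j → D j (z′ - ι (ℤ.+ n) * z)) (ℕP.+-comm 1 (suc k ℕ.+ 1)) (next-level k d))))))
          where
          rearrange = solve 3 (λ i q u → :- (con 0 :- i :* (q :* u)) := q :* (i :* u)) refl
        cases (yes (ℕD.divides q n≡q*p)) nP≡O =
          let (z′ , c′ , d) = chart-mul p on c in
          descend (next-level k d) c′
          where
          q≢0 : q ≢ 0
          q≢0 refl = n≢0 n≡q*p
          1<p : 1 ℕ.< p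
          1<p = ℕ.nonTrivial⇒n>1 p {{prime⇒nonTrivial prime}}
          q<n : q ℕ.< n
          q<n = subst (q ℕ.<_) (sym n≡q*p) (ℕP.m<m*n q p {{ℕ.≢-nonZero q≢0}} 1<p)
          raise : ∀ {Q z′} → Chart k Q z′ → D (suc (suc k)) z′ → Chart (suc k) Q z′
          raise origin _ = origin
          raise (affine e dw _) d = affine e dw d
          descend : ∀ {z′} → D (suc (suc k) ℕ.+ 1) (z′ - ϖ * z) → Chart k (mul p P) z′ → ⊥
          descend {z′} (mkD t (int-t) e) c′ = rec q<n (mul-closed p on)
            (raise c′ (mkD u′ (proj₁ unit′ , proj₁ (proj₂ unit′)) z′≡)) z′≡ unit′ q≢0
            (trans (sym (mul-* q p on)) (trans (cong (λ j → mul j P) (sym n≡q*p)) nP≡O))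
            where
            -- The coordinate of p P is p z + p^(k+3) t = p^(k+2) (u + p t), so its unit part is u +
            -- p t.
            u′ = u + ϖ^ 1 * t
            unit′ : Unit u′
            unit′ = unit-+ {0} unit (mkD t int-t refl)
            z′≡ : z′ ≡ ϖ^ (suc (suc k)) * u′
            z′≡ = linear₃ 1# e (ϖ) z≡ t (ϖ^-+ (suc (suc k)) 1) (solve 7 (λ z′ p q u t z q′ → z′ :- p :* (p :* q) :* (u
                :+ p :* con 1 :* t) := con 1 :* (z′ :- p :* z :- p :* (p :* q′) :* t) :+ p :* (z :- p :* q :* u)
                :+ t :* (p :* (p :* q′) :- p :* (p :* q) :* (p :* con 1))) refl z′ ϖ (ϖ^ k) u t z (ϖ^ (k ℕ.+ 1)))

    -- With r = 1/x the curve equation gives e w² = r³ and e z² = r for a unit e, and the maximal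
    -- ideal contains the square roots of its elements.
    chart-E₁ : ∀ {x y r} → y * y ≡ cubic x → x * r ≡ 1# → D 1 r → ∃ λ z → Chart 0 (aff x y) z × z ≢ 0#
    chart-E₁ {x} {y} {r} p x*r dr = x * w , affine y*w dw dz , *-≢0 x≢0 w≢0
      where
      int-r = D⇒int dr
      e = A + (B * r + C * (r * r) + r * r * r)
      unit-e : Unit e
      unit-e = unit-+ unit-A (D-+ (D-+ (D-scale int-B dr) (D-scale int-C (D-scale int-r dr)))
        (D-scale (int-* int-r int-r) dr))
      homogeneous : ∀ t → x * r ≡ t → y * y * (r * r * r) ≡ A * (t * t * t) + B * r * (t * t) + C * (r * r) * t + r * r * r
      homogeneous _ refl = linear₁ (r * r * r) p (solve 6 (λ y r A x B C → y :* y :* (r :* r :* r) :- (A :* (x :* r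
          :* (x :* r) :* (x :* r)) :+ B :* r :* (x :* r :* (x :* r)) :+ C :* (r :* r) :* (x :* r) :+ r :* r :* r) := r
          :* r :* r :* (y :* y :- (A :* x :* x :* x :+ B :* x :* x :+ C :* x :+ con 1))) refl y r A x B C)
      y²r³ : y * y * (r * r * r) ≡ e
      y²r³ = trans (homogeneous 1# x*r) (simplify A B C r)
        where
        simplify = solve 4 (λ A B C r → A :* (con 1 :* con 1 :* con 1) :+ B :* r :* (con 1 :* con 1) :+ C
            :* (r :* r) :* con 1 :+ r :* r :* r := A :+ (B :* r :+ C :* (r :* r) :+ r :* r :* r)) refl
      y≢0 : y ≢ 0#
      y≢0 y≡0 = unit-≢0 unit-e (linear₂ (- 1#) y²r³ (y * (r * r * r)) y≡0 (solve 5 (λ A B r C y → A :+ (B :* r :+ C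
          :* (r :* r) :+ r :* r :* r) :- con 0 := :- con 1 :* (y :* y :* (r :* r :* r) :- (A :+ (B :* r :+ C :* (r
          :* r) :+ r :* r :* r))) :+ y :* (r :* r :* r) :* (y :- con 0)) refl A B r C y))
      w = inv y
      y*w : y * w ≡ 1#
      y*w = *-inv y y≢0
      x≢0 : x ≢ 0#
      x≢0 x≡0 = 1≢0 (linear₂ (- 1#) x*r r x≡0 (solve 2 (λ x r → con 1 :- con 0 := :- con 1 :* (x :* r :- con 1)
          :+ r :* (x :- con 0)) refl x r))
      w≢0 : w ≢ 0#
      w≢0 w≡0 = 1≢0 (linear₂ (- 1#) y*w y w≡0 (solve 2 (λ y w → con 1 :- con 0 := :- con 1 :* (y :* w :- con 1)
          :+ y :* (w :- con 0)) refl y w))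
      eww : e * (w * w) ≡ r * r * r
      eww = linear₂ (- (w * w)) y²r³ (r * r * r * (y * w + 1#)) y*w (solve 6 (λ A B r C w y → (A :+ (B :* r :+ C :* (r
          :* r) :+ r :* r :* r)) :* (w :* w) :- r :* r :* r := :- (w :* w) :* (y :* y :* (r :* r :* r) :- (A :+ (B :* r
          :+ C :* (r :* r) :+ r :* r :* r))) :+ r :* r :* r :* (y :* w :+ con 1) :* (y :* w :- con 1))
          refl A B r C w y)
      ezz : e * (x * w * (x * w)) ≡ r
      ezz = linear₂ (x * x) eww (r * (x * r + 1#)) x*r (solve 6 (λ A B r C x w → (A :+ (B :* r :+ C :* (r :* r) :+ r
          :* r :* r)) :* (x :* w :* (x :* w)) :- r := x :* x :* ((A :+ (B :* r :+ C :* (r :* r) :+ r :* r :* r)) :* (w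
          :* w) :- r :* r :* r) :+ r :* (x :* r :+ con 1) :* (x :* r :- con 1)) refl A B r C x w)
      dw : D 1 w
      dw = D₁-sqrt (D-divide unit-e (subst (D 1) (sym eww) (D-scale (int-* int-r int-r) dr)))
      dz : D 1 (x * w)
      dz = D₁-sqrt (D-divide unit-e (subst (D 1) (sym ezz) dr))

    -- If x were integral then so would y be, although its inverse w lies in the maximal ideal.
    -- Hence x has an inverse, and z = x w is nonzero.
    chart-x≢0 : ∀ {x y z} → OnCurve (aff x y) → Chart 0 (aff x y) z → z ≢ 0#
    chart-x≢0 {x} {y} p (affine {w = w} e dw dz) with integral-or-inverse x
    ... | inj₂ (r , x*r , dr) = λ z≡0 → 1≢0 (linear₃ (- 1#) x*r (y * r) z≡0 (- (x * r)) e (solve 4 (λ x r y w → con 1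
        :- con 0 := :- con 1 :* (x :* r :- con 1) :+ y :* r :* (x :* w :- con 0) :+ :- (x :* r) :* (y :* w
        :- con 1)) refl x r y w))
    ... | inj₁ ix = ⊥-elim (¬integral-inverse int-y e dw)
      where
      int-y : Integral y
      int-y = integral-sqrt (subst Integral (sym p)
        (int-+ (int-+ (int-+ (int-* (int-* (int-* int-A ix) ix) ix) (int-* (int-* int-B ix) ix)) (int-* int-C ix)) (int-ι ℤ.1ℤ)))

    torsion-free : ∀ n {P z} → OnCurve P → Chart 0 P z → mul (suc n) P ≡ O → P ≡ O
    torsion-free n {O} _ _ _ = refl
    torsion-free n {aff x y} {z} p c nP≡O = ⊥-elim (contradiction c (chart-x≢0 p c))
      where
      contradiction : ∀ {z} → Chart 0 (aff x y) z → z ≢ 0# → ⊥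
      contradiction {z} c@(affine e dw dz) z≢0 =
        let (k , u , unit , z≡) = valuation dz z≢0 in
        no-torsion (suc n) {k} {u = u} p (affine e dw (mkD u (proj₁ unit , proj₁ (proj₂ unit)) z≡)) z≡ unit (λ ()) nP≡O

    -- `nothing` is the point at infinity of the reduced curve; a pair of integers represents an
    -- affine point modulo p.
    data ReducesTo : Point → Maybe (ℤ × ℤ) → Set where
      infinite : ∀ {P z} → Chart 0 P z → ReducesTo P nothing
      finite : ∀ {x y m n} → Res x m → Res y n → ReducesTo (aff x y) (just (m , n))

    reduce : ∀ P → OnCurve P → ∃ (ReducesTo P)
    reduce O _ = nothing , infinite origin
    reduce (aff x y) p with integral-or-inverse x
    ... | inj₂ (r , x*r , dr) = nothing , infinite (proj₁ (proj₂ (chart-E₁ p x*r dr)))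
    ... | inj₁ ix@(m , rx) with integral-sqrt (subst Integral (sym p)
        (int-+ (int-+ (int-+ (int-* (int-* (int-* int-A ix) ix) ix) (int-* (int-* int-B ix) ix)) (int-* int-C ix)) (int-ι ℤ.1ℤ)))
    ...   | n , ry = just (m , n) , finite rx ry

    module GoodReduction (a b c : ℤ) (res-A : Res A a) (res-B : Res B b) (res-C : Res C c) (p∤2 : ¬ P ∣ ℤ.+ 2)
      (good : ∀ m → P ∣ a ℤ.* m ℤ.* m ℤ.* m ℤ.+ b ℤ.* m ℤ.* m ℤ.+ c ℤ.* m ℤ.+ ℤ.1ℤ →
        ¬ P ∣ a ℤ.* (m ℤ.* m ℤ.+ m ℤ.* m ℤ.+ m ℤ.* m) ℤ.+ b ℤ.* (m ℤ.+ m) ℤ.+ c) where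

      curve-residue : ∀ {x y m n} → y * y ≡ cubic x → Res x m → Res y n →
        P ∣ n ℤ.* n ℤ.- (a ℤ.* m ℤ.* m ℤ.* m ℤ.+ b ℤ.* m ℤ.* m ℤ.+ c ℤ.* m ℤ.+ ℤ.1ℤ)
      curve-residue {x} {y} p rx ry = res-unique (res-* ry ry) (subst (λ t → Res t _) (sym p)
        (res-+ (res-+ (res-+ (res-* (res-* (res-* res-A rx) rx) rx) (res-* (res-* res-B rx) rx)) (res-* res-C rx)) (res-ι ℤ.1ℤ)))

      -- Consider the third point of the line through P and -Q. If x₃ were integral, then so would l
      -- be, by l² = A (x₁ + x₂ + x₃) + B. Reducing `chordSlope` gives 2n ≡ 0 and reducing
      -- `tangentSlope` gives a vanishing derivative at m: a singular point of the reduced curve.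
      congruent-affine : ∀ {x₁ y₁ x₂ y₂ m n} → y₁ * y₁ ≡ cubic x₁ → y₂ * y₂ ≡ cubic x₂ →
        Res x₁ m → Res y₁ n → Res x₂ m → Res y₂ n → ∃ (Chart 0 (aff x₁ y₁ ⊕ aff x₂ (- y₂)))
      congruent-affine {x₁} {y₁} {x₂} {y₂} {m} {n} p₁ p₂ rx₁ ry₁ rx₂ ry₂ = cases (opposite? x₁ y₁ x₂ (- y₂))
        where
        q₂ = neg-onCurve (aff x₂ y₂) p₂
        cases : Dec (Opposite x₁ y₁ x₂ (- y₂)) → ∃ (Chart 0 (aff x₁ y₁ ⊕ aff x₂ (- y₂)))
        cases (yes o) = 0# , subst (λ R → Chart 0 R 0#) (sym (opposite-⊕ o)) origin
        cases (no ¬opp) = finish (lineThrough p₁ q₂ ¬opp)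
          where
          finish : (∃ λ l → ∃ λ m → ∃ λ x₃ → ∃ λ y₃ → Line l m x₁ y₁ x₂ (- y₂) x₃ y₃) → _
          finish (l , μ , x₃ , y₃ , L) with integral-or-inverse x₃
          ... | inj₂ (r , x₃*r , dr) =
                let (z , ch , _) = chart-E₁ (neg-onCurve (aff x₃ y₃) (onCurve₁ (rotate L))) x₃*r dr in
                z , subst (λ R → Chart 0 R z) (sym (line-⊕ L ¬opp)) ch
          ... | inj₁ ix₃ with integral-sqrt {l} (subst Integral l²≡ (int-+ (int-* int-A (int-+ (int-+ (m , rx₁) (m , rx₂)) ix₃)) int-B))
            where
            l²≡ : A * (x₁ + x₂ + x₃) + B ≡ l * l
            l²≡ = linear₁ 1# (Line.vieta₁ L) (solve 6 (λ A x₁ x₂ x₃ B l → A :* (x₁ :+ x₂ :+ x₃) :+ B :- l :* l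
                := con 1 :* (A :* (x₁ :+ x₂ :+ x₃) :- (l :* l :- B))) refl A x₁ x₂ x₃ B l)
          ...   | s , rl = ⊥-elim (good m (∣-cong (sub (n ℤ.* n) (a ℤ.* m ℤ.* m ℤ.* m ℤ.+ b ℤ.* m ℤ.* m ℤ.+ c ℤ.* m ℤ.+ ℤ.1ℤ)) (∣m∣n⇒∣m-n (∣n⇒∣m*n n p∣n) (curve-residue p₁ rx₁ ry₁)))
                  (∣-cong (sub′ (s ℤ.* (n ℤ.+ ℤ.- n)) (a ℤ.* (m ℤ.* m ℤ.+ m ℤ.* m ℤ.+ m ℤ.* m) ℤ.+ b ℤ.* (m ℤ.+ m) ℤ.+ c) (s*0 s n)) (∣m⇒∣-m (res-unique (res-* rl (res-+ ry₁ (res-neg ry₂)))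
                    (subst (λ t → Res t _) (sym (tangentSlope L)) (res-+ (res-+ (res-* res-A (res-+ (res-+ (res-* rx₁ rx₁) (res-* rx₁ rx₂))
                    (res-* rx₂ rx₂))) (res-* res-B (res-+ rx₁ rx₂))) res-C))))))
            where
            sub : ∀ a b → a ℤ.- (a ℤ.- b) ≡ b
            sub = solve-∀
            sub″ : ∀ b → ℤ.- (ℤ.0ℤ ℤ.- b) ≡ b
            sub″ = solve-∀
            sub′ : ∀ t b → t ≡ ℤ.0ℤ → ℤ.- (t ℤ.- b) ≡ b
            sub′ _ b refl = sub″ b
            s*0 : ∀ s n → s ℤ.* (n ℤ.+ ℤ.- n) ≡ ℤ.0ℤ
            s*0 = solve-∀
            double : ∀ n s m → n ℤ.- (ℤ.- n) ℤ.- s ℤ.* (m ℤ.- m) ≡ ℤ.+ 2 ℤ.* n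
            double = solve-∀
            p∣2n : P ∣ ℤ.+ 2 ℤ.* n
            p∣2n = ∣-cong (double n s m) (res-unique (res-+ ry₁ (res-neg (res-neg ry₂)))
              (subst (λ t → Res t _) (sym (chordSlope L)) (res-* rl (res-+ rx₁ (res-neg rx₂)))))
            p∣n : P ∣ n
            p∣n = [ (λ d → ⊥-elim (p∤2 d)) , (λ d → d) ]′ (euclid (ℤ.+ 2) n p∣2n)

      congruent : ∀ {P Q r} → OnCurve P → OnCurve Q → ReducesTo P r → ReducesTo Q r → ∃ (Chart 0 (P ⊕ neg Q))
      congruent {P} {Q} p q (infinite c) (infinite c′) =
        let (z , c″ , _) = chart-⊕ p (neg-onCurve Q q) c (chart-neg c′) in z , c″
      congruent p q (finite rx ry) (finite rx′ ry′) = congruent-affine p q rx ry rx′ ry′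

-- Copies of ℤ/2 × ℤ/10 in an abelian group

module TorsionSubgroups where
  open import Defs using (_+mod_; Z2×Z10; _⊞_)
  open import Algebra.Bundles using (AbelianGroup)
  open import Level using (0ℓ)
  open import Data.Empty using (⊥-elim)
  open import Data.Fin as Fin using (Fin; zero; suc; toℕ; remQuot; combine)
  import Data.Fin.Properties as FinP
  open import Data.Nat as ℕ using (ℕ; zero; suc; _%_; _/_)
  open import Data.Nat.DivMod using (m≡m%n+[m/n]*n; m%n<n)
  import Data.Nat.Properties as ℕP
  open import Data.Product using (∃; _×_; _,_; proj₁; proj₂)
  open import Relation.Binary.PropositionalEquality as ≡ using (_≡_; cong; cong₂; subst)
  open import Relation.Nullary using (¬_; Dec; _→-dec_; _×-dec_)
  open import Relation.Nullary.Decidable using (toWitness)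

  module TorsionSubgroup (G : AbelianGroup 0ℓ 0ℓ) where
    open AbelianGroup G renaming (_∙_ to _+_; ε to 0#; ∙-cong to +-cong; ∙-congˡ to +-congˡ; ∙-congʳ to +-congʳ;
      identityˡ to +-identityˡ; identityʳ to +-identityʳ; comm to +-comm; assoc to +-assoc; _⁻¹ to -_; inverseʳ to -‿inverseʳ; inverseˡ to -‿inverseˡ; ⁻¹-cong to -‿cong; _-_ to infixl 6 _-_)
    open import Algebra.Properties.CommutativeMonoid.Mult commutativeMonoid
      renaming (_×_ to _•_; ×-homo-+ to •-homo-+; ×-congʳ to •-congʳ; ×-assocˡ to •-assocˡ; ×-distrib-+ to •-distrib-+; ×-idem to •-idem; ×-cong to •-cong)
    open import Relation.Binary.Reasoning.Setoid setoid
    open import Algebra.Properties.Group group using (∙-cancelʳ)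

    •-0 : ∀ n → n • 0# ≈ 0#
    •-0 zero = refl
    •-0 (suc n) = trans (+-identityˡ _) (•-0 n)

    •-multiple : ∀ n x → n • x ≈ 0# → ∀ m → (m ℕ.* n) • x ≈ 0#
    •-multiple n x e m = trans (sym (•-assocˡ x m n)) (trans (•-congʳ m e) (•-0 m))

    •-% : ∀ n x .{{_ : ℕ.NonZero n}} → n • x ≈ 0# → ∀ m → (m % n) • x ≈ m • x
    •-% n x e m = sym (begin
      m • x                                  ≡⟨ cong (_• x) (m≡m%n+[m/n]*n m n) ⟩
      (m % n ℕ.+ (m / n) ℕ.* n) • x          ≈⟨ •-homo-+ x (m % n) ((m / n) ℕ.* n) ⟩
      (m % n) • x + ((m / n) ℕ.* n) • x      ≈⟨ +-congˡ (•-multiple n x e (m / n)) ⟩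
      (m % n) • x + 0#                       ≈⟨ +-identityʳ _ ⟩
      (m % n) • x                            ∎)

    •-swap : ∀ m n x → m • (n • x) ≈ n • (m • x)
    •-swap m n x = trans (•-assocˡ x m n) (trans (reflexive (cong (_• x) (ℕP.*-comm m n))) (sym (•-assocˡ x n m)))

    1• : ∀ x → 1 • x ≈ x
    1• = +-identityʳ

    interchange : ∀ a b c d → (a + b) + (c + d) ≈ (a + c) + (b + d)
    interchange a b c d = begin
      (a + b) + (c + d)   ≈⟨ +-assoc a b (c + d) ⟩
      a + (b + (c + d))   ≈⟨ +-congˡ (sym (+-assoc b c d)) ⟩
      a + ((b + c) + d)   ≈⟨ +-congˡ (+-congʳ (+-comm b c)) ⟩
      a + ((c + b) + d)   ≈⟨ +-congˡ (+-assoc c b d) ⟩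
      a + (c + (b + d))   ≈⟨ sym (+-assoc a c (b + d)) ⟩
      (a + c) + (b + d)   ∎

    Torsion : Carrier → Set
    Torsion x = ∃ λ n → suc n • x ≈ 0#

    torsion-+ : ∀ {x y} → Torsion x → Torsion y → Torsion (x + y)
    torsion-+ {x} {y} (m , e) (n , f) = n ℕ.+ m ℕ.* suc n , (begin
      (suc m ℕ.* suc n) • (x + y)                           ≈⟨ •-distrib-+ x y (suc m ℕ.* suc n) ⟩
      (suc m ℕ.* suc n) • x + (suc m ℕ.* suc n) • y         ≈⟨ +-cong (trans (reflexive (cong (_• x) (ℕP.*-comm (suc m) (suc n)))) (•-multiple (suc m) x e (suc n)))
                                                                 (•-multiple (suc n) y f (suc m)) ⟩
      0# + 0#                                               ≈⟨ +-identityˡ 0# ⟩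
      0#                                                    ∎)

    torsion-neg : ∀ {x} → Torsion x → Torsion (- x)
    torsion-neg {x} (m , e) = m , (begin
      suc m • (- x)                        ≈⟨ sym (+-identityʳ _) ⟩
      suc m • (- x) + 0#                   ≈⟨ +-congˡ (sym e) ⟩
      suc m • (- x) + suc m • x            ≈⟨ sym (•-distrib-+ (- x) x (suc m)) ⟩
      suc m • ((- x) + x)                  ≈⟨ •-congʳ (suc m) (-‿inverseˡ x) ⟩
      suc m • 0#                           ≈⟨ •-0 (suc m) ⟩
      0#                                   ∎)

    module Z2×Z10-Embedding (T₁ T₂ P : Carrier) (2T₁ : 2 • T₁ ≈ 0#) (2T₂ : 2 • T₂ ≈ 0#) (5P : 5 • P ≈ 0#)
      (T₁≉0 : ¬ T₁ ≈ 0#) (T₂≉0 : ¬ T₂ ≈ 0#) (T₁≉T₂ : ¬ T₁ ≈ T₂) (P≉0 : ¬ P ≈ 0#) where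

      -- A generator of the factor ℤ/10: 5S = T₁ and 6S = P recover its components of order 2 and 5.
      S : Carrier
      S = T₁ + P

      ψ : Z2×Z10 → Carrier
      ψ (i , j) = toℕ i • T₂ + toℕ j • S

      5S : 5 • S ≈ T₁
      5S = begin
        5 • (T₁ + P)          ≈⟨ •-distrib-+ T₁ P 5 ⟩
        5 • T₁ + 5 • P        ≈⟨ +-cong (sym (•-% 2 T₁ 2T₁ 5)) 5P ⟩
        1 • T₁ + 0#           ≈⟨ trans (+-identityʳ _) (1• T₁) ⟩
        T₁                    ∎

      6S : 6 • S ≈ P
      6S = begin
        6 • (T₁ + P)          ≈⟨ •-distrib-+ T₁ P 6 ⟩
        6 • T₁ + 6 • P        ≈⟨ +-cong (sym (•-% 2 T₁ 2T₁ 6)) (sym (•-% 5 P 5P 6)) ⟩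
        0# + 1 • P            ≈⟨ trans (+-identityˡ _) (1• P) ⟩
        P                     ∎

      10S : 10 • S ≈ 0#
      10S = trans (sym (•-assocˡ S 2 5)) (trans (•-congʳ 2 5S) 2T₁)

      toℕ-+mod : ∀ {n} .{{_ : ℕ.NonZero n}} (i j : Fin n) → toℕ (i +mod j) ≡ (toℕ i ℕ.+ toℕ j) % n
      toℕ-+mod {n} i j = FinP.toℕ-fromℕ< (m%n<n (toℕ i ℕ.+ toℕ j) n)

      ψ-homo : ∀ u v → ψ (u ⊞ v) ≈ ψ u + ψ v
      ψ-homo (i , j) (k , l) = trans (+-cong (component 2 T₂ 2T₂ i k) (component 10 S 10S j l))
        (interchange (toℕ i • T₂) (toℕ k • T₂) (toℕ j • S) (toℕ l • S))
        where
        component : ∀ n x .{{_ : ℕ.NonZero n}} → n • x ≈ 0# → ∀ (i j : Fin n) → toℕ (i +mod j) • x ≈ toℕ i • x + toℕ j • x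
        component n x e i j = begin
          toℕ (i +mod j) • x               ≡⟨ cong (_• x) (toℕ-+mod i j) ⟩
          ((toℕ i ℕ.+ toℕ j) % n) • x      ≈⟨ •-% n x e (toℕ i ℕ.+ toℕ j) ⟩
          (toℕ i ℕ.+ toℕ j) • x            ≈⟨ •-homo-+ x (toℕ i) (toℕ j) ⟩
          toℕ i • x + toℕ j • x            ∎

      ψ-multiple : ∀ n i j → n • ψ (i , j) ≈ toℕ i • (n • T₂) + toℕ j • (n • S)
      ψ-multiple n i j = trans (•-distrib-+ (toℕ i • T₂) (toℕ j • S) n) (+-cong (•-swap n (toℕ i) T₂) (•-swap n (toℕ j) S))

      ψ-torsion : ∀ u → Torsion (ψ u)
      ψ-torsion (i , j) = 9 , trans (ψ-multiple 10 i j)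
        (trans (+-cong (trans (•-congʳ (toℕ i) (•-multiple 2 T₂ 2T₂ 5)) (•-0 (toℕ i))) (trans (•-congʳ (toℕ j) 10S) (•-0 (toℕ j)))) (+-identityˡ 0#))

      independent : ∀ m n → m • T₂ + n • T₁ ≈ 0# → m % 2 ≡ 0 × n % 2 ≡ 0
      independent m n e = cases (m % 2) (n % 2) (m%n<n m 2) (m%n<n n 2) (trans (+-cong (•-% 2 T₂ 2T₂ m) (•-% 2 T₁ 2T₁ n)) e)
        where
        cases : ∀ i j → i ℕ.< 2 → j ℕ.< 2 → i • T₂ + j • T₁ ≈ 0# → i ≡ 0 × j ≡ 0
        cases 0 0 _ _ _ = ≡.refl , ≡.refl
        cases 0 1 _ _ e = ⊥-elim (T₁≉0 (trans (sym (trans (+-identityˡ _) (1• T₁))) e))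
        cases 1 0 _ _ e = ⊥-elim (T₂≉0 (trans (sym (trans (+-identityʳ _) (1• T₂))) e))
        cases 1 1 _ _ e = ⊥-elim (T₁≉T₂ (∙-cancelʳ T₁ T₁ T₂ (begin
          T₁ + T₁              ≈⟨ +-congˡ (sym (1• T₁)) ⟩
          2 • T₁               ≈⟨ 2T₁ ⟩
          0#                   ≈⟨ sym e ⟩
          1 • T₂ + 1 • T₁      ≈⟨ +-cong (1• T₂) (1• T₁) ⟩
          T₂ + T₁              ∎)))
        cases (suc (suc _)) _ (ℕ.s≤s (ℕ.s≤s ())) _ _
        cases _ (suc (suc _)) _ (ℕ.s≤s (ℕ.s≤s ())) _

      order-5 : ∀ m → m • P ≈ 0# → m % 5 ≡ 0
      order-5 m e = cases (m % 5) (m%n<n m 5) (trans (•-% 5 P 5P m) e)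
        where
        invert : ∀ i j → (j ℕ.* i) % 5 ≡ 1 → i • P ≈ 0# → P ≈ 0#
        invert i j ij≡1 e = begin
          P                          ≈⟨ sym (1• P) ⟩
          1 • P                      ≡⟨ cong (_• P) (≡.sym ij≡1) ⟩
          ((j ℕ.* i) % 5) • P        ≈⟨ •-% 5 P 5P (j ℕ.* i) ⟩
          (j ℕ.* i) • P              ≈⟨ •-multiple i P e j ⟩
          0#                         ∎
        cases : ∀ i → i ℕ.< 5 → i • P ≈ 0# → i ≡ 0
        cases 0 _ _ = ≡.refl
        cases 1 _ e = ⊥-elim (P≉0 (invert 1 1 ≡.refl e))
        cases 2 _ e = ⊥-elim (P≉0 (invert 2 3 ≡.refl e))
        cases 3 _ e = ⊥-elim (P≉0 (invert 3 2 ≡.refl e))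
        cases 4 _ e = ⊥-elim (P≉0 (invert 4 4 ≡.refl e))
        cases (suc (suc (suc (suc (suc _))))) (ℕ.s≤s (ℕ.s≤s (ℕ.s≤s (ℕ.s≤s (ℕ.s≤s ()))))) _

      -- Multiplication by 5 leaves i T₂ + j T₁ and multiplication by 6 leaves j P. So the image
      -- determines i and j modulo 2 and j modulo 5, hence j modulo 10.
      ψ-injective : ∀ u v → ψ u ≈ ψ v → u ≡ v
      ψ-injective (i , j) (k , l) e =
        -- Differences are avoided: modulo 2 they are sums, and modulo 5 one has j - l ≡ j + 4 l.
        let (p , q) = independent (toℕ i ℕ.+ toℕ k) (toℕ j ℕ.+ toℕ l) two
            (r , s) = toWitness {a? = check} _ i k j l p q (order-5 (toℕ j ℕ.+ 4 ℕ.* toℕ l) five)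
        in cong₂ _,_ r s
        where
        check : Dec (∀ (i k : Fin 2) (j l : Fin 10) → (toℕ i ℕ.+ toℕ k) % 2 ≡ 0 → (toℕ j ℕ.+ toℕ l) % 2 ≡ 0 →
          (toℕ j ℕ.+ 4 ℕ.* toℕ l) % 5 ≡ 0 → i ≡ k × j ≡ l)
        check = FinP.all? λ i → FinP.all? λ k → FinP.all? λ j → FinP.all? λ l →
          ((toℕ i ℕ.+ toℕ k) % 2 ℕ.≟ 0) →-dec ((toℕ j ℕ.+ toℕ l) % 2 ℕ.≟ 0) →-dec
          ((toℕ j ℕ.+ 4 ℕ.* toℕ l) % 5 ℕ.≟ 0) →-dec ((i FinP.≟ k) ×-dec (j FinP.≟ l))
        fivefold : ∀ i j → 5 • ψ (i , j) ≈ toℕ i • T₂ + toℕ j • T₁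
        fivefold i j = trans (ψ-multiple 5 i j) (+-cong (•-congʳ (toℕ i) (trans (sym (•-% 2 T₂ 2T₂ 5)) (1• T₂))) (•-congʳ (toℕ j) 5S))
        sixfold : ∀ i j → 6 • ψ (i , j) ≈ toℕ j • P
        sixfold i j = trans (ψ-multiple 6 i j)
          (trans (+-cong (trans (•-congʳ (toℕ i) (sym (•-% 2 T₂ 2T₂ 6))) (•-0 (toℕ i))) (•-congʳ (toℕ j) 6S)) (+-identityˡ _))
        two : (toℕ i ℕ.+ toℕ k) • T₂ + (toℕ j ℕ.+ toℕ l) • T₁ ≈ 0#
        two = begin
          (toℕ i ℕ.+ toℕ k) • T₂ + (toℕ j ℕ.+ toℕ l) • T₁
            ≈⟨ +-cong (•-homo-+ T₂ (toℕ i) (toℕ k)) (•-homo-+ T₁ (toℕ j) (toℕ l)) ⟩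
          (toℕ i • T₂ + toℕ k • T₂) + (toℕ j • T₁ + toℕ l • T₁)
            ≈⟨ interchange _ _ _ _ ⟩
          (toℕ i • T₂ + toℕ j • T₁) + (toℕ k • T₂ + toℕ l • T₁)
            ≈⟨ +-congʳ (trans (sym (fivefold i j)) (trans (•-congʳ 5 e) (fivefold k l))) ⟩
          (toℕ k • T₂ + toℕ l • T₁) + (toℕ k • T₂ + toℕ l • T₁)
            ≈⟨ +-congˡ (sym (1• _)) ⟩
          2 • (toℕ k • T₂ + toℕ l • T₁)
            ≈⟨ •-distrib-+ _ _ 2 ⟩
          2 • (toℕ k • T₂) + 2 • (toℕ l • T₁)
            ≈⟨ +-cong (trans (•-swap 2 (toℕ k) T₂) (trans (•-congʳ (toℕ k) 2T₂) (•-0 (toℕ k))))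
                      (trans (•-swap 2 (toℕ l) T₁) (trans (•-congʳ (toℕ l) 2T₁) (•-0 (toℕ l)))) ⟩
          0# + 0#
            ≈⟨ +-identityˡ 0# ⟩
          0# ∎
        five : (toℕ j ℕ.+ 4 ℕ.* toℕ l) • P ≈ 0#
        five = begin
          (toℕ j ℕ.+ 4 ℕ.* toℕ l) • P                 ≈⟨ •-homo-+ P (toℕ j) (4 ℕ.* toℕ l) ⟩
          toℕ j • P + (4 ℕ.* toℕ l) • P               ≈⟨ +-congʳ (trans (sym (sixfold i j)) (trans (•-congʳ 6 e) (sixfold k l))) ⟩
          toℕ l • P + (4 ℕ.* toℕ l) • P               ≈⟨ sym (•-homo-+ P (toℕ l) (4 ℕ.* toℕ l)) ⟩
          (toℕ l ℕ.+ 4 ℕ.* toℕ l) • P                 ≡⟨ cong (_• P) (ℕP.*-comm 5 (toℕ l)) ⟩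
          (toℕ l ℕ.* 5) • P                           ≈⟨ •-multiple 5 P 5P (toℕ l) ⟩
          0#                                          ∎

      -- A torsion element outside the image would give 21 torsion elements in 20 classes.
      module _ (Class : Carrier → Fin 20 → Set) (classify : ∀ g → ∃ (Class g))
        (separated : ∀ {g h i} → Class g i → Class h i → Torsion (g + - h) → g ≈ h) where

        torsion-in-image : ∀ {g} → Torsion g → ∃ λ u → ψ u ≈ g
        torsion-in-image {g} tg = find (FinP.pigeonhole (ℕP.n<1+n 20) (λ i → proj₁ (classify (f i))))
          where
          -- Index 0 is g and the others enumerate the image of ψ. A collision thus either involves
          -- g or contradicts injectivity of ψ.
          f : Fin 21 → Carrier
          f zero = g
          f (suc i) = ψ (remQuot {2} 10 i)
          f-torsion : ∀ i → Torsion (f i)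
          f-torsion zero = tg
          f-torsion (suc i) = ψ-torsion (remQuot {2} 10 i)
          equal : ∀ i j → proj₁ (classify (f i)) ≡ proj₁ (classify (f j)) → f i ≈ f j
          equal i j e = separated (proj₂ (classify (f i))) (subst (Class (f j)) (≡.sym e) (proj₂ (classify (f j))))
            (torsion-+ (f-torsion i) (torsion-neg (f-torsion j)))
          find : (∃ λ i → ∃ λ j → i Fin.< j × proj₁ (classify (f i)) ≡ proj₁ (classify (f j))) → ∃ λ u → ψ u ≈ g
          find (zero , suc j , _ , e) = remQuot {2} 10 j , sym (equal zero (suc j) e)
          find (suc i , suc j , i<j , e) = ⊥-elim (ℕP.<⇒≢ i<j (cong (λ k → suc (toℕ k)) i≡j))
            where
            i≡j : i ≡ j
            i≡j = ≡.trans (≡.sym (FinP.combine-remQuot {2} 10 i)) (≡.trans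
              (cong (λ (a , b) → combine {2} {10} a b) (ψ-injective (remQuot {2} 10 i) (remQuot {2} 10 j) (equal (suc i) (suc j) e))) (FinP.combine-remQuot {2} 10 j))

-- The induced curve of a triple and its reduction modulo 17

module TripleCurves where
  open FieldSolver
  open EllipticCurves
  open Places
  open ReductionModP
  open TorsionSubgroups
  open import Algebra.Bundles using (AbelianGroup)
  open import Level using (0ℓ)
  open import Data.Fin using (Fin; zero; suc; toℕ; fromℕ<)
  import Data.Fin.Properties as FinP
  open import Data.Integer as ℤ using (ℤ)
  import Data.Integer.DivMod as ℤDM
  open import Data.Integer.Divisibility.Signed using (_∣_; divides; ∣m∣n⇒∣m+n; ∣n⇒∣m*n; ∣m⇒∣m*n; ∣m∣n⇒∣m-n; ∣-reflexive; _∣?_)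
  open import Data.Integer.Tactic.RingSolver using (solve-∀)
  open import Data.Maybe using (Maybe; just; nothing)
  open import Data.Nat as ℕ using (ℕ; zero; suc)
  open import Data.Product using (Σ; ∃; _×_; _,_; proj₁; proj₂)
  open import Data.Product.Properties using (≡-dec)
  open import Data.Sum using (_⊎_; inj₁; inj₂; [_,_]′)
  open import Data.Unit using (tt)
  open import Data.Vec using (Vec; []; _∷_; lookup)
  open import Relation.Binary.PropositionalEquality
  open import Relation.Nullary using (¬_; yes; no; _→-dec_)
  open import Relation.Nullary.Decidable using (toWitness; toWitnessFalse)

  -- The reduction mod 17 of every curve of the family is y² = 16x³ + 7x² + 10x + 1.
  module ReducedCurve where
    reducedCubic reducedDerivative : ℤ → ℤ
    reducedCubic m = ℤ.+ 16 ℤ.* m ℤ.* m ℤ.* m ℤ.+ ℤ.+ 7 ℤ.* m ℤ.* m ℤ.+ ℤ.+ 10 ℤ.* m ℤ.+ ℤ.1ℤ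
    reducedDerivative m = ℤ.+ 16 ℤ.* (m ℤ.* m ℤ.+ m ℤ.* m ℤ.+ m ℤ.* m) ℤ.+ ℤ.+ 7 ℤ.* (m ℤ.+ m) ℤ.+ ℤ.+ 10

    17∤_ : ℤ → Set
    17∤ n = ¬ ℤ.+ 17 ∣ n

    -- A Bézout relation between the cubic and its derivative modulo 17.
    reduced-nonsingular : ∀ m → ℤ.+ 17 ∣ reducedCubic m → 17∤ reducedDerivative m
    reduced-nonsingular m d e = toWitnessFalse {a? = ℤ.+ 17 ∣? ℤ.1ℤ} _ (subst (ℤ.+ 17 ∣_) (sym (bezout m))
      (∣m∣n⇒∣m-n (∣m∣n⇒∣m+n (∣n⇒∣m*n (ℤ.+ 8 ℤ.+ ℤ.+ 16 ℤ.* m) d) (∣n⇒∣m*n (ℤ.1ℤ ℤ.+ ℤ.+ 6 ℤ.* m ℤ.+ ℤ.+ 6 ℤ.* m ℤ.* m) e))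
        (∣m⇒∣m*n {i = ℤ.+ 17} (ℤ.1ℤ ℤ.+ ℤ.+ 10 ℤ.* m ℤ.+ ℤ.+ 24 ℤ.* m ℤ.* m ℤ.+ ℤ.+ 36 ℤ.* m ℤ.* m ℤ.* m ℤ.+ ℤ.+ 32 ℤ.* m ℤ.* m ℤ.* m ℤ.* m) (∣-reflexive refl))))
      where
      bezout : ∀ m → ℤ.1ℤ ≡ (ℤ.+ 8 ℤ.+ ℤ.+ 16 ℤ.* m) ℤ.* (ℤ.+ 16 ℤ.* m ℤ.* m ℤ.* m ℤ.+ ℤ.+ 7 ℤ.* m ℤ.* m ℤ.+ ℤ.+ 10 ℤ.* m ℤ.+ ℤ.1ℤ)
        ℤ.+ (ℤ.1ℤ ℤ.+ ℤ.+ 6 ℤ.* m ℤ.+ ℤ.+ 6 ℤ.* m ℤ.* m) ℤ.* (ℤ.+ 16 ℤ.* (m ℤ.* m ℤ.+ m ℤ.* m ℤ.+ m ℤ.* m) ℤ.+ ℤ.+ 7 ℤ.* (m ℤ.+ m) ℤ.+ ℤ.+ 10)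
        ℤ.- ℤ.+ 17 ℤ.* (ℤ.1ℤ ℤ.+ ℤ.+ 10 ℤ.* m ℤ.+ ℤ.+ 24 ℤ.* m ℤ.* m ℤ.+ ℤ.+ 36 ℤ.* m ℤ.* m ℤ.* m ℤ.+ ℤ.+ 32 ℤ.* m ℤ.* m ℤ.* m ℤ.* m)
      bezout = solve-∀

    affinePoints : Vec (ℕ × ℕ) 19
    affinePoints = (0 , 1) ∷ (0 , 16) ∷ (1 , 0) ∷ (3 , 4) ∷ (3 , 13) ∷ (4 , 2) ∷ (4 , 15) ∷ (5 , 4) ∷ (5 , 13) ∷ (8 , 0)
      ∷ (11 , 1) ∷ (11 , 16) ∷ (12 , 8) ∷ (12 , 9) ∷ (13 , 1) ∷ (13 , 16) ∷ (15 , 0) ∷ (16 , 4) ∷ (16 , 13) ∷ []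

    integerPair : ℕ × ℕ → ℤ × ℤ
    integerPair (m , n) = ℤ.+ m , ℤ.+ n

    abstract
      -- Decided by running through all 289 pairs of residues. With the point at infinity this
      -- leaves 20 classes, the order of ℤ/2 × ℤ/10.
      complete : ∀ (x y : Fin 17) → ℤ.+ 17 ∣ ℤ.+ toℕ y ℤ.* ℤ.+ toℕ y ℤ.- reducedCubic (ℤ.+ toℕ x) →
        ∃ λ i → lookup affinePoints i ≡ (toℕ x , toℕ y)
      complete = toWitness {a? = FinP.all? λ x → FinP.all? λ y →
        (ℤ.+ 17 ∣? ℤ.+ toℕ y ℤ.* ℤ.+ toℕ y ℤ.- reducedCubic (ℤ.+ toℕ x)) →-dec
        FinP.any? λ i → ≡-dec ℕ._≟_ ℕ._≟_ (lookup affinePoints i) (toℕ x , toℕ y)} _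

  -- With B = ab + ac + bc and C = a + b + c, regularity is (a + b - c)² = 4(ab + 1); then OrderFive says that
  -- doubling (0 , 1) twice gives (0 , -1).
  module Conditions (𝔽 : DecField) where
    open DecField 𝔽

    two four : F
    two = 1# + 1#
    four = 1# + 1# + 1# + 1#

    Regular OrderFive : F → F → Set
    Regular B C = C * C ≡ four * B + four
    OrderFive A C = two * A * (two * A + C) ≡ 1#

  module TangentLines (𝔽 : DecField) {A B C : DecField.F 𝔽}
    (regular : Conditions.Regular 𝔽 B C) (order-five : Conditions.OrderFive 𝔽 A C) where
    open DecField 𝔽
    open FieldLemmas 𝔽
    open Curve 𝔽 A B C
    open Conditions 𝔽

    -- The tangent at (0 , 1) has slope C/2, and regularity says C²/4 - B = 1, so the third abscissa
    -- is 1/A.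
    tangentLine : ∀ {h i} → two * h ≡ 1# → A * i ≡ 1# → Line (C * h) 1# 0# 1# 0# 1# i (C * h * i + 1#)
    tangentLine {h} {i} e f = mkLine (solve 2 (λ C h → con 1 := C :* h :* con 0 :+ con 1)
        refl C h) (solve 2 (λ C h → con 1 := C :* h :* con 0 :+ con 1) refl C h) refl
      (linear₃ 1# f (- (h * h)) regular (- ((B + 1#) * (1# + two * h))) e (solve 5 (λ A i C h B → A :* (con 0
          :+ con 0 :+ i) :- (C :* h :* (C :* h) :- B) := con 1 :* (A :* i :- con 1) :+ :- (h :* h) :* (C :* C
          :- (con 4 :* B :+ con 4)) :+ :- ((B :+ con 1) :* (con 1 :+ con 2 :* h)) :* (con 2 :* h
          :- con 1)) refl A i C h B)) (linear₁ C e (solve 4 (λ A i C h → A :* (con 0 :* con 0 :+ con 0 :* i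
          :+ con 0 :* i) :- (C :- con 2 :* (C :* h :* con 1)) := C :* (con 2 :* h :- con 1))
          refl A i C h)) (solve 2 (λ A i → A :* (con 0 :* con 0 :* i) := con 1 :* con 1 :- con 1) refl A i)

    -- The tangent at the double of (0 , 1) has slope -(C/2 + 2A), and `OrderFive` is the condition
    -- for it to pass through (0 , 1) again. Hence four times (0 , 1) is (0 , -1).
    secondTangentLine : ∀ {h i} → two * h ≡ 1# → A * i ≡ 1# →
      Line (- (C * h + two * A)) 1# i (- (C * h * i + 1#)) i (- (C * h * i + 1#)) 0# 1#
    secondTangentLine {h} {i} e f = mkLine (linear₁ two f (solve 4 (λ C h i A → :- (C :* h :* i :+ con 1) :- (:- (C
        :* h :+ con 2 :* A) :* i :+ con 1) := con 2 :* (A :* i :- con 1))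
        refl C h i A)) (linear₁ two f (solve 4 (λ C h i A → :- (C :* h :* i :+ con 1) :- (:- (C :* h :+ con 2 :* A)
        :* i :+ con 1) := con 2 :* (A :* i :- con 1)) refl C h i A)) (solve 3 (λ C h A → con 1 := :- (C :* h
        :+ con 2 :* A) :* con 0 :+ con 1) refl C h A)
      (linear₄ two f (- (h * h)) regular (- 1#) order-five (- ((B + 1#) * (1# + two * h)) - two * A * C) e (solve 5 (λ A i C h B → A
          :* (i :+ i :+ con 0) :- (:- (C :* h :+ con 2 :* A) :* :- (C :* h :+ con 2 :* A) :- B) := con 2 :* (A
          :* i :- con 1) :+ :- (h :* h) :* (C :* C :- (con 4 :* B :+ con 4)) :+ :- con 1 :* (con 2 :* A
          :* (con 2 :* A :+ C) :- con 1) :+ (:- ((B :+ con 1) :* (con 1 :+ con 2 :* h)) :- con 2 :* A :* C)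
          :* (con 2 :* h :- con 1)) refl A i C h B))
      (linear₃ (i + four * A + two * C) f (- i) order-five (- C) e (solve 4 (λ A i C h → A :* (i :* i :+ i :* con 0
          :+ i :* con 0) :- (C :- con 2 :* (:- (C :* h :+ con 2 :* A) :* con 1)) := (i :+ con 4 :* A
          :+ con 2 :* C) :* (A :* i :- con 1) :+ :- i :* (con 2 :* A :* (con 2 :* A :+ C) :- con 1) :+ :- C
          :* (con 2 :* h :- con 1)) refl A i C h)) (solve 2 (λ A i → A :* (i :* i :* con 0) := con 1 :* con 1
          :- con 1) refl A i)

  module Triple (𝔽 : DecField) (place : Place 𝔽 17) (a b c : DecField.F 𝔽) where
    open DecField 𝔽
    open FieldLemmas 𝔽
    open FromIntegers isCommutativeRing using (ι)
    open Place place
    open PlaceLemmas place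
    open ReducedCurve

    open Conditions 𝔽

    A B C : F
    A = a * b * c
    B = a * b + a * c + b * c
    C = a + b + c

    open Curve 𝔽 A B C

    module Torsion (a≢0 : a ≢ 0#) (b≢0 : b ≢ 0#) (c≢0 : c ≢ 0#) (a≢b : a ≢ b) (a≢c : a ≢ c) (b≢c : b ≢ c)
      (regular : Regular B C) (order-five : OrderFive A C)
      (res-A : Res A (ℤ.+ 16)) where

      unit-numeral : ∀ n → 17∤ (ℤ.+ n) → Unit (ι (ℤ.+ n))
      unit-numeral n ∤n = ℤ.+ n , res-ι (ℤ.+ n) , ∤n

      17∤2 : 17∤ (ℤ.+ 2)
      17∤2 = toWitnessFalse {a? = ℤ.+ 17 ∣? ℤ.+ 2} _

      2≢0 : two ≢ 0#
      2≢0 = unit-≢0 (unit-numeral 2 17∤2)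

      4≢0 : four ≢ 0#
      4≢0 = unit-≢0 (unit-numeral 4 (toWitnessFalse {a? = ℤ.+ 17 ∣? ℤ.+ 4} _))

      unit-A : Unit A
      unit-A = ℤ.+ 16 , res-A , toWitnessFalse {a? = ℤ.+ 17 ∣? ℤ.+ 16} _

      A≢0 : A ≢ 0#
      A≢0 = *-≢0 (*-≢0 a≢0 b≢0) c≢0

      17∣17* : ∀ n → ℤ.+ 17 ∣ ℤ.+ 17 ℤ.* n
      17∣17* n = ∣m⇒∣m*n {i = ℤ.+ 17} n (∣-reflexive refl)

      inverse-residue : ∀ {u m} → Res u m → 17∤ m → u ≢ 0# → ∃ λ n → Res (inv u) n × ℤ.+ 17 ∣ m ℤ.* n ℤ.- ℤ.1ℤ
      inverse-residue {u} r ∤m u≢0 = let (n , s) = res-inv r ∤m (*-inv u u≢0) in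
        n , s , res-unique (res-* r s) (subst (λ t → Res t ℤ.1ℤ) (sym (*-inv u u≢0)) (res-ι ℤ.1ℤ))

      -- `OrderFive` gives C = (1 - 4A²)/(2A), so the reduction of C is a function of that of A.
      res-C : Res C (ℤ.+ 10)
      res-C = let (n , s , d) = inverse-residue (res-* (res-ι (ℤ.+ 2)) res-A) (toWitnessFalse {a? = ℤ.+ 17 ∣? ℤ.+ 32} _) (*-≢0 2≢0 A≢0) in
        res-shift {m = (ℤ.1ℤ ℤ.+ ℤ.- (ℤ.+ 4 ℤ.* ℤ.+ 16 ℤ.* ℤ.+ 16)) ℤ.* n} (subst (λ t → Res t ((ℤ.1ℤ ℤ.+ ℤ.- (ℤ.+ 4 ℤ.* ℤ.+ 16 ℤ.* ℤ.+ 16)) ℤ.* n)) (sym C≡) (res-* (res-+ (res-ι ℤ.1ℤ) (res-neg (res-* (res-* (res-ι (ℤ.+ 4)) res-A) res-A))) s))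
          (subst (ℤ.+ 17 ∣_) (sym (collect n)) (∣m∣n⇒∣m+n (∣n⇒∣m*n (ℤ.+ 10) d) (17∣17* (ℤ.- ℤ.+ 79 ℤ.* n))))
        where
        collect : ∀ n → (ℤ.1ℤ ℤ.+ ℤ.- (ℤ.+ 4 ℤ.* ℤ.+ 16 ℤ.* ℤ.+ 16)) ℤ.* n ℤ.- ℤ.+ 10 ≡
          ℤ.+ 10 ℤ.* (ℤ.+ 32 ℤ.* n ℤ.- ℤ.1ℤ) ℤ.+ ℤ.+ 17 ℤ.* (ℤ.- ℤ.+ 79 ℤ.* n)
        collect = solve-∀
        solveC : ∀ A C i → two * A * (two * A + C) ≡ 1# → two * A * i ≡ 1# → C ≡ (1# + - (four * A * A)) * i
        solveC A C i e f = linear₂ i e (- C) f (solve 3 (λ C A i → C :- (con 1 :- con 4 :* A :* A) :* i := i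
            :* (con 2 :* A :* (con 2 :* A :+ C) :- con 1) :+ :- C :* (con 2 :* A :* i :- con 1)) refl C A i)
        C≡ : C ≡ (1# + - (four * A * A)) * inv (two * A)
        C≡ = solveC A C (inv (two * A)) order-five (*-inv (two * A) (*-≢0 2≢0 A≢0))

      -- Regularity gives B = (C² - 4)/4, and (100 - 4)/4 = 24 ≡ 7.
      res-B : Res B (ℤ.+ 7)
      res-B = let (n , s , d) = inverse-residue (res-ι (ℤ.+ 4)) (toWitnessFalse {a? = ℤ.+ 17 ∣? ℤ.+ 4} _) 4≢0 in
        res-shift {m = (ℤ.+ 10 ℤ.* ℤ.+ 10 ℤ.+ ℤ.- ℤ.+ 4) ℤ.* n} (subst (λ t → Res t ((ℤ.+ 10 ℤ.* ℤ.+ 10 ℤ.+ ℤ.- ℤ.+ 4) ℤ.* n)) (sym B≡) (res-* (res-+ (res-* res-C res-C) (res-neg (res-ι (ℤ.+ 4)))) s))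
          (subst (ℤ.+ 17 ∣_) (sym (collect n)) (∣m∣n⇒∣m+n (∣n⇒∣m*n (ℤ.+ 7) d) (17∣17* (ℤ.+ 4 ℤ.* n))))
        where
        collect : ∀ n → (ℤ.+ 10 ℤ.* ℤ.+ 10 ℤ.+ ℤ.- ℤ.+ 4) ℤ.* n ℤ.- ℤ.+ 7 ≡ ℤ.+ 7 ℤ.* (ℤ.+ 4 ℤ.* n ℤ.- ℤ.1ℤ) ℤ.+ ℤ.+ 17 ℤ.* (ℤ.+ 4 ℤ.* n)
        collect = solve-∀
        solveB : ∀ B C i → C * C ≡ four * B + four → four * i ≡ 1# → B ≡ (C * C + - four) * i
        solveB B C i e f = linear₂ (- i) e (- B) f (solve 3 (λ B C i → B :- (C :* C :- con 4) :* i := :- i :* (C :* C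
            :- (con 4 :* B :+ con 4)) :+ :- B :* (con 4 :* i :- con 1)) refl B C i)
        B≡ : B ≡ (C * C + - four) * inv four
        B≡ = solveB B C (inv four) regular (*-inv four 4≢0)

      factorised = solve 4 (λ a b c x → (a :* x :+ con 1) :* (b :* x :+ con 1) :* (c :* x :+ con 1) := a :* b :* c
          :* x :* x :* x :+ (a :* b :+ a :* c :+ b :* c) :* x :* x :+ (a :+ b :+ c) :* x :+ con 1) refl

      zero-factor : ∀ {x y} → x * y ≡ 0# → x ≡ 0# ⊎ y ≡ 0#
      zero-factor {x} e with x ≟ 0#
      ... | yes p = inj₁ p
      ... | no ¬p = inj₂ (zeroProduct ¬p e)

      -- At the root x = -1/r the derivative is r (s x + 1)(t x + 1) = (r - s)(r - t)/r, nonzero for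
      -- a triple of distinct elements.
      nonsingular : ∀ x → cubic x ≡ 0# → dividedDifference x x ≢ 0#
      nonsingular x e d = [ [ at-root a≢0 a≢b a≢c (derivative a b c x) d , at-root b≢0 (λ p → a≢b (sym p)) b≢c (trans (symmetric₁ a b c x) (derivative b a c x)) d ]′ ,
        at-root c≢0 (λ p → a≢c (sym p)) (λ p → b≢c (sym p)) (trans (symmetric₂ a b c x) (derivative c a b x)) d ]′
          (split (zero-factor (trans (factorised a b c x) e)))
        where
        dd : F → F → F → F → F
        dd a b c x = a * b * c * (x * x + x * x + x * x) + (a * b + a * c + b * c) * (x + x) + (a + b + c)
        split : (a * x + 1#) * (b * x + 1#) ≡ 0# ⊎ c * x + 1# ≡ 0# → (a * x + 1# ≡ 0# ⊎ b * x + 1# ≡ 0#) ⊎ c * x + 1# ≡ 0#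
        split (inj₁ p) = inj₁ (zero-factor p)
        split (inj₂ p) = inj₂ p
        symmetric₁ = solve 4 (λ a b c x → a :* b :* c :* (x :* x :+ x :* x :+ x :* x) :+ (a :* b :+ a :* c :+ b :* c)
            :* (x :+ x) :+ (a :+ b :+ c) := b :* a :* c :* (x :* x :+ x :* x :+ x :* x) :+ (b :* a :+ b :* c :+ a :* c)
            :* (x :+ x) :+ (b :+ a :+ c)) refl
        symmetric₂ = solve 4 (λ a b c x → a :* b :* c :* (x :* x :+ x :* x :+ x :* x) :+ (a :* b :+ a :* c :+ b :* c)
            :* (x :+ x) :+ (a :+ b :+ c) := c :* a :* b :* (x :* x :+ x :* x :+ x :* x) :+ (c :* a :+ c :* b :+ a :* b)
            :* (x :+ x) :+ (c :+ a :+ b)) refl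
        derivative = solve 4 (λ a b c x → a :* b :* c :* (x :* x :+ x :* x :+ x :* x) :+ (a :* b :+ a :* c :+ b :* c)
            :* (x :+ x) :+ (a :+ b :+ c) := a :* ((b :* x :+ con 1) :* (c :* x :+ con 1)) :+ (a :* x :+ con 1)
            :* (b :* (c :* x :+ con 1) :+ c :* (b :* x :+ con 1))) refl
        at-root : ∀ {r s t d} → r ≢ 0# → r ≢ s → r ≢ t →
          d ≡ r * ((s * x + 1#) * (t * x + 1#)) + (r * x + 1#) * (s * (t * x + 1#) + t * (s * x + 1#)) →
          d ≡ 0# → ¬ r * x + 1# ≡ 0#
        at-root {r} {s} {t} {d} r≢0 r≢s r≢t e d≡0 root =
          *-≢0 (*-≢0 r≢0 (λ p → r≢s (x-y≡0⇒x≡y p))) (λ p → r≢t (x-y≡0⇒x≡y p))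
            (linear₃ (r * r) d≡0 (- (r * r)) e (- (r * r * (s * (t * x + 1#) + t * (s * x + 1#)) + r * (s * (r - t) + t * (r - s) + s * t * (r * x + 1#)))) root (solve 5 (λ r s t d x → r
                :* (r :- s) :* (r :- t) :- con 0 := r :* r :* (d :- con 0) :+ :- (r :* r) :* (d :- (r :* ((s :* x
                :+ con 1) :* (t :* x :+ con 1)) :+ (r :* x :+ con 1) :* (s :* (t :* x :+ con 1) :+ t :* (s :* x
                :+ con 1)))) :+ :- (r :* r :* (s :* (t :* x :+ con 1) :+ t :* (s :* x :+ con 1)) :+ r :* (s :* (r
                :- t) :+ t :* (r :- s) :+ s :* t :* (r :* x :+ con 1))) :* (r :* x :+ con 1 :- con 0))
                refl r s t d x))

      open Reduction place A B C unit-A (_ , res-B) (_ , res-C) 2≢0 nonsingular public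
      open GroupLaw A≢0 2≢0 nonsingular public
      open GoodReduction (ℤ.+ 16) (ℤ.+ 7) (ℤ.+ 10) res-A res-B res-C 17∤2 reduced-nonsingular

      -- Equality compares the points only, not the proofs that they lie on the curve.
      pointGroup : AbelianGroup 0ℓ 0ℓ
      pointGroup = record
        { Carrier = Σ Point OnCurve
        ; _≈_ = λ (P , _) (Q , _) → P ≡ Q
        ; _∙_ = λ (P , p) (Q , q) → P ⊕ Q , ⊕-closed P Q p q
        ; ε = O , tt
        ; _⁻¹ = λ (P , p) → neg P , neg-onCurve P p
        ; isAbelianGroup = record
          { isGroup = record
            { isMonoid = record
              { isSemigroup = record
                { isMagma = record
                  { isEquivalence = record { refl = refl ; sym = sym ; trans = trans }
                  ; ∙-cong = cong₂ _⊕_ }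
                ; assoc = λ (P , p) (Q , q) (R , r) → ⊕-assoc P Q R p q r }
              ; identity = (λ (P , _) → ⊕-identityˡ P) , (λ (P , _) → ⊕-identityʳ P) }
            ; inverse = (λ (P , p) → trans (⊕-comm (neg P) P (neg-onCurve P p) p) (⊕-inverseʳ P)) , (λ (P , _) → ⊕-inverseʳ P)
            ; ⁻¹-cong = cong neg }
          ; comm = λ (P , p) (Q , q) → ⊕-comm P Q p q } }

      open AbelianGroup pointGroup using (Carrier; _≈_)
      open TorsionSubgroup pointGroup using (module Z2×Z10-Embedding)
      open import Algebra.Properties.CommutativeMonoid.Mult (AbelianGroup.commutativeMonoid pointGroup)
        using () renaming (_×_ to _•_; ×-assocˡ to •-assocˡ; ×-congʳ to •-congʳ)

      •≡mul : ∀ n (g : Carrier) → proj₁ (n • g) ≡ mul n (proj₁ g)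
      •≡mul zero g = refl
      •≡mul (suc n) g = cong (proj₁ g ⊕_) (•≡mul n g)

      2-torsion : ∀ {r s t} → r ≢ 0# → (∀ x → (r * x + 1#) * (s * x + 1#) * (t * x + 1#) ≡ cubic x) → Carrier
      2-torsion {r} {s} {t} r≢0 f = aff (- inv r) 0# ,
        trans (linear₁ ((s * (- inv r) + 1#) * (t * (- inv r) + 1#)) (*-inv r r≢0) (solve 4 (λ r i s t → con 0
            :* con 0 :- (r :* :- i :+ con 1) :* (s :* :- i :+ con 1) :* (t :* :- i :+ con 1) := (s :* :- i
            :+ con 1) :* (t :* :- i :+ con 1) :* (r :* i :- con 1)) refl r (inv r) s t)) (f (- inv r))

      T₁ T₂ P₅ : Carrier
      T₁ = 2-torsion {a} {b} {c} a≢0 (factorised a b c)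
      T₂ = 2-torsion {b} {a} {c} b≢0 (λ x → trans (swap (a * x + 1#) (b * x + 1#) (c * x + 1#)) (factorised a b c x))
        where
        swap = solve 3 (λ u v w → v :* u :* w := u :* v :* w) refl
      P₅ = aff 0# 1# , one A B C
        where
        one = solve 3 (λ A B C → con 1 :* con 1 := A :* con 0 :* con 0 :* con 0 :+ B :* con 0 :* con 0
            :+ C :* con 0 :+ con 1) refl

      2T≈0 : ∀ {x} on → 2 • (aff x 0# , on) ≈ (O , tt)
      2T≈0 on = trans (cong (aff _ 0# ⊕_) (⊕-identityʳ _)) (opposite-⊕ (refl , +-identityˡ 0#))

      open TangentLines 𝔽 {A} {B} {C} regular order-five using (tangentLine; secondTangentLine)

      5P≈0 : 5 • P₅ ≈ (O , tt)
      5P≈0 = trans (cong (aff 0# 1# ⊕_) 4P≡) (opposite-⊕ (refl , -‿inverseʳ 1#))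
        where
        e = *-inv two 2≢0
        f = *-inv A A≢0
        2P≡ : proj₁ (2 • P₅) ≡ aff (inv A) (- (C * inv two * inv A + 1#))
        2P≡ = trans (cong (aff 0# 1# ⊕_) (⊕-identityʳ _)) (line-⊕ (tangentLine e f) (¬line-opposite (tangentLine e f)))
        double : ∀ (g : Carrier) {Q} → proj₁ g ≡ Q → proj₁ (2 • g) ≡ Q ⊕ Q
        double g refl = cong (proj₁ g ⊕_) (⊕-identityʳ (proj₁ g))
        4P≡ : proj₁ (4 • P₅) ≡ aff 0# (- 1#)
        4P≡ = trans (sym (•-assocˡ P₅ 2 2)) (trans (double (2 • P₅) 2P≡)
          (line-⊕ (secondTangentLine e f) (¬line-opposite (secondTangentLine e f))))

      T₁≉T₂ : ¬ T₁ ≈ T₂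
      T₁≉T₂ e = a≢b (linear₃ (- a) (*-inv b b≢0) b (*-inv a a≢0) (a * b) (proj₁ (aff-injective e)) (solve 4 (λ a b j i → a
          :- b := :- a :* (b :* j :- con 1) :+ b :* (a :* i :- con 1) :+ a :* b :* (:- i :- :- j))
          refl a b (inv b) (inv a)))

      open Z2×Z10-Embedding T₁ T₂ P₅ (2T≈0 (proj₂ T₁)) (2T≈0 (proj₂ T₂)) 5P≈0 (λ ()) (λ ()) T₁≉T₂ (λ ()) public
        using (ψ; ψ-homo; ψ-injective; torsion-in-image)

      residueClass : Fin 20 → Maybe (ℤ × ℤ)
      residueClass zero = nothing
      residueClass (suc i) = just (integerPair (lookup affinePoints i))

      classify : ∀ g → ∃ λ i → ReducesTo (proj₁ g) (residueClass i)
      classify (Q , q) = find q (proj₂ (reduce Q q))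
        where
        normalise : ∀ {x m} → Res x m → ∃ λ (i : Fin 17) → Res x (ℤ.+ toℕ i)
        normalise {x} {m} r = fromℕ< (ℤDM.n%ℕd<d m 17) , subst (λ k → Res x (ℤ.+ k)) (sym (FinP.toℕ-fromℕ< (ℤDM.n%ℕd<d m 17)))
          (res-shift r (divides (m ℤDM./ℕ 17) (trans (cong (ℤ._- (ℤ.+ (m ℤDM.%ℕ 17))) (ℤDM.a≡a%ℕn+[a/ℕn]*n m 17)) (cancel (ℤ.+ (m ℤDM.%ℕ 17)) ((m ℤDM./ℕ 17) ℤ.* ℤ.+ 17)))))
          where
          cancel : ∀ u v → u ℤ.+ v ℤ.- u ≡ v
          cancel = solve-∀
        find : ∀ {Q r} → OnCurve Q → ReducesTo Q r → ∃ λ i → ReducesTo Q (residueClass i)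
        find q (infinite ch) = zero , infinite ch
        find {Q} q (finite rx ry) =
          let (i , rx′) = normalise rx
              (j , ry′) = normalise ry
              (k , e) = complete i j (curve-residue q rx′ ry′)
          in suc k , subst (λ r → ReducesTo Q (just r)) (sym (cong integerPair e)) (finite rx′ ry′)

      difference-zero : ∀ {Q R} → OnCurve Q → OnCurve R → Q ⊕ neg R ≡ O → Q ≡ R
      difference-zero {Q} {R} q r e = begin
          Q                    ≡⟨ sym (⊕-identityʳ Q) ⟩
          Q ⊕ O                ≡⟨ cong (Q ⊕_) (sym (trans (⊕-comm (neg R) R (neg-onCurve R r) r) (⊕-inverseʳ R))) ⟩
          Q ⊕ (neg R ⊕ R)      ≡⟨ sym (⊕-assoc Q (neg R) R q (neg-onCurve R r) r) ⟩
          Q ⊕ neg R ⊕ R        ≡⟨ cong (_⊕ R) e ⟩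
          O ⊕ R                ≡⟨ ⊕-identityˡ R ⟩
          R                    ∎
        where open ≡-Reasoning

      torsion-classified : ∀ {Q} → OnCurve Q → ∀ n → mul (suc n) Q ≡ O → ∃ λ u → proj₁ (ψ u) ≡ Q
      torsion-classified {Q} q n e = torsion-in-image (λ g i → ReducesTo (proj₁ g) (residueClass i)) classify
        (λ {g} {h} {i} cg ch (m , t) → difference-zero (proj₂ g) (proj₂ h)
          (torsion-free m (⊕-closed _ _ (proj₂ g) (neg-onCurve _ (proj₂ h)))
            (proj₂ (congruent (proj₂ g) (proj₂ h) cg ch))
            (trans (sym (•≡mul (suc m) (proj₁ g ⊕ neg (proj₁ h) , ⊕-closed _ _ (proj₂ g) (neg-onCurve _ (proj₂ h))))) t)))
        {Q , q} (n , trans (•≡mul (suc n) (Q , q)) e)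

-- The place of ℚ(√h) above 17

module SplitPrime where
  open FieldSolver
  open EllipticCurves
  open Places
  open import Data.Empty using (⊥-elim)
  open import Data.Fin using (Fin; zero; suc; toℕ; fromℕ<)
  import Data.Fin.Properties as FinP
  open import Data.Integer as ℤ using (ℤ)
  import Data.Integer.Properties as ℤP
  import Data.Integer.DivMod as ℤDM
  open import Data.Integer.Divisibility.Signed using (_∣_; divides; ∣ᵤ⇒∣; ∣⇒∣ᵤ; ∣m∣n⇒∣m+n; ∣n⇒∣m*n; ∣m⇒∣-m; ∣m⇒∣m*n; ∣m∣n⇒∣m-n; ∣-reflexive; _∣?_)
  open import Data.Integer.Tactic.RingSolver using (solve-∀)
  open import Data.Nat as ℕ using (ℕ; zero; suc)
  import Data.Nat.Properties as ℕP
  import Data.Nat.Divisibility as ℕD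
  open import Data.Nat.Primality using (Prime; prime?; euclidsLemma)
  open import Data.Product using (∃; _×_; _,_; proj₁)
  open import Data.Sum using (_⊎_; inj₁; inj₂; [_,_]′)
  open import Relation.Binary.PropositionalEquality
  open import Relation.Nullary using (¬_; yes; no; _→-dec_)
  open import Relation.Nullary.Decidable using (toWitness; toWitnessFalse)

  module Modulo (p : ℕ) (p-prime : Prime p) where
    infix 4 _≡ₚ_
    record _≡ₚ_ (m n : ℤ) : Set where
      constructor modulo
      field
        p∣difference : ℤ.+ p ∣ m ℤ.- n
    open _≡ₚ_ public

    ≡ₚ-reflexive : ∀ {m n} → m ≡ n → m ≡ₚ n
    ≡ₚ-reflexive {m} refl = modulo (divides ℤ.0ℤ (ℤP.+-inverseʳ m))

    ≡ₚ-sym : ∀ {m n} → m ≡ₚ n → n ≡ₚ m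
    ≡ₚ-sym {m} {n} (modulo (divides q e)) = modulo (divides (ℤ.- q) (trans (flip m n) (trans (cong ℤ.-_ e) (ℤP.neg-distribˡ-* q (ℤ.+ p)))))
      where
      flip : ∀ m n → n ℤ.- m ≡ ℤ.- (m ℤ.- n)
      flip = solve-∀

    ≡ₚ-trans : ∀ {l m n} → l ≡ₚ m → m ≡ₚ n → l ≡ₚ n
    ≡ₚ-trans {l} {m} {n} (modulo d) (modulo e) = modulo (subst (ℤ.+ p ∣_) (telescope l m n) (∣m∣n⇒∣m+n d e))
      where
      telescope : ∀ l m n → l ℤ.- m ℤ.+ (m ℤ.- n) ≡ l ℤ.- n
      telescope = solve-∀

    +-congₚ : ∀ {m m′ n n′} → m ≡ₚ m′ → n ≡ₚ n′ → m ℤ.+ n ≡ₚ m′ ℤ.+ n′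
    +-congₚ {m} {m′} {n} {n′} (modulo d) (modulo e) = modulo (subst (ℤ.+ p ∣_) (regroup m m′ n n′) (∣m∣n⇒∣m+n d e))
      where
      regroup : ∀ m m′ n n′ → m ℤ.- m′ ℤ.+ (n ℤ.- n′) ≡ m ℤ.+ n ℤ.- (m′ ℤ.+ n′)
      regroup = solve-∀

    *-congₚ : ∀ {m m′ n n′} → m ≡ₚ m′ → n ≡ₚ n′ → m ℤ.* n ≡ₚ m′ ℤ.* n′
    *-congₚ {m} {m′} {n} {n′} (modulo d) (modulo e) = modulo (subst (ℤ.+ p ∣_) (regroup m m′ n n′) (∣m∣n⇒∣m+n (∣n⇒∣m*n n d) (∣n⇒∣m*n m′ e)))
      where
      regroup : ∀ m m′ n n′ → n ℤ.* (m ℤ.- m′) ℤ.+ m′ ℤ.* (n ℤ.- n′) ≡ m ℤ.* n ℤ.- m′ ℤ.* n′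
      regroup = solve-∀

    neg-congₚ : ∀ {m m′} → m ≡ₚ m′ → ℤ.- m ≡ₚ ℤ.- m′
    neg-congₚ {m} {m′} (modulo d) = modulo (subst (ℤ.+ p ∣_) (regroup m m′) (∣m⇒∣-m d))
      where
      regroup : ∀ m m′ → ℤ.- (m ℤ.- m′) ≡ ℤ.- m ℤ.- ℤ.- m′
      regroup = solve-∀

    euclidₚ : ∀ m n → ℤ.+ p ∣ m ℤ.* n → ℤ.+ p ∣ m ⊎ ℤ.+ p ∣ n
    euclidₚ m n d with euclidsLemma ℤ.∣ m ∣ ℤ.∣ n ∣ p-prime (subst (p ℕD.∣_) (ℤP.abs-* m n) (∣⇒∣ᵤ d))
    ... | inj₁ e = inj₁ (∣ᵤ⇒∣ e)
    ... | inj₂ e = inj₂ (∣ᵤ⇒∣ e)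

    ∤-* : ∀ {m n} → ¬ ℤ.+ p ∣ m → ¬ ℤ.+ p ∣ n → ¬ ℤ.+ p ∣ m ℤ.* n
    ∤-* {m} {n} ∤m ∤n d = [ ∤m , ∤n ]′ (euclidₚ m n d)

    ∣-resp : ∀ {m n} → m ≡ₚ n → ℤ.+ p ∣ m → ℤ.+ p ∣ n
    ∣-resp {m} {n} (modulo e) d = subst (ℤ.+ p ∣_) (cancel m n) (∣m∣n⇒∣m-n d e)
      where
      cancel : ∀ m n → m ℤ.- (m ℤ.- n) ≡ n
      cancel = solve-∀

  module Modulo17 where
    17-prime : Prime 17
    17-prime = toWitness {a? = prime? 17} _

    open Modulo 17 17-prime public

    remainder : ∀ m → m ≡ₚ ℤ.+ (m ℤDM.%ℕ 17)
    remainder m = modulo (divides (m ℤDM./ℕ 17) (trans (cong (ℤ._- (ℤ.+ (m ℤDM.%ℕ 17))) (ℤDM.a≡a%ℕn+[a/ℕn]*n m 17))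
        (cancel (ℤ.+ (m ℤDM.%ℕ 17)) ((m ℤDM./ℕ 17) ℤ.* ℤ.+ 17))))
      where
      cancel : ∀ u v → u ℤ.+ v ℤ.- u ≡ v
      cancel = solve-∀

    abstract
      inverse₁₇ : ∀ m → ¬ ℤ.+ 17 ∣ m → ∃ λ n → m ℤ.* n ≡ₚ ℤ.1ℤ
      inverse₁₇ m ∤m = let (j , e) = table (fromℕ< lt) (λ d → ∤m (∣-resp (≡ₚ-sym (remainder m)) (subst (λ k → ℤ.+ 17 ∣ ℤ.+ k) (FinP.toℕ-fromℕ< lt) d))) in
        ℤ.+ toℕ j , ≡ₚ-trans (*-congₚ (subst (λ k → m ≡ₚ ℤ.+ k) (sym (FinP.toℕ-fromℕ< lt)) (remainder m)) (≡ₚ-reflexive {ℤ.+ toℕ j} refl)) (modulo e)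
        where
        lt : m ℤDM.%ℕ 17 ℕ.< 17
        lt = ℤDM.n%ℕd<d m 17
        table : ∀ (i : Fin 17) → ¬ ℤ.+ 17 ∣ ℤ.+ toℕ i → ∃ λ (j : Fin 17) → ℤ.+ 17 ∣ ℤ.+ toℕ i ℤ.* ℤ.+ toℕ j ℤ.- ℤ.1ℤ
        table = toWitness {a? = FinP.all? λ i → Relation.Nullary.¬? (ℤ.+ 17 ∣? ℤ.+ toℕ i) →-dec
          FinP.any? λ j → ℤ.+ 17 ∣? ℤ.+ toℕ i ℤ.* ℤ.+ toℕ j ℤ.- ℤ.1ℤ} _

  -- A description of ℚ(√h) with denominators cleared. Here h may have square factors, so that the
  -- heights themselves can be used for h and not only their squarefree parts.
  record SquareRoot (𝔽 : DecField) (h : ℤ) : Set where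
    open DecField 𝔽
    open FromIntegers isCommutativeRing using (ι)
    field
      θ : F
      θ² : θ * θ ≡ ι h
      independent : ∀ x z → ι x + ι z * θ ≡ 0# → x ≡ ℤ.0ℤ × z ≡ ℤ.0ℤ
      spanned : ∀ α → ∃ λ m → ∃ λ x → ∃ λ z → m ≢ ℤ.0ℤ × ι m * α ≡ ι x + ι z * θ

  -- If h ≡ 1 mod 289 then 17 splits in ℚ(√h). At the place used here √h ≡ 1, so √h + 18 is a unit,
  -- while it is a uniformiser at the other place.
  module SplitPlace (𝔽 : DecField) (h k : ℤ) (h≡ : h ≡ ℤ.1ℤ ℤ.+ ℤ.+ 289 ℤ.* k) (√h : SquareRoot 𝔽 h) where
    open DecField 𝔽
    open FieldLemmas 𝔽
    open FromIntegers isCommutativeRing using (ι; ι-+; ι-*; ι-neg)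
    open Modulo17
    open SquareRoot √h
    open Powers 𝔽

    Order : Set
    Order = ℤ × ℤ

    infixl 6 _⊹_
    infixl 7 _⊛_
    _⊹_ _⊛_ : Order → Order → Order
    (a , b) ⊹ (c , e) = a ℤ.+ c , b ℤ.+ e
    (a , b) ⊛ (c , e) = a ℤ.* c ℤ.+ h ℤ.* (b ℤ.* e) , a ℤ.* e ℤ.+ b ℤ.* c

    ⟪_⟫ : Order → F
    ⟪ a , b ⟫ = ι a + ι b * θ

    -- `ρ` is reduction at the place, where √h ≡ 1. It is a ring homomorphism ℤ[√h] → ℤ/17,
    -- multiplicative only modulo 17.
    ρ norm : Order → ℤ
    ρ (a , b) = a ℤ.+ b
    norm (a , b) = a ℤ.* a ℤ.- h ℤ.* (b ℤ.* b)

    ⟪⟫-+ : ∀ u v → ⟪ u ⊹ v ⟫ ≡ ⟪ u ⟫ + ⟪ v ⟫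
    ⟪⟫-+ (a , b) (c , e) = trans (cong₂ (λ s t → s + t * θ) (ι-+ a c) (ι-+ b e)) (regroup (ι a) (ι b) (ι c) (ι e) θ)
      where
      regroup = solve 5 (λ a b c e θ → a :+ c :+ (b :+ e) :* θ := a :+ b :* θ :+ (c :+ e :* θ)) refl

    ⟪⟫-* : ∀ u v → ⟪ u ⊛ v ⟫ ≡ ⟪ u ⟫ * ⟪ v ⟫
    ⟪⟫-* (a , b) (c , e) = trans (cong₂ (λ s t → s + t * θ)
        (trans (ι-+ (a ℤ.* c) (h ℤ.* (b ℤ.* e))) (cong₂ _+_ (ι-* a c) (trans (ι-* h (b ℤ.* e)) (cong (ι h *_) (ι-* b e)))))
        (trans (ι-+ (a ℤ.* e) (b ℤ.* c)) (cong₂ _+_ (ι-* a e) (ι-* b c))))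
      (expand (ι a) (ι b) (ι c) (ι e) θ (ι h) θ²)
      where
      expand : ∀ a b c e θ h → θ * θ ≡ h → a * c + h * (b * e) + (a * e + b * c) * θ ≡ (a + b * θ) * (c + e * θ)
      expand a b c e θ h p = linear₁ (- (b * e)) p (solve 6 (λ a c h b e θ → a :* c :+ h :* (b :* e) :+ (a :* e :+ b
          :* c) :* θ :- (a :+ b :* θ) :* (c :+ e :* θ) := :- (b :* e) :* (θ :* θ :- h)) refl a c h b e θ)

    ⟪ι⟫ : ∀ n → ⟪ n , ℤ.0ℤ ⟫ ≡ ι n
    ⟪ι⟫ n = simplify (ι n) θ
      where
      simplify = solve 2 (λ a θ → a :+ con 0 :* θ := a) refl

    ⟪⟫-neg : ∀ a b → ⟪ ℤ.- a , ℤ.- b ⟫ ≡ - ⟪ a , b ⟫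
    ⟪⟫-neg a b = trans (cong₂ (λ s t → s + t * θ) (ι-neg a) (ι-neg b)) (regroup (ι a) (ι b) θ)
      where
      regroup = solve 3 (λ a b θ → :- a :+ :- b :* θ := :- (a :+ b :* θ)) refl

    ⟪⟫-injective : ∀ u v → ⟪ u ⟫ ≡ ⟪ v ⟫ → u ≡ v
    ⟪⟫-injective (a , b) (c , e) p =
      let (q , r) = independent (a ℤ.+ ℤ.- c) (b ℤ.+ ℤ.- e) (trans (⟪⟫-+ (a , b) (ℤ.- c , ℤ.- e)) (trans (cong₂ _+_ p (⟪⟫-neg c e)) (-‿inverseʳ _)))
      in cong₂ _,_ (ℤP.i-j≡0⇒i≡j a c q) (ℤP.i-j≡0⇒i≡j b e r)

    ρ-* : ∀ u v → ρ (u ⊛ v) ≡ₚ ρ u ℤ.* ρ v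
    ρ-* (a , b) (c , e) = modulo (divides (ℤ.+ 17 ℤ.* (k ℤ.* (b ℤ.* e)))
      (trans (cong (λ h → a ℤ.* c ℤ.+ h ℤ.* (b ℤ.* e) ℤ.+ (a ℤ.* e ℤ.+ b ℤ.* c) ℤ.- (a ℤ.+ b) ℤ.* (c ℤ.+ e)) h≡) (expand a b c e k)))
      where
      expand : ∀ a b c e k → a ℤ.* c ℤ.+ (ℤ.1ℤ ℤ.+ ℤ.+ 289 ℤ.* k) ℤ.* (b ℤ.* e) ℤ.+ (a ℤ.* e ℤ.+ b ℤ.* c) ℤ.- (a ℤ.+ b) ℤ.* (c ℤ.+ e)
        ≡ ℤ.+ 17 ℤ.* (k ℤ.* (b ℤ.* e)) ℤ.* ℤ.+ 17
      expand = solve-∀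

    ρ-+ : ∀ u v → ρ (u ⊹ v) ≡ ρ u ℤ.+ ρ v
    ρ-+ (a , b) (c , e) = regroup a b c e
      where
      regroup : ∀ a b c e → a ℤ.+ c ℤ.+ (b ℤ.+ e) ≡ a ℤ.+ b ℤ.+ (c ℤ.+ e)
      regroup = solve-∀

    -- The localisation of ℤ[√h] at the kernel of ρ: x is a fraction u/w with ρ w invertible, and n
    -- ≡ ρ u / ρ w is written without division.
    Res : F → ℤ → Set
    Res x n = ∃ λ w → ∃ λ u → ⟪ w ⟫ * x ≡ ⟪ u ⟫ × ¬ ℤ.+ 17 ∣ ρ w × ρ u ≡ₚ n ℤ.* ρ w

    ∤-⊛ : ∀ u v → ¬ ℤ.+ 17 ∣ ρ u → ¬ ℤ.+ 17 ∣ ρ v → ¬ ℤ.+ 17 ∣ ρ (u ⊛ v)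
    ∤-⊛ u v ∤u ∤v d = ∤-* ∤u ∤v (∣-resp (ρ-* u v) d)

    17∤1 : ¬ ℤ.+ 17 ∣ ℤ.1ℤ
    17∤1 = toWitnessFalse {a? = ℤ.+ 17 ∣? ℤ.1ℤ} _

    res-ι : ∀ n → Res (ι n) n
    res-ι n = (ℤ.1ℤ , ℤ.0ℤ) , (n , ℤ.0ℤ) , trans (cong (_* ι n) (⟪ι⟫ ℤ.1ℤ)) (trans (*-identityˡ _) (sym (⟪ι⟫ n))) , 17∤1 ,
      ≡ₚ-reflexive (simplify n)
      where
      simplify : ∀ n → n ℤ.+ ℤ.0ℤ ≡ n ℤ.* (ℤ.1ℤ ℤ.+ ℤ.0ℤ)
      simplify = solve-∀

    res-neg : ∀ {x m} → Res x m → Res (- x) (ℤ.- m)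
    res-neg {x} {m} (w , (a , b) , e , ∤w , r) = w , (ℤ.- a , ℤ.- b) , trans (move ⟪ w ⟫ x) (trans (cong -_ e) (sym (⟪⟫-neg a b))) , ∤w ,
      ≡ₚ-trans (≡ₚ-reflexive (negate a b)) (≡ₚ-trans (neg-congₚ r) (≡ₚ-reflexive (ℤP.neg-distribˡ-* m (ρ w))))
      where
      move = solve 2 (λ w x → w :* :- x := :- (w :* x)) refl
      negate : ∀ a b → ℤ.- a ℤ.+ ℤ.- b ≡ ℤ.- (a ℤ.+ b)
      negate = solve-∀

    res-+ : ∀ {x y m n} → Res x m → Res y n → Res (x + y) (m ℤ.+ n)
    res-+ {x} {y} {m} {n} (w , u , e , ∤w , r) (w′ , u′ , e′ , ∤w′ , r′) = w ⊛ w′ , w′ ⊛ u ⊹ w ⊛ u′ ,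
      trans (cong (_* (x + y)) (⟪⟫-* w w′)) (trans (expand ⟪ w ⟫ ⟪ w′ ⟫ x y _ _ e e′)
        (sym (trans (⟪⟫-+ (w′ ⊛ u) (w ⊛ u′)) (cong₂ _+_ (⟪⟫-* w′ u) (⟪⟫-* w u′))))) , ∤-⊛ w w′ ∤w ∤w′ ,
      ≡ₚ-trans (≡ₚ-reflexive (ρ-+ (w′ ⊛ u) (w ⊛ u′)))
        (≡ₚ-trans (+-congₚ (≡ₚ-trans (ρ-* w′ u) (*-congₚ (≡ₚ-reflexive {ρ w′} refl) r)) (≡ₚ-trans (ρ-* w u′) (*-congₚ (≡ₚ-reflexive {ρ w} refl) r′)))
          (≡ₚ-trans (≡ₚ-reflexive (collect (ρ w) (ρ w′) m n)) (*-congₚ (≡ₚ-reflexive {m ℤ.+ n} refl) (≡ₚ-sym (ρ-* w w′)))))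
      where
      expand : ∀ w w′ x y u u′ → w * x ≡ u → w′ * y ≡ u′ → w * w′ * (x + y) ≡ w′ * u + w * u′
      expand w w′ x y _ _ refl refl = solve 4 (λ w w′ x y → w :* w′ :* (x :+ y) := w′ :* (w :* x) :+ w :* (w′ :* y))
          refl w w′ x y
      collect : ∀ w w′ m n → w′ ℤ.* (m ℤ.* w) ℤ.+ w ℤ.* (n ℤ.* w′) ≡ (m ℤ.+ n) ℤ.* (w ℤ.* w′)
      collect = solve-∀

    res-* : ∀ {x y m n} → Res x m → Res y n → Res (x * y) (m ℤ.* n)
    res-* {x} {y} {m} {n} (w , u , e , ∤w , r) (w′ , u′ , e′ , ∤w′ , r′) = w ⊛ w′ , u ⊛ u′ ,
      trans (cong (_* (x * y)) (⟪⟫-* w w′)) (trans (expand ⟪ w ⟫ ⟪ w′ ⟫ x y _ _ e e′) (sym (⟪⟫-* u u′))) , ∤-⊛ w w′ ∤w ∤w′ ,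
      ≡ₚ-trans (ρ-* u u′) (≡ₚ-trans (*-congₚ r r′)
        (≡ₚ-trans (≡ₚ-reflexive (collect (ρ w) (ρ w′) m n)) (*-congₚ (≡ₚ-reflexive {m ℤ.* n} refl) (≡ₚ-sym (ρ-* w w′)))))
      where
      expand : ∀ w w′ x y u u′ → w * x ≡ u → w′ * y ≡ u′ → w * w′ * (x * y) ≡ u * u′
      expand w w′ x y _ _ refl refl = solve 4 (λ w w′ x y → w :* w′ :* (x :* y) := w :* x :* (w′ :* y)) refl w w′ x y
      collect : ∀ w w′ m n → m ℤ.* w ℤ.* (n ℤ.* w′) ≡ m ℤ.* n ℤ.* (w ℤ.* w′)
      collect = solve-∀

    res-shift : ∀ {x m n} → Res x m → m ≡ₚ n → Res x n
    res-shift (w , u , e , ∤w , r) d = w , u , e , ∤w , ≡ₚ-trans r (*-congₚ d (≡ₚ-reflexive {ρ w} refl))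

    res-unique : ∀ {x m n} → Res x m → Res x n → m ≡ₚ n
    res-unique {x} {m} {n} (w , u , e , ∤w , r) (w′ , u′ , e′ , ∤w′ , r′) =
      modulo ([ (λ d → d) , (λ d → ⊥-elim (∤-* ∤w ∤w′ d)) ]′ (euclidₚ (m ℤ.- n) (ρ w ℤ.* ρ w′) (subst (ℤ.+ 17 ∣_) (factor (ρ w) (ρ w′) m n) (p∣difference congruence))))
      where
      cross : ∀ w w′ u u′ → w * x ≡ u → w′ * x ≡ u′ → w′ * u ≡ w * u′
      cross w w′ _ _ refl refl = solve 3 (λ w′ w x → w′ :* (w :* x) := w :* (w′ :* x)) refl w′ w x
      equal : w′ ⊛ u ≡ w ⊛ u′
      equal = ⟪⟫-injective (w′ ⊛ u) (w ⊛ u′) (trans (⟪⟫-* w′ u) (trans (cross _ _ _ _ e e′) (sym (⟪⟫-* w u′))))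
      congruence : ρ w′ ℤ.* (m ℤ.* ρ w) ≡ₚ ρ w ℤ.* (n ℤ.* ρ w′)
      congruence = ≡ₚ-trans (*-congₚ (≡ₚ-reflexive {ρ w′} refl) (≡ₚ-sym r)) (≡ₚ-trans (≡ₚ-sym (ρ-* w′ u))
        (≡ₚ-trans (≡ₚ-reflexive (cong ρ equal)) (≡ₚ-trans (ρ-* w u′) (*-congₚ (≡ₚ-reflexive {ρ w} refl) r′))))
      factor : ∀ w w′ m n → w′ ℤ.* (m ℤ.* w) ℤ.- w ℤ.* (n ℤ.* w′) ≡ (m ℤ.- n) ℤ.* (w ℤ.* w′)
      factor = solve-∀

    quotient-residue : ∀ {x} w u → ⟪ w ⟫ * x ≡ ⟪ u ⟫ → ¬ ℤ.+ 17 ∣ ρ w → ¬ ℤ.+ 17 ∣ ρ u → ∃ λ n → Res x n × ¬ ℤ.+ 17 ∣ n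
    quotient-residue w u e ∤w ∤u = let (i , p) = inverse₁₇ (ρ w) ∤w in
      ρ u ℤ.* i , (w , u , e , ∤w , ≡ₚ-sym (residue i p)) ,
      λ d → ∤u (∣-resp (residue i p) (∣m⇒∣m*n (ρ w) d))
      where
      residue : ∀ i → ρ w ℤ.* i ≡ₚ ℤ.1ℤ → ρ u ℤ.* i ℤ.* ρ w ≡ₚ ρ u
      residue i p = ≡ₚ-trans (≡ₚ-reflexive (rearrange (ρ u) (ρ w) i))
        (≡ₚ-trans (*-congₚ (≡ₚ-reflexive {ρ u} refl) p) (≡ₚ-reflexive (ℤP.*-identityʳ (ρ u))))
        where
        rearrange : ∀ u w i → u ℤ.* i ℤ.* w ≡ u ℤ.* (w ℤ.* i)
        rearrange = solve-∀

    res-inv : ∀ {x y m} → Res x m → ¬ ℤ.+ 17 ∣ m → x * y ≡ 1# → ∃ (Res y)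
    res-inv {x} {y} {m} (w , u , e , ∤w , r) ∤m x*y =
      let (n , s , _) = quotient-residue u w (flip ⟪ w ⟫ ⟪ u ⟫ e) (λ d → ∤-* ∤m ∤w (∣-resp r d)) ∤w in n , s
      where
      flip : ∀ w u → w * x ≡ u → u * y ≡ w
      flip w _ refl = linear₁ w x*y (solve 3 (λ w x y → w :* x :* y :- w := w :* (x :* y :- con 1)) refl w x y)

    ϖ : F
    ϖ = ι (ℤ.+ 17)

    ϖ^ : ℕ → F
    ϖ^ = power ϖ

    17^ : ℕ → ℤ
    17^ zero = ℤ.1ℤ
    17^ (suc j) = ℤ.+ 17 ℤ.* 17^ j

    17^∣-cancel : ∀ j n e → ¬ ℤ.+ 17 ∣ e → 17^ j ∣ n ℤ.* e → 17^ j ∣ n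
    17^∣-cancel zero n e ∤e d = divides n (sym (ℤP.*-identityʳ n))
    17^∣-cancel (suc j) n e ∤e (divides q eq) with euclidₚ n e (divides (q ℤ.* 17^ j) (trans eq (rearrange q (17^ j))))
      where
      rearrange : ∀ q r → q ℤ.* (ℤ.+ 17 ℤ.* r) ≡ q ℤ.* r ℤ.* ℤ.+ 17
      rearrange = solve-∀
    ... | inj₂ d = ⊥-elim (∤e d)
    ... | inj₁ (divides n′ refl) =
          let (divides r eq′) = 17^∣-cancel j n′ e ∤e (divides q (ℤP.*-cancelˡ-≡ (ℤ.+ 17) _ _ (trans (move n′ e) (trans eq (move′ q (17^ j))))))
          in divides r (trans (cong (ℤ._* ℤ.+ 17) eq′) (move″ r (17^ j)))
      where
      move : ∀ n e → ℤ.+ 17 ℤ.* (n ℤ.* e) ≡ n ℤ.* ℤ.+ 17 ℤ.* e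
      move = solve-∀
      move′ : ∀ q r → q ℤ.* (ℤ.+ 17 ℤ.* r) ≡ ℤ.+ 17 ℤ.* (q ℤ.* r)
      move′ = solve-∀
      move″ : ∀ q r → q ℤ.* r ℤ.* ℤ.+ 17 ≡ q ℤ.* (ℤ.+ 17 ℤ.* r)
      move″ = solve-∀

    ι-injective : ∀ {n} → ι n ≡ 0# → n ≡ ℤ.0ℤ
    ι-injective {n} e = proj₁ (independent n ℤ.0ℤ (trans (⟪ι⟫ n) e))

    norm≢0 : ∀ u → ⟪ u ⟫ ≢ 0# → norm u ≢ ℤ.0ℤ
    norm≢0 (a , b) u≢0 e = u≢0 (x≡0 (independent a (ℤ.- b) (trans (cong (λ t → ι a + t * θ) (ι-neg b))
        (zeroProduct u≢0 (trans (expand (ι a) (ι b) θ (ι h) θ²) (trans (sym ι-norm) (cong ι e)))))))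
      where
      expand : ∀ a b θ h → θ * θ ≡ h → (a + b * θ) * (a + - b * θ) ≡ a * a - h * (b * b)
      expand a b θ h p = linear₁ (- (b * b)) p (solve 4 (λ a b θ h → (a :+ b :* θ) :* (a :+ :- b :* θ) :- (a :* a :- h
          :* (b :* b)) := :- (b :* b) :* (θ :* θ :- h)) refl a b θ h)
      ι-norm : ι (a ℤ.* a ℤ.- h ℤ.* (b ℤ.* b)) ≡ ι a * ι a - ι h * (ι b * ι b)
      ι-norm = trans (ι-+ (a ℤ.* a) (ℤ.- (h ℤ.* (b ℤ.* b)))) (cong₂ _+_ (ι-* a a) (trans (ι-neg (h ℤ.* (b ℤ.* b))) (cong -_ (trans (ι-* h (b ℤ.* b)) (cong (ι h *_) (ι-* b b))))))
      x≡0 : a ≡ ℤ.0ℤ × ℤ.- b ≡ ℤ.0ℤ → ⟪ a , b ⟫ ≡ 0#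
      x≡0 (refl , p) = trans (cong (λ b → ⟪ ℤ.0ℤ , b ⟫) (trans (sym (ℤP.neg-involutive b)) (cong ℤ.-_ p))) (⟪ι⟫ ℤ.0ℤ)

    -- The element 18 + √h has norm 324 - h = 17 (19 - 17 k). The factor 17 occurs exactly once
    -- because h ≡ 1 holds modulo 289.
    τ : Order
    τ = ℤ.+ 18 , ℤ.1ℤ

    -- One factor lies in the prime of the place and τ in the conjugate prime, so their product is
    -- divisible by 17. Norms show that v has one factor 17 less in its norm than u.
    τ-divides : ∀ u → ℤ.+ 17 ∣ ρ u → ∃ λ v → ⟪ τ ⟫ * ⟪ u ⟫ ≡ ϖ * ⟪ v ⟫ × ℤ.+ 17 ℤ.* norm v ≡ norm u ℤ.* (ℤ.+ 19 ℤ.- ℤ.+ 17 ℤ.* k)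
    τ-divides (a , b) (divides q e) = (a ℤ.+ q ℤ.+ ℤ.+ 17 ℤ.* k ℤ.* b , q ℤ.+ b) ,
      trans (sym (⟪⟫-* τ (a , b))) (trans (cong ⟪_⟫ product) (trans (⟪⟫-* (ℤ.+ 17 , ℤ.0ℤ) v) (cong (_* ⟪ v ⟫) (⟪ι⟫ (ℤ.+ 17))))) ,
      norms
      where
      v : Order
      v = a ℤ.+ q ℤ.+ ℤ.+ 17 ℤ.* k ℤ.* b , q ℤ.+ b
      a≡ : a ≡ q ℤ.* ℤ.+ 17 ℤ.- b
      a≡ = trans (isolate a b) (cong (ℤ._- b) e)
        where
        isolate : ∀ a b → a ≡ a ℤ.+ b ℤ.- b
        isolate = solve-∀
      product : τ ⊛ (a , b) ≡ (ℤ.+ 17 , ℤ.0ℤ) ⊛ v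
      product = cong₂ _,_ (first a h a≡ h≡) (second a a≡)
        where
        firstSolved : ∀ q b k → ℤ.+ 18 ℤ.* (q ℤ.* ℤ.+ 17 ℤ.- b) ℤ.+ (ℤ.1ℤ ℤ.+ ℤ.+ 289 ℤ.* k) ℤ.* (ℤ.1ℤ ℤ.* b) ≡
          ℤ.+ 17 ℤ.* (q ℤ.* ℤ.+ 17 ℤ.- b ℤ.+ q ℤ.+ ℤ.+ 17 ℤ.* k ℤ.* b) ℤ.+ (ℤ.1ℤ ℤ.+ ℤ.+ 289 ℤ.* k) ℤ.* (ℤ.0ℤ ℤ.* (q ℤ.+ b))
        firstSolved = solve-∀
        first : ∀ a h → a ≡ q ℤ.* ℤ.+ 17 ℤ.- b → h ≡ ℤ.1ℤ ℤ.+ ℤ.+ 289 ℤ.* k → ℤ.+ 18 ℤ.* a ℤ.+ h ℤ.* (ℤ.1ℤ ℤ.* b) ≡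
          ℤ.+ 17 ℤ.* (a ℤ.+ q ℤ.+ ℤ.+ 17 ℤ.* k ℤ.* b) ℤ.+ h ℤ.* (ℤ.0ℤ ℤ.* (q ℤ.+ b))
        first _ _ refl refl = firstSolved q b k
        secondSolved : ∀ q b k → ℤ.+ 18 ℤ.* b ℤ.+ ℤ.1ℤ ℤ.* (q ℤ.* ℤ.+ 17 ℤ.- b) ≡
          ℤ.+ 17 ℤ.* (q ℤ.+ b) ℤ.+ ℤ.0ℤ ℤ.* (q ℤ.* ℤ.+ 17 ℤ.- b ℤ.+ q ℤ.+ ℤ.+ 17 ℤ.* k ℤ.* b)
        secondSolved = solve-∀
        second : ∀ a → a ≡ q ℤ.* ℤ.+ 17 ℤ.- b → ℤ.+ 18 ℤ.* b ℤ.+ ℤ.1ℤ ℤ.* a ≡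
          ℤ.+ 17 ℤ.* (q ℤ.+ b) ℤ.+ ℤ.0ℤ ℤ.* (a ℤ.+ q ℤ.+ ℤ.+ 17 ℤ.* k ℤ.* b)
        second _ refl = secondSolved q b k
      norms : ℤ.+ 17 ℤ.* norm v ≡ norm (a , b) ℤ.* (ℤ.+ 19 ℤ.- ℤ.+ 17 ℤ.* k)
      norms = byNorms a h a≡ h≡
        where
        solved : ∀ q b k → let a = q ℤ.* ℤ.+ 17 ℤ.- b ; h = ℤ.1ℤ ℤ.+ ℤ.+ 289 ℤ.* k ; c = a ℤ.+ q ℤ.+ ℤ.+ 17 ℤ.* k ℤ.* b ; e = q ℤ.+ b in
          ℤ.+ 17 ℤ.* (c ℤ.* c ℤ.- h ℤ.* (e ℤ.* e)) ≡ (a ℤ.* a ℤ.- h ℤ.* (b ℤ.* b)) ℤ.* (ℤ.+ 19 ℤ.- ℤ.+ 17 ℤ.* k)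
        solved = solve-∀
        byNorms : ∀ a h → a ≡ q ℤ.* ℤ.+ 17 ℤ.- b → h ≡ ℤ.1ℤ ℤ.+ ℤ.+ 289 ℤ.* k → let c = a ℤ.+ q ℤ.+ ℤ.+ 17 ℤ.* k ℤ.* b ; e = q ℤ.+ b in
          ℤ.+ 17 ℤ.* (c ℤ.* c ℤ.- h ℤ.* (e ℤ.* e)) ≡ (a ℤ.* a ℤ.- h ℤ.* (b ℤ.* b)) ℤ.* (ℤ.+ 19 ℤ.- ℤ.+ 17 ℤ.* k)
        byNorms _ _ refl refl = solved q b k

    17∤19-17k : ¬ ℤ.+ 17 ∣ ℤ.+ 19 ℤ.- ℤ.+ 17 ℤ.* k
    17∤19-17k d = toWitnessFalse {a? = ℤ.+ 17 ∣? ℤ.+ 2} _ (subst (ℤ.+ 17 ∣_) (simplify k) (∣m∣n⇒∣m+n d (∣m⇒∣m*n (k ℤ.- ℤ.1ℤ) (∣-reflexive {ℤ.+ 17} refl))))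
      where
      simplify : ∀ k → ℤ.+ 19 ℤ.- ℤ.+ 17 ℤ.* k ℤ.+ ℤ.+ 17 ℤ.* (k ℤ.- ℤ.1ℤ) ≡ ℤ.+ 2
      simplify = solve-∀

    -- The witness j is the valuation of u at the place, since t and v are units there.
    Factored : Order → Set
    Factored u = ∃ λ j → ∃ λ t → ∃ λ v → ¬ ℤ.+ 17 ∣ ρ t × ¬ ℤ.+ 17 ∣ ρ v × ⟪ t ⟫ * ⟪ u ⟫ ≡ ϖ^ j * ⟪ v ⟫

    -- Each division by `τ-divides` removes one factor 17 from the norm, so j bounds the number of
    -- divisions. The powers of τ are collected in t.
    factor-bounded : ∀ j u → ¬ 17^ j ∣ norm u → Factored u
    factor-bounded zero u ∤norm = ⊥-elim (∤norm (divides (norm u) (sym (ℤP.*-identityʳ (norm u)))))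
    factor-bounded (suc j) u ∤norm with ℤ.+ 17 ∣? ρ u
    ... | no ∤u = 0 , (ℤ.1ℤ , ℤ.0ℤ) , u , 17∤1 , ∤u , cong (_* ⟪ u ⟫) (⟪ι⟫ ℤ.1ℤ)
    ... | yes d = let (v , e , n) = τ-divides u d in extend v e (factor-bounded j v (λ (divides q eq) →
            ∤norm (17^∣-cancel (suc j) (norm u) (ℤ.+ 19 ℤ.- ℤ.+ 17 ℤ.* k) 17∤19-17k
              (divides q (trans (sym n) (trans (cong (ℤ.+ 17 ℤ.*_) eq) (move q (17^ j))))))))
      where
      move : ∀ q r → ℤ.+ 17 ℤ.* (q ℤ.* r) ≡ q ℤ.* (ℤ.+ 17 ℤ.* r)
      move = solve-∀
      extend : ∀ v → ⟪ τ ⟫ * ⟪ u ⟫ ≡ ϖ * ⟪ v ⟫ → Factored v → Factored u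
      extend v e (i , t , v′ , ∤t , ∤v′ , e′) = suc i , t ⊛ τ , v′ , ∤-⊛ t τ ∤t (toWitnessFalse {a? = ℤ.+ 17 ∣? ℤ.+ 19} _) , ∤v′ ,
        trans (cong (_* ⟪ u ⟫) (⟪⟫-* t τ)) (combine ⟪ t ⟫ ⟪ τ ⟫ ⟪ u ⟫ ϖ ⟪ v ⟫ (ϖ^ i) ⟪ v′ ⟫ e e′)
        where
        combine : ∀ t τ u ϖ v p v′ → τ * u ≡ ϖ * v → t * v ≡ p * v′ → t * τ * u ≡ ϖ * p * v′
        combine t τ u ϖ v p v′ e e′ = linear₂ t e ϖ e′ (solve 7 (λ t τ u ϖ p v′ v → t :* τ :* u :- ϖ :* p :* v′ := t
            :* (τ :* u :- ϖ :* v) :+ ϖ :* (t :* v :- p :* v′)) refl t τ u ϖ p v′ v)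

    abstract
      factor : ∀ u → ⟪ u ⟫ ≢ 0# → Factored u
      -- A crude bound for the exponent suffices: 17^n > n, with n the absolute value of the nonzero
      -- norm.
      factor u u≢0 = factor-bounded ℤ.∣ norm u ∣ u (λ d → ℕP.<⇒≱ (n<17^n ℤ.∣ norm u ∣)
          (ℕD.∣⇒≤ {{ℕ.≢-nonZero (λ e → norm≢0 u u≢0 (ℤP.∣i∣≡0⇒i≡0 e))}} (subst (ℕD._∣ ℤ.∣ norm u ∣) (abs-17^ ℤ.∣ norm u ∣) (∣⇒∣ᵤ d))))
        where
        abs-17^ : ∀ n → ℤ.∣ 17^ n ∣ ≡ 17 ℕ.^ n
        abs-17^ zero = refl
        abs-17^ (suc n) = trans (ℤP.abs-* (ℤ.+ 17) (17^ n)) (cong (17 ℕ.*_) (abs-17^ n))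
        n<17^n : ∀ n → n ℕ.< 17 ℕ.^ n
        n<17^n zero = ℕP.≤-refl
        n<17^n (suc n) = ℕP.<-≤-trans (ℕ.s≤s (n<17^n n)) (ℕP.≤-trans (ℕP.+-monoˡ-≤ (17 ℕ.^ n) (ℕP.≤-trans (ℕ.s≤s ℕ.z≤n) (n<17^n n)))
          (ℕP.+-monoʳ-≤ (17 ℕ.^ n) (ℕP.m≤m+n (17 ℕ.^ n) _)))

    ϖ≢0 : ϖ ≢ 0#
    ϖ≢0 e with ι-injective {ℤ.+ 17} e
    ... | ()

    -- As a quotient of a + b √h by m, x has valuation i - i′; the comparison of i with i′ decides
    -- on which side the power of ϖ is put.
    decompose-quotient : ∀ {x m a b} → ι m * x ≡ ⟪ a , b ⟫ → Factored (a , b) → Factored (m , ℤ.0ℤ) →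
      ∃ λ i → ∃ λ u → ∃ λ m → Res u m × ¬ ℤ.+ 17 ∣ m × (x ≡ ϖ^ i * u ⊎ ϖ^ i * x ≡ u)
    decompose-quotient {x} {m} {a} {b} e (i , t , v , ∤t , ∤v , f) (i′ , t′ , v′ , ∤t′ , ∤v′ , f′) = result (ℕP.≤-total i i′)
      where
      W V : Order
      W = t ⊛ v′
      V = t′ ⊛ v
      ∤W = ∤-⊛ t v′ ∤t ∤v′
      ∤V = ∤-⊛ t′ v ∤t′ ∤v
      balance : ∀ {T A P V T′ M P′ V′} → T * A ≡ P * V → T′ * M ≡ P′ * V′ → M * x ≡ A → P′ * (T * V′ * x) ≡ P * (T′ * V)
      balance {T} {A} {P} {V} {T′} {M} {P′} {V′} f f′ e = linear₃ T′ f (- (T * x)) f′ (T * T′) e (solve 9 (λ P′ T V′ x P T′ V A M → P′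
          :* (T :* V′ :* x) :- P :* (T′ :* V) := T′ :* (T :* A :- P :* V) :+ :- (T :* x) :* (T′ :* M :- P′ :* V′) :+ T
          :* T′ :* (M :* x :- A)) refl P′ T V′ x P T′ V A M)
      balanced : ϖ^ i′ * (⟪ W ⟫ * x) ≡ ϖ^ i * ⟪ V ⟫
      balanced = trans (cong (λ w → ϖ^ i′ * (w * x)) (⟪⟫-* t v′)) (trans
        (balance f (trans (cong (⟪ t′ ⟫ *_) (sym (⟪ι⟫ m))) f′) e) (cong (ϖ^ i *_) (sym (⟪⟫-* t′ v))))
      W≢0 : ⟪ W ⟫ ≢ 0#
      W≢0 p = ∤W (subst (ℤ.+ 17 ∣_) (sym (cong ρ (⟪⟫-injective W (ℤ.0ℤ , ℤ.0ℤ) (trans p (sym (⟪ι⟫ ℤ.0ℤ)))))) (divides ℤ.0ℤ refl))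
      result : i ℕ.≤ i′ ⊎ i′ ℕ.≤ i → ∃ λ i → ∃ λ u → ∃ λ m → Res u m × ¬ ℤ.+ 17 ∣ m × (x ≡ ϖ^ i * u ⊎ ϖ^ i * x ≡ u)
      result (inj₁ i≤i′) = let (n , r , ∤n) = quotient-residue W V eq ∤W ∤V in i′ ℕ.∸ i , ϖ^ (i′ ℕ.∸ i) * x , n , r , ∤n , inj₂ refl
        where
        eq : ⟪ W ⟫ * (ϖ^ (i′ ℕ.∸ i) * x) ≡ ⟪ V ⟫
        eq = cancelˡ (power-≢0 ϖ≢0 i) (trans (rearrange (ϖ^ i) ⟪ W ⟫ (ϖ^ (i′ ℕ.∸ i)) x)
          (trans (cong (_* (⟪ W ⟫ * x)) (trans (sym (power-+ ϖ i (i′ ℕ.∸ i))) (cong ϖ^ (ℕP.m+[n∸m]≡n i≤i′)))) balanced))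
          where
          rearrange = solve 4 (λ p w q x → p :* (w :* (q :* x)) := p :* q :* (w :* x)) refl
      result (inj₂ i′≤i) = let (n , r , ∤n) = quotient-residue W V (trans (*-comm ⟪ W ⟫ _) quotient) ∤W ∤V in
          i ℕ.∸ i′ , ⟪ V ⟫ * inv ⟪ W ⟫ , n , r , ∤n , inj₁ (cancelˡ W≢0 (cancelˡ (power-≢0 ϖ≢0 i′) eq))
        where
        quotient : ⟪ V ⟫ * inv ⟪ W ⟫ * ⟪ W ⟫ ≡ ⟪ V ⟫
        quotient = trans (*-comm _ ⟪ W ⟫) (inv-* W≢0 ⟪ V ⟫)
        eq : ϖ^ i′ * (⟪ W ⟫ * x) ≡ ϖ^ i′ * (⟪ W ⟫ * (ϖ^ (i ℕ.∸ i′) * (⟪ V ⟫ * inv ⟪ W ⟫)))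
        eq = trans balanced (trans (cong₂ _*_ (trans (cong ϖ^ (sym (ℕP.m+[n∸m]≡n i′≤i))) (power-+ ϖ i′ (i ℕ.∸ i′))) (sym quotient))
          (rearrange (ϖ^ i′) (ϖ^ (i ℕ.∸ i′)) (⟪ V ⟫ * inv ⟪ W ⟫) ⟪ W ⟫))
          where
          rearrange = solve 4 (λ p q y w → p :* q :* (y :* w) := p :* (w :* (q :* y))) refl

    decompose : ∀ {x} → x ≢ 0# → ∃ λ i → ∃ λ u → ∃ λ m → Res u m × ¬ ℤ.+ 17 ∣ m × (x ≡ ϖ^ i * u ⊎ ϖ^ i * x ≡ u)
    decompose {x} x≢0 =
      let (m , a , b , m≢0 , e) = spanned x
          ιm≢0 = λ p → m≢0 (ι-injective p)
      in decompose-quotient {x} {m} {a} {b} e (factor (a , b) (λ p → *-≢0 ιm≢0 x≢0 (trans e p)))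
           (factor (m , ℤ.0ℤ) (λ p → ιm≢0 (trans (sym (⟪ι⟫ m)) p)))

    splitPlace : Place 𝔽 17
    splitPlace = record
      { prime = 17-prime ; ϖ≢0 = ϖ≢0 ; Res = Res ; res-ι = res-ι ; res-+ = λ {x} {y} {m} {n} → res-+ {x} {y} {m} {n} ; res-* = λ {x} {y} {m} {n} → res-* {x} {y} {m} {n} ; res-neg = λ {x} {m} → res-neg {x} {m}
      ; res-unique = λ {x} {m} {n} r s → p∣difference (res-unique {x} {m} {n} r s) ; res-shift = λ {x} {m} {n} r d → res-shift {x} {m} {n} r (modulo d) ; res-inv = λ {x} {y} {m} → res-inv {x} {y} {m}
      ; decompose = decompose }

-- Tripling formulas on the quartic

module TriplingIdentity where
  open FieldSolver
  open Polynomials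
  open import Data.Integer as ℤ using (ℤ)
  import Data.Integer.Properties as ℤP
  open import Data.Nat using (ℕ)
  open import Relation.Binary.PropositionalEquality

  -- The operations are parameters so that the same formulas can be read over ℤ and as expressions
  -- for the solver.
  module TriplingPolynomials {R : Set} (_+_ _*_ : R → R → R) (-_ : R → R) (# : ℕ → R) (X W : R) where
    private
      infixl 6 _⊕_ _⊖_
      infixl 7 _⊛_
      _⊕_ _⊖_ _⊛_ : R → R → R
      _⊕_ = _+_
      _⊛_ = _*_
      x ⊖ y = x + (- y)
      X² = X ⊛ X
      W² = W ⊛ W
      X⁴ = X² ⊛ X²

    -- With t = X/W = σ², the map t ↦ t D²/N² is tripling on y² = x³ + x² - x at x = -t, onto which
    -- (σ , s) ↦ (-σ² , σ s) maps the curve s² = 1 + σ² - σ⁴. N is minus the 3-division polynomial,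
    -- homogenised; D arises from it, up to sign, by t ↦ -1/t, the translation by (0 , 0). H is the
    -- factor acquired by s.
    D N H : R
    D = W ⊛ W² ⊛ (# 3 ⊛ W ⊕ # 4 ⊛ X) ⊖ X² ⊛ (# 6 ⊛ W² ⊕ X²)
    N = W² ⊛ W² ⊕ X² ⊛ (# 6 ⊛ W² ⊕ # 4 ⊛ X ⊛ W ⊖ # 3 ⊛ X²)
    H = (((((((W ⊕ # 4 ⊛ X) ⊛ W ⊖ # 28 ⊛ X²) ⊛ W ⊖ # 28 ⊛ X ⊛ X²) ⊛ W ⊖ # 10 ⊛ X⁴) ⊛ W ⊕ # 28 ⊛ X⁴ ⊛ X) ⊛ W
      ⊖ # 28 ⊛ X⁴ ⊛ X²) ⊛ W ⊖ # 4 ⊛ X⁴ ⊛ X² ⊛ X) ⊛ W ⊕ X⁴ ⊛ X⁴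

  module Symbolic = TriplingPolynomials _:+_ _:*_ :-_ con
  module Tripling = TriplingPolynomials ℤ._+_ ℤ._*_ ℤ.-_ ℤ.+_

  open Tripling
  open Solver ℤP.+-*-isCommutativeRing

  abstract
    tripling-squares : ∀ X W → let X′ = X ℤ.* (D X W ℤ.* D X W) ; W′ = W ℤ.* (N X W ℤ.* N X W) in
      W′ ℤ.* W′ ℤ.+ X′ ℤ.* W′ ℤ.- X′ ℤ.* X′ ≡ (W ℤ.* W ℤ.+ X ℤ.* W ℤ.- X ℤ.* X) ℤ.* (H X W ℤ.* H X W)
    tripling-squares = solve 2 (λ x w → let x′ = x :* (Symbolic.D x w :* Symbolic.D x w) ; w′ = w :* (Symbolic.N x w :* Symbolic.N x w) in
      w′ :* w′ :+ x′ :* w′ :- x′ :* x′ := (w :* w :+ x :* w :- x :* x) :* (Symbolic.H x w :* Symbolic.H x w)) refl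

-- Iterated multiplication by -3, controlled at 3 and at 17

module TriplingMap where
  open FieldSolver
  open Polynomials
  open SplitPrime
  open TriplingIdentity using (module Symbolic; module Tripling; tripling-squares)
  open import Data.Integer as ℤ using (ℤ)
  import Data.Integer.Properties as ℤP
  open import Data.Integer.Divisibility.Signed using (_∣_; ∣m⇒∣-m; ∣m⇒∣m*n; ∣m∣n⇒∣m-n; ∣-reflexive; _∣?_)
  open import Data.Integer.Tactic.RingSolver using (solve-∀)
  open import Data.Nat using (ℕ; zero; suc)
  open import Data.Nat.Primality using (Prime; prime?)
  open import Relation.Binary.PropositionalEquality
  open import Relation.Nullary using (¬_)
  open import Relation.Nullary.Decidable using (toWitness; toWitnessFalse)

  3-prime : Prime 3
  3-prime = toWitness {a? = prime? 3} _

  module Mod3 = Modulo 3 3-prime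
  open Modulo17

  module TriplingStep where
    open Tripling
    open Solver ℤP.+-*-isCommutativeRing

    D-cong : ∀ {X X′ W W′} → X ≡ₚ X′ → W ≡ₚ W′ → D X W ≡ₚ D X′ W′
    D-cong x w = +-congₚ (*-congₚ (*-congₚ w w²) (+-congₚ (*-congₚ (≡ₚ-reflexive {ℤ.+ 3} refl) w) (*-congₚ (≡ₚ-reflexive {ℤ.+ 4} refl) x)))
      (neg-congₚ (*-congₚ x² (+-congₚ (*-congₚ (≡ₚ-reflexive {ℤ.+ 6} refl) w²) x²)))
      where
      w² = *-congₚ w w
      x² = *-congₚ x x

    N-cong : ∀ {X X′ W W′} → X ≡ₚ X′ → W ≡ₚ W′ → N X W ≡ₚ N X′ W′
    N-cong x w = +-congₚ (*-congₚ w² w²) (*-congₚ x² (+-congₚ (+-congₚ (*-congₚ (≡ₚ-reflexive {ℤ.+ 6} refl) w²)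
      (*-congₚ (*-congₚ (≡ₚ-reflexive {ℤ.+ 4} refl) x) w)) (neg-congₚ (*-congₚ (≡ₚ-reflexive {ℤ.+ 3} refl) x²))))
      where
      w² = *-congₚ w w
      x² = *-congₚ x x

    -- Because D and N are forms of the same degree, the new quotient U′/V′ modulo 17 depends on r
    -- alone, and a single numerical check settles a step.
    D-homogeneous : ∀ x W → D (x ℤ.* W) W ≡ D x ℤ.1ℤ ℤ.* (W ℤ.* W ℤ.* (W ℤ.* W))
    D-homogeneous = solve 2 (λ x w → Symbolic.D (x :* w) w := Symbolic.D x (con 1) :* (w :* w :* (w :* w))) refl

    N-homogeneous : ∀ x W → N (x ℤ.* W) W ≡ N x ℤ.1ℤ ℤ.* (W ℤ.* W ℤ.* (W ℤ.* W))
    N-homogeneous = solve 2 (λ x w → Symbolic.N (x :* w) w := Symbolic.N x (con 1) :* (w :* w :* (w :* w))) refl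

    -- (U : V) = 3^{j+1} u : V represents a point (σ , M/V²) of h y² = 1 + σ² - σ⁴ with σ = U/V;
    -- σ is close to 0 at the prime 3 and its residue mod 17 is r.
    record State (h r : ℤ) (j : ℕ) : Set where
      constructor mkState
      field
        U V M u : ℤ
        curve : V ℤ.* V ℤ.* (V ℤ.* V) ℤ.+ U ℤ.* U ℤ.* (V ℤ.* V) ℤ.- U ℤ.* U ℤ.* (U ℤ.* U) ≡ h ℤ.* (M ℤ.* M)
        order : U ≡ (ℤ.+ 3) ℤ.^ suc j ℤ.* u
        3∤u : ¬ ℤ.+ 3 ∣ u
        3∤V : ¬ ℤ.+ 3 ∣ V
        residue : U ≡ₚ r ℤ.* V
        17∤V : ¬ ℤ.+ 17 ∣ V

    -- Multiplication by -3 on the curve; σ ≡ 8 mod 17 is fixed by it.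
    step : ∀ {h r j} → ℤ.+ 17 ∣ ℤ.- (r ℤ.* D (r ℤ.* r) ℤ.1ℤ) ℤ.- ℤ.+ 8 ℤ.* N (r ℤ.* r) ℤ.1ℤ → ¬ ℤ.+ 17 ∣ N (r ℤ.* r) ℤ.1ℤ →
      State h r j → State h (ℤ.+ 8) (suc j)
    step {h} {r} {j} fixed ∤N (mkState U V M u curve order 3∤u 3∤V residue 17∤V) = record
      { U = U′ ; V = V′ ; M = M ℤ.* H X W ; u = ℤ.- (u ℤ.* D₃)
      ; curve = begin
          V′ ℤ.* V′ ℤ.* (V′ ℤ.* V′) ℤ.+ U′ ℤ.* U′ ℤ.* (V′ ℤ.* V′) ℤ.- U′ ℤ.* U′ ℤ.* (U′ ℤ.* U′)
            ≡⟨ cong₂ (λ x w → w ℤ.* w ℤ.+ x ℤ.* w ℤ.- x ℤ.* x) (squareU U (D X W)) (squareV V (N X W)) ⟩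
          W₁ ℤ.* W₁ ℤ.+ X₁ ℤ.* W₁ ℤ.- X₁ ℤ.* X₁
            ≡⟨ tripling-squares X W ⟩
          (W ℤ.* W ℤ.+ X ℤ.* W ℤ.- X ℤ.* X) ℤ.* (H X W ℤ.* H X W)
            ≡⟨ cong (ℤ._* (H X W ℤ.* H X W)) curve ⟩
          h ℤ.* (M ℤ.* M) ℤ.* (H X W ℤ.* H X W)
            ≡⟨ collect h M (H X W) ⟩
          h ℤ.* (M ℤ.* H X W ℤ.* (M ℤ.* H X W)) ∎
      ; order = trans (cong (λ d → ℤ.- (U ℤ.* d)) D≡3D₃) (trans (cong (λ U → ℤ.- (U ℤ.* (ℤ.+ 3 ℤ.* D₃))) order) (shift ((ℤ.+ 3) ℤ.^ suc j) u D₃))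
      ; 3∤u = λ d → Mod3.∤-* 3∤u 3∤D₃ (subst (ℤ.+ 3 ∣_) (ℤP.neg-involutive (u ℤ.* D₃)) (∣m⇒∣-m d))
      ; 3∤V = Mod3.∤-* 3∤V 3∤N
      ; residue = ≡ₚ-trans U′≡ (≡ₚ-trans (modulo (subst (ℤ.+ 17 ∣_) (regroup (D (r ℤ.* r) ℤ.1ℤ) (N (r ℤ.* r) ℤ.1ℤ) r V (W ℤ.* W ℤ.* (W ℤ.* W)))
            (∣m⇒∣m*n (V ℤ.* (W ℤ.* W ℤ.* (W ℤ.* W))) fixed))) (≡ₚ-sym (*-congₚ (≡ₚ-reflexive {ℤ.+ 8} refl) V′≡)))
      ; 17∤V = λ d → ∤-* 17∤V (∤-* ∤N (∤-* (∤-* 17∤W 17∤W) (∤-* 17∤W 17∤W))) (∣-resp V′≡ d) }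
      where
      open ≡-Reasoning
      X = U ℤ.* U
      W = V ℤ.* V
      U′ = ℤ.- (U ℤ.* D X W)
      V′ = V ℤ.* N X W
      X₁ = X ℤ.* (D X W ℤ.* D X W)
      W₁ = W ℤ.* (N X W ℤ.* N X W)
      squareU : ∀ U d → ℤ.- (U ℤ.* d) ℤ.* ℤ.- (U ℤ.* d) ≡ U ℤ.* U ℤ.* (d ℤ.* d)
      squareU = solve-∀
      squareV : ∀ V d → V ℤ.* d ℤ.* (V ℤ.* d) ≡ V ℤ.* V ℤ.* (d ℤ.* d)
      squareV = solve-∀
      collect : ∀ h M H → h ℤ.* (M ℤ.* M) ℤ.* (H ℤ.* H) ≡ h ℤ.* (M ℤ.* H ℤ.* (M ℤ.* H))
      collect = solve-∀
      t = (ℤ.+ 3) ℤ.^ j ℤ.* u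
      U≡3t : U ≡ ℤ.+ 3 ℤ.* t
      U≡3t = trans order (ℤP.*-assoc (ℤ.+ 3) ((ℤ.+ 3) ℤ.^ j) u)
      -- Since 3 divides U, D = 3 D₃ with D₃ ≡ W⁴ and N ≡ W⁴ modulo 3. So σ gains exactly one factor
      -- 3.
      S R D₃ : ℤ
      S = t ℤ.* t
      R = ℤ.+ 4 ℤ.* (W ℤ.* (W ℤ.* W)) ℤ.* S ℤ.- ℤ.+ 9 ℤ.* (S ℤ.* S) ℤ.* (ℤ.+ 6 ℤ.* (W ℤ.* W) ℤ.+ ℤ.+ 81 ℤ.* (S ℤ.* S))
      D₃ = W ℤ.* W ℤ.* (W ℤ.* W) ℤ.+ ℤ.+ 3 ℤ.* R
      D≡3D₃ : D X W ≡ ℤ.+ 3 ℤ.* D₃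
      D≡3D₃ = trans (cong (λ U → D (U ℤ.* U) W) U≡3t) (expand t W)
        where
        expand : ∀ t W → W ℤ.* (W ℤ.* W) ℤ.* (ℤ.+ 3 ℤ.* W ℤ.+ ℤ.+ 4 ℤ.* (ℤ.+ 3 ℤ.* t ℤ.* (ℤ.+ 3 ℤ.* t)))
          ℤ.+ ℤ.- (ℤ.+ 3 ℤ.* t ℤ.* (ℤ.+ 3 ℤ.* t) ℤ.* (ℤ.+ 3 ℤ.* t ℤ.* (ℤ.+ 3 ℤ.* t)) ℤ.* (ℤ.+ 6 ℤ.* (W ℤ.* W) ℤ.+ ℤ.+ 3 ℤ.* t ℤ.* (ℤ.+ 3 ℤ.* t) ℤ.* (ℤ.+ 3 ℤ.* t ℤ.* (ℤ.+ 3 ℤ.* t))))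
          ≡ ℤ.+ 3 ℤ.* (W ℤ.* W ℤ.* (W ℤ.* W) ℤ.+ ℤ.+ 3 ℤ.* (ℤ.+ 4 ℤ.* (W ℤ.* (W ℤ.* W)) ℤ.* (t ℤ.* t) ℤ.- ℤ.+ 9 ℤ.* (t ℤ.* t ℤ.* (t ℤ.* t)) ℤ.* (ℤ.+ 6 ℤ.* (W ℤ.* W) ℤ.+ ℤ.+ 81 ℤ.* (t ℤ.* t ℤ.* (t ℤ.* t)))))
        expand = solve-∀
      shift : ∀ p u d → ℤ.- (p ℤ.* u ℤ.* (ℤ.+ 3 ℤ.* d)) ≡ ℤ.+ 3 ℤ.* p ℤ.* ℤ.- (u ℤ.* d)
      shift = solve-∀
      3∤W : ¬ ℤ.+ 3 ∣ W
      3∤W = Mod3.∤-* 3∤V 3∤V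
      3∤W⁴ : ¬ ℤ.+ 3 ∣ W ℤ.* W ℤ.* (W ℤ.* W)
      3∤W⁴ = Mod3.∤-* (Mod3.∤-* 3∤W 3∤W) (Mod3.∤-* 3∤W 3∤W)
      remove-multiple : ∀ {a} b c → c ≡ a ℤ.+ ℤ.+ 3 ℤ.* b → ¬ ℤ.+ 3 ∣ a → ¬ ℤ.+ 3 ∣ c
      remove-multiple {a} b _ refl ∤a d = ∤a (subst (ℤ.+ 3 ∣_) (cancel a b) (∣m∣n⇒∣m-n d (∣m⇒∣m*n b (∣-reflexive {ℤ.+ 3} refl))))
        where
        cancel : ∀ a b → a ℤ.+ ℤ.+ 3 ℤ.* b ℤ.- ℤ.+ 3 ℤ.* b ≡ a
        cancel = solve-∀
      3∤D₃ : ¬ ℤ.+ 3 ∣ D₃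
      3∤D₃ = remove-multiple R D₃ refl 3∤W⁴
      3∤N : ¬ ℤ.+ 3 ∣ N X W
      3∤N = remove-multiple (ℤ.+ 3 ℤ.* (t ℤ.* t) ℤ.* X ℤ.* (ℤ.+ 6 ℤ.* (W ℤ.* W) ℤ.+ ℤ.+ 4 ℤ.* X ℤ.* W ℤ.+ ℤ.- (ℤ.+ 3 ℤ.* (X ℤ.* X)))) (N X W)
        (trans (cong (λ x → W ℤ.* W ℤ.* (W ℤ.* W) ℤ.+ x ℤ.* X ℤ.* (ℤ.+ 6 ℤ.* (W ℤ.* W) ℤ.+ ℤ.+ 4 ℤ.* X ℤ.* W ℤ.+ ℤ.- (ℤ.+ 3 ℤ.* (X ℤ.* X)))) (cong (λ U → U ℤ.* U) U≡3t))
          (cong (λ z → W ℤ.* W ℤ.* (W ℤ.* W) ℤ.+ z) (extract t X (ℤ.+ 6 ℤ.* (W ℤ.* W) ℤ.+ ℤ.+ 4 ℤ.* X ℤ.* W ℤ.+ ℤ.- (ℤ.+ 3 ℤ.* (X ℤ.* X)))))) 3∤W⁴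
        where
        extract : ∀ t X Z → ℤ.+ 3 ℤ.* t ℤ.* (ℤ.+ 3 ℤ.* t) ℤ.* X ℤ.* Z ≡ ℤ.+ 3 ℤ.* (ℤ.+ 3 ℤ.* (t ℤ.* t) ℤ.* X ℤ.* Z)
        extract = solve-∀
      17∤W : ¬ ℤ.+ 17 ∣ W
      17∤W = ∤-* 17∤V 17∤V
      X≡ : X ≡ₚ r ℤ.* r ℤ.* W
      X≡ = ≡ₚ-trans (*-congₚ residue residue) (≡ₚ-reflexive (rearrange r V))
        where
        rearrange : ∀ r V → r ℤ.* V ℤ.* (r ℤ.* V) ≡ r ℤ.* r ℤ.* (V ℤ.* V)
        rearrange = solve-∀
      U′≡ : U′ ≡ₚ ℤ.- (r ℤ.* V ℤ.* (D (r ℤ.* r) ℤ.1ℤ ℤ.* (W ℤ.* W ℤ.* (W ℤ.* W))))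
      U′≡ = neg-congₚ (*-congₚ residue (≡ₚ-trans (D-cong X≡ (≡ₚ-reflexive {W} refl)) (≡ₚ-reflexive (D-homogeneous (r ℤ.* r) W))))
      V′≡ : V′ ≡ₚ V ℤ.* (N (r ℤ.* r) ℤ.1ℤ ℤ.* (W ℤ.* W ℤ.* (W ℤ.* W)))
      V′≡ = *-congₚ (≡ₚ-reflexive {V} refl) (≡ₚ-trans (N-cong X≡ (≡ₚ-reflexive {W} refl)) (≡ₚ-reflexive (N-homogeneous (r ℤ.* r) W)))
      regroup : ∀ d n r V Z → (ℤ.- (r ℤ.* d) ℤ.- ℤ.+ 8 ℤ.* n) ℤ.* (V ℤ.* Z) ≡ ℤ.- (r ℤ.* V ℤ.* (d ℤ.* Z)) ℤ.- ℤ.+ 8 ℤ.* (V ℤ.* (n ℤ.* Z))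
      regroup = solve-∀

    -- The residue 6 is that of 3/v for v ≡ 26. Multiplication by 3 in place of -3 would make the
    -- later residues alternate between 8 and -8, and so give two residues of A.
    first-step : ∀ {h} → State h (ℤ.+ 6) 0 → State h (ℤ.+ 8) 1
    first-step = step (toWitness {a? = ℤ.+ 17 ∣? ℤ.- (ℤ.+ 6 ℤ.* D (ℤ.+ 36) ℤ.1ℤ) ℤ.- ℤ.+ 8 ℤ.* N (ℤ.+ 36) ℤ.1ℤ} _) (toWitnessFalse {a? = ℤ.+ 17 ∣? N (ℤ.+ 36) ℤ.1ℤ} _)

    iterate : ∀ {h} → State h (ℤ.+ 6) 0 → ∀ j → State h (ℤ.+ 8) (suc j)
    iterate s zero = first-step s
    iterate s (suc j) = step (toWitness {a? = ℤ.+ 17 ∣? ℤ.- (ℤ.+ 8 ℤ.* D (ℤ.+ 64) ℤ.1ℤ) ℤ.- ℤ.+ 8 ℤ.* N (ℤ.+ 64) ℤ.1ℤ} _) (toWitnessFalse {a? = ℤ.+ 17 ∣? N (ℤ.+ 64) ℤ.1ℤ} _) (iterate s j)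

-- From points of the quartic to Diophantine triples

module TripleFamilies where
  open FieldSolver
  open EllipticCurves
  open Places
  open TripleCurves
  open SplitPrime
  open TriplingMap
  open import Defs using (Z2×Z10; _⊞_)
  open import Data.Empty using (⊥-elim)
  open import Data.Integer as ℤ using (ℤ)
  import Data.Integer.Properties as ℤP
  open import Data.Integer.Divisibility.Signed using (_∣_; divides; ∣n⇒∣m*n; ∣m⇒∣-m; ∣m⇒∣m*n; ∣m∣n⇒∣m-n; ∣-reflexive; _∣?_)
  open import Data.Integer.Tactic.RingSolver using (solve-∀)
  open import Data.Nat as ℕ using (ℕ; zero; suc)
  import Data.Nat.Properties as ℕP
  import Data.Nat.Tactic.RingSolver as ℕSolver
  open import Data.Product using (∃; _×_; _,_; proj₁; proj₂)
  open import Data.Sum using ([_,_]′)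
  open import Relation.Binary.PropositionalEquality
  open import Relation.Nullary using (¬_)
  open import Relation.Nullary.Decidable using (toWitnessFalse)

  -- With σ = x/y and ρ = 2√(1 + σ² - σ⁴)/(1 - σ⁴), the triple is a = 2σ³/(1 - σ⁴) and
  -- b, c = (a + σ + σ⁻¹ ± ρ)/2; all fractions are over e = 2xy(y⁴ - x⁴).
  module Formulas (𝔽 : DecField) (x y μ i η : DecField.F 𝔽) where
    open DecField 𝔽
    open FieldLemmas 𝔽
    open Conditions 𝔽

    P₋ P₊ e a n ρ b c A B C : F
    P₋ = y * y - x * x
    P₊ = y * y + x * x
    e = two * x * y * (P₋ * P₊)
    a = four * (x * x * (x * x)) * (y * y) * i
    n = two * (P₊ * P₊ * P₋) * i
    ρ = four * μ * x * (y * y * y) * i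
    b = (a + n + ρ) * η
    c = (a + n - ρ) * η
    A = a * b * c
    B = a * b + a * c + b * c
    C = a + b + c

    module Identities (curve : y * y * (y * y) + x * x * (y * y) - x * x * (x * x) ≡ μ * μ) (ei : e * i ≡ 1#) (2η : two * η ≡ 1#)
      (2≢0 : two ≢ 0#) (r≢0 : x * P₋ ≢ 0#) (s≢0 : y * P₊ ≢ 0#) where

      -- With b + c = a + n and b - c = ρ this is regularity. For the given a and n = σ + σ⁻¹ the
      -- right-hand side is 4(1 + σ² - σ⁴)/(1 - σ⁴)², which is where the equation of the quartic
      -- enters.
      ρ² : ρ * ρ ≡ a * a + two * a * n + four
      ρ² = linear₂ (- (four * four * (i * i) * (x * x) * (y * y * y * (y * y * y)))) curve (four * (e * i + 1#)) ei (solve 4 (λ μ x y i → con 4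
          :* μ :* x :* (y :* y :* y) :* i :* (con 4 :* μ :* x :* (y :* y :* y) :* i) :- (con 4 :* (x :* x :* (x
          :* x)) :* (y :* y) :* i :* (con 4 :* (x :* x :* (x :* x)) :* (y :* y) :* i) :+ con 2 :* (con 4 :* (x
          :* x :* (x :* x)) :* (y :* y) :* i) :* (con 2 :* ((y :* y :+ x :* x) :* (y :* y :+ x :* x) :* (y :* y :- x
          :* x)) :* i) :+ con 4) := :- (con 4 :* con 4 :* (i :* i) :* (x :* x) :* (y :* y :* y :* (y :* y :* y)))
          :* (y :* y :* (y :* y) :+ x :* x :* (y :* y) :- x :* x :* (x :* x) :- μ :* μ) :+ con 4 :* (con 2 :* x :* y
          :* ((y :* y :- x :* x) :* (y :* y :+ x :* x)) :* i :+ con 1) :* (con 2 :* x :* y :* ((y :* y :- x :* x)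
          :* (y :* y :+ x :* x)) :* i :- con 1)) refl μ x y i)

      b+c : b + c ≡ a + n
      b+c = linear₁ (a + n) 2η (identity a n ρ η)
        where
        identity = solve 4 (λ a n ρ η → (a :+ n :+ ρ) :* η :+ (a :+ n :- ρ) :* η :- (a :+ n) := (a :+ n) :* (con 2
            :* η :- con 1)) refl

      4bc : four * (b * c) ≡ (a + n) * (a + n) - ρ * ρ
      4bc = linear₁ (((a + n) * (a + n) - ρ * ρ) * (two * η + 1#)) 2η (identity a n ρ η)
        where
        identity = solve 4 (λ a n ρ η → con 4 :* ((a :+ n :+ ρ) :* η :* ((a :+ n :- ρ) :* η)) :- ((a :+ n) :* (a :+ n)
            :- ρ :* ρ) := ((a :+ n) :* (a :+ n) :- ρ :* ρ) :* (con 2 :* η :+ con 1) :* (con 2 :* η :- con 1))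
            refl

      regular : C * C ≡ four * B + four
      regular = general a b c n ρ b+c 4bc ρ²
        where
        general : ∀ a b c n ρ → b + c ≡ a + n → four * (b * c) ≡ (a + n) * (a + n) - ρ * ρ → ρ * ρ ≡ a * a + two * a * n + four →
          (a + b + c) * (a + b + c) ≡ four * (a * b + a * c + b * c) + four
        general a b c n ρ s p r = linear₃ (b + c - a + n) s (- 1#) p 1# r (solve 5 (λ a b c n ρ → (a :+ b :+ c) :* (a
            :+ b :+ c) :- (con 4 :* (a :* b :+ a :* c :+ b :* c) :+ con 4) := (b :+ c :- a :+ n) :* (b :+ c :- (a
            :+ n)) :+ :- con 1 :* (con 4 :* (b :* c) :- ((a :+ n) :* (a :+ n) :- ρ :* ρ)) :+ con 1 :* (ρ :* ρ
            :- (a :* a :+ con 2 :* a :* n :+ con 4))) refl a b c n ρ)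

      4A : four * A ≡ a * (n * n - four)
      4A = general a b c n ρ 4bc ρ²
        where
        general : ∀ a b c n ρ → four * (b * c) ≡ (a + n) * (a + n) - ρ * ρ → ρ * ρ ≡ a * a + two * a * n + four →
          four * (a * b * c) ≡ a * (n * n - four)
        general a b c n ρ p r = linear₂ a p (- a) r (solve 5 (λ a b c n ρ → con 4 :* (a :* b :* c) :- a :* (n :* n
            :- con 4) := a :* (con 4 :* (b :* c) :- ((a :+ n) :* (a :+ n) :- ρ :* ρ)) :+ :- a :* (ρ :* ρ :- (a :* a
            :+ con 2 :* a :* n :+ con 4))) refl a b c n ρ)

      -- As n² - 4 = (σ - σ⁻¹)², one gets 2A = σ(1 - σ²)/(1 + σ²). Then 2A + C turns out to be the
      -- inverse of this fraction, which is the condition of order five.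
      2A : two * A * (y * P₊) ≡ x * P₋
      2A = cancelˡ 2≢0 (general A 4A)
        where
        general : ∀ A → four * A ≡ a * (n * n - four) → two * (two * A * (y * P₊)) ≡ two * (x * P₋)
        general A p = linear₂ (y * P₊) p
          (four * (x * x * (x * x)) * (y * y) * i * four * (e * i + 1#) * (y * P₊) + two * (x * P₋) * (e * i * (e * i) + e * i + 1#)) ei (solve 4 (λ A y x i → con 2
              :* (con 2 :* A :* (y :* (y :* y :+ x :* x))) :- con 2 :* (x :* (y :* y :- x :* x)) := y :* (y :* y
              :+ x :* x) :* (con 4 :* A :- con 4 :* (x :* x :* (x :* x)) :* (y :* y) :* i :* (con 2 :* ((y :* y
              :+ x :* x) :* (y :* y :+ x :* x) :* (y :* y :- x :* x)) :* i :* (con 2 :* ((y :* y :+ x :* x) :* (y :* y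
              :+ x :* x) :* (y :* y :- x :* x)) :* i) :- con 4)) :+ (con 4 :* (x :* x :* (x :* x)) :* (y :* y) :* i
              :* con 4 :* (con 2 :* x :* y :* ((y :* y :- x :* x) :* (y :* y :+ x :* x)) :* i :+ con 1) :* (y
              :* (y :* y :+ x :* x)) :+ con 2 :* (x :* (y :* y :- x :* x)) :* (con 2 :* x :* y :* ((y :* y :- x
              :* x) :* (y :* y :+ x :* x)) :* i :* (con 2 :* x :* y :* ((y :* y :- x :* x) :* (y :* y :+ x :* x))
              :* i) :+ con 2 :* x :* y :* ((y :* y :- x :* x) :* (y :* y :+ x :* x)) :* i :+ con 1)) :* (con 2
              :* x :* y :* ((y :* y :- x :* x) :* (y :* y :+ x :* x)) :* i :- con 1)) refl A y x i)

      2A+C : (two * A + C) * (x * P₋) ≡ y * P₊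
      2A+C = cancelˡ (*-≢0 2≢0 s≢0) (general A C 2A C≡)
        where
        C≡ : C ≡ two * a + n
        C≡ = trans (assoc a b c) (trans (cong (a +_) b+c) (assoc′ a n))
          where
          assoc = solve 3 (λ a b c → a :+ b :+ c := a :+ (b :+ c)) refl
          assoc′ = solve 2 (λ a n → a :+ (a :+ n) := con 2 :* a :+ n) refl
        general : ∀ A C → two * A * (y * P₊) ≡ x * P₋ → C ≡ two * a + n → two * (y * P₊) * ((two * A + C) * (x * P₋)) ≡ two * (y * P₊) * (y * P₊)
        general A C p q = linear₃ (two * (x * P₋)) p e q (two * four * (x * x * (x * x)) * (y * y) + two * (P₊ * P₊ * P₋)) ei (solve 5 (λ y x A C i → con 2
            :* (y :* (y :* y :+ x :* x)) :* ((con 2 :* A :+ C) :* (x :* (y :* y :- x :* x))) :- con 2 :* (y :* (y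
            :* y :+ x :* x)) :* (y :* (y :* y :+ x :* x)) := con 2 :* (x :* (y :* y :- x :* x)) :* (con 2 :* A :* (y
            :* (y :* y :+ x :* x)) :- x :* (y :* y :- x :* x)) :+ con 2 :* x :* y :* ((y :* y :- x :* x) :* (y :* y
            :+ x :* x)) :* (C :- (con 2 :* (con 4 :* (x :* x :* (x :* x)) :* (y :* y) :* i) :+ con 2 :* ((y :* y
            :+ x :* x) :* (y :* y :+ x :* x) :* (y :* y :- x :* x)) :* i)) :+ (con 2 :* con 4 :* (x :* x :* (x
            :* x)) :* (y :* y) :+ con 2 :* ((y :* y :+ x :* x) :* (y :* y :+ x :* x) :* (y :* y :- x :* x)))
            :* (con 2 :* x :* y :* ((y :* y :- x :* x) :* (y :* y :+ x :* x)) :* i :- con 1)) refl y x A C i)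

      order-five : two * A * (two * A + C) ≡ 1#
      order-five = cancelˡ (*-≢0 r≢0 s≢0) (general A C (x * P₋) (y * P₊) 2A 2A+C)
        where
        general : ∀ A C r s → two * A * s ≡ r → (two * A + C) * r ≡ s → r * s * (two * A * (two * A + C)) ≡ r * s * 1#
        general A C r s p q = linear₂ ((two * A + C) * r) p r q (solve 4 (λ r s A C → r :* s :* (con 2 :* A
            :* (con 2 :* A :+ C)) :- r :* s :* con 1 := (con 2 :* A :+ C) :* r :* (con 2 :* A :* s :- r) :+ r
            :* ((con 2 :* A :+ C) :* r :- s)) refl r s A C)

      square : ∀ a b c → (a + b + c) * (a + b + c) ≡ four * (a * b + a * c + b * c) + four → (a + b - c) * η * ((a + b - c) * η) ≡ a * b + 1#
      square a b c p = linear₂ (η * η) p ((two * η + 1#) * (a * b + 1#)) 2η (solve 4 (λ a b c η → (a :+ b :- c) :* η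
          :* ((a :+ b :- c) :* η) :- (a :* b :+ con 1) := η :* η :* ((a :+ b :+ c) :* (a :+ b :+ c) :- (con 4 :* (a
          :* b :+ a :* c :+ b :* c) :+ con 4)) :+ (con 2 :* η :+ con 1) :* (a :* b :+ con 1) :* (con 2 :* η
          :- con 1)) refl a b c η)

      A≢0 : A ≢ 0#
      A≢0 p = r≢0 (trans (sym 2A) (trans (cong (λ t → two * t * (y * P₊)) p) (vanish two (y * P₊))))
        where
        vanish = solve 2 (λ u v → u :* con 0 :* v := con 0) refl

  record TorsionTriple (𝔽 : DecField) (a b c : DecField.F 𝔽) : Set where
    open DecField 𝔽
    open Curve 𝔽 (a * b * c) (a * b + a * c + b * c) (a + b + c)
    field
      a≢0 : a ≢ 0#
      b≢0 : b ≢ 0#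
      c≢0 : c ≢ 0#
      a≢b : a ≢ b
      a≢c : a ≢ c
      b≢c : b ≢ c
      square-ab : ∃ λ t → t * t ≡ a * b + 1#
      square-ac : ∃ λ t → t * t ≡ a * c + 1#
      square-bc : ∃ λ t → t * t ≡ b * c + 1#
      factorised : ∀ x → (a * x + 1#) * (b * x + 1#) * (c * x + 1#) ≡ cubic x
      ψ : Z2×Z10 → Point
      ψ-onCurve : ∀ u → OnCurve (ψ u)
      ψ-homo : ∀ u v → ψ (u ⊞ v) ≡ ψ u ⊕ ψ v
      ψ-injective : ∀ u v → ψ u ≡ ψ v → u ≡ v
      torsion-classified : ∀ {Q} → OnCurve Q → ∀ n → mul (suc n) Q ≡ O → ∃ λ u → ψ u ≡ Q

  -- Rationality singles out the first element, so equality of two underlying sets forces equality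
  -- of their a.
  record TripleFamily (𝔽 : DecField) (Rational : DecField.F 𝔽 → Set) : Set where
    open DecField 𝔽
    field
      a b c : ℕ → F
      torsionTriple : ∀ j → TorsionTriple 𝔽 (a j) (b j) (c j)
      a-rational : ∀ j → Rational (a j)
      b-irrational : ∀ j → ¬ Rational (b j)
      c-irrational : ∀ j → ¬ Rational (c j)
      a-injective : ∀ i j → a i ≡ a j → i ≡ j

  module FieldTriple (𝔽 : DecField) (h k : ℤ) (h≡ : h ≡ ℤ.1ℤ ℤ.+ ℤ.+ 289 ℤ.* k) (√h : SquareRoot 𝔽 h) where
    open DecField 𝔽
    open FieldLemmas 𝔽
    open FromIntegers isCommutativeRing using (ι; ι-+; ι-*; ι-neg)
    open SquareRoot √h
    open Conditions 𝔽
    open SplitPlace 𝔽 h k h≡ √h using (splitPlace; ι-injective; ⟪ι⟫)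
    open Modulo17
    open TriplingStep using (State)

    Rational : F → Set
    Rational α = ∃ λ q → ∃ λ p → q ≢ ℤ.0ℤ × ι q * α ≡ ι p

    zero-product : ∀ {m n} → m ≢ ℤ.0ℤ → n ≢ ℤ.0ℤ → m ℤ.* n ≢ ℤ.0ℤ
    zero-product {m} m≢0 n≢0 e = [ m≢0 , n≢0 ]′ (ℤP.i*j≡0⇒i≡0∨j≡0 m e)

    rational-+ : ∀ {α β} → Rational α → Rational β → Rational (α + β)
    rational-+ {α} {β} (q , p , q≢0 , e) (q′ , p′ , q′≢0 , e′) = q ℤ.* q′ , q′ ℤ.* p ℤ.+ q ℤ.* p′ , zero-product q≢0 q′≢0 ,
      trans (cong (_* (α + β)) (ι-* q q′)) (trans (combine (ι q) (ι q′) α β (ι p) (ι p′) e e′)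
        (sym (trans (ι-+ (q′ ℤ.* p) (q ℤ.* p′)) (cong₂ _+_ (ι-* q′ p) (ι-* q p′)))))
      where
      combine : ∀ q q′ α β p p′ → q * α ≡ p → q′ * β ≡ p′ → q * q′ * (α + β) ≡ q′ * p + q * p′
      combine q q′ α β _ _ refl refl = solve 4 (λ q q′ α β → q :* q′ :* (α :+ β) := q′ :* (q :* α) :+ q :* (q′ :* β))
          refl q q′ α β

    rational-neg : ∀ {α} → Rational α → Rational (- α)
    rational-neg {α} (q , p , q≢0 , e) = q , ℤ.- p , q≢0 , trans (move (ι q) α) (trans (cong -_ e) (sym (ι-neg p)))
      where
      move = solve 2 (λ q α → q :* :- α := :- (q :* α)) refl

    module OfState {j} (state : State h (ℤ.+ 8) j) where
      open State state

      E : ℤ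
      E = ℤ.+ 2 ℤ.* U ℤ.* V ℤ.* ((V ℤ.* V ℤ.- U ℤ.* U) ℤ.* (V ℤ.* V ℤ.+ U ℤ.* U))

      17∤U : ¬ ℤ.+ 17 ∣ U
      17∤U d = ∤-* (toWitnessFalse {a? = ℤ.+ 17 ∣? ℤ.+ 8} _) 17∤V (∣-resp residue d)

      U²≡ : U ℤ.* U ≡ₚ ℤ.+ 64 ℤ.* (V ℤ.* V)
      U²≡ = ≡ₚ-trans (*-congₚ residue residue) (≡ₚ-reflexive (rearrange V))
        where
        rearrange : ∀ V → ℤ.+ 8 ℤ.* V ℤ.* (ℤ.+ 8 ℤ.* V) ≡ ℤ.+ 64 ℤ.* (V ℤ.* V)
        rearrange = solve-∀

      17∤P₋ : ¬ ℤ.+ 17 ∣ V ℤ.* V ℤ.- U ℤ.* U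
      17∤P₋ d = ∤-* (toWitnessFalse {a? = ℤ.+ 17 ∣? ℤ.- ℤ.+ 63} _) (∤-* 17∤V 17∤V)
        (∣-resp (≡ₚ-trans (+-congₚ (≡ₚ-reflexive {V ℤ.* V} refl) (neg-congₚ U²≡)) (≡ₚ-reflexive (collect (V ℤ.* V)))) d)
        where
        collect : ∀ W → W ℤ.- ℤ.+ 64 ℤ.* W ≡ ℤ.- ℤ.+ 63 ℤ.* W
        collect = solve-∀

      17∤P₊ : ¬ ℤ.+ 17 ∣ V ℤ.* V ℤ.+ U ℤ.* U
      17∤P₊ d = ∤-* (toWitnessFalse {a? = ℤ.+ 17 ∣? ℤ.+ 65} _) (∤-* 17∤V 17∤V)
        (∣-resp (≡ₚ-trans (+-congₚ (≡ₚ-reflexive {V ℤ.* V} refl) U²≡) (≡ₚ-reflexive (collect (V ℤ.* V)))) d)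
        where
        collect : ∀ W → W ℤ.+ ℤ.+ 64 ℤ.* W ≡ ℤ.+ 65 ℤ.* W
        collect = solve-∀

      ∤⇒≢0 : ∀ {n} → ¬ ℤ.+ 17 ∣ n → n ≢ ℤ.0ℤ
      ∤⇒≢0 ∤n refl = ∤n (divides ℤ.0ℤ refl)

      ι≢0 : ∀ {n} → n ≢ ℤ.0ℤ → ι n ≢ 0#
      ι≢0 n≢0 e = n≢0 (ι-injective e)

      M≢0 : M ≢ ℤ.0ℤ
      -- Modulo 17, h M² is (1 + σ² - σ⁴) V⁴ with σ = 8, and 1 + 64 - 64² = -4031 is prime to 17.
      M≢0 refl = ∤-* (toWitnessFalse {a? = ℤ.+ 17 ∣? ℤ.- ℤ.+ 4031} _) (∤-* (∤-* 17∤V 17∤V) (∤-* 17∤V 17∤V))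
        (∣-resp {m = ℤ.0ℤ} (≡ₚ-trans (≡ₚ-reflexive (sym (trans curve (ℤP.*-zeroʳ h))))
          (≡ₚ-trans (+-congₚ (+-congₚ (≡ₚ-reflexive {V ℤ.* V ℤ.* (V ℤ.* V)} refl) (*-congₚ U²≡ (≡ₚ-reflexive {V ℤ.* V} refl))) (neg-congₚ (*-congₚ U²≡ U²≡)))
            (≡ₚ-reflexive (collect (V ℤ.* V))))) (divides ℤ.0ℤ refl))
        where
        collect : ∀ W → W ℤ.* W ℤ.+ ℤ.+ 64 ℤ.* W ℤ.* W ℤ.- ℤ.+ 64 ℤ.* W ℤ.* (ℤ.+ 64 ℤ.* W) ≡ ℤ.- ℤ.+ 4031 ℤ.* (W ℤ.* W)
        collect = solve-∀

      x y m P₋ P₊ e : F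
      x = ι U
      y = ι V
      m = ι M
      P₋ = y * y - x * x
      P₊ = y * y + x * x
      e = two * x * y * (P₋ * P₊)

      ι-P₋ : ι (V ℤ.* V ℤ.- U ℤ.* U) ≡ P₋
      ι-P₋ = trans (ι-+ (V ℤ.* V) (ℤ.- (U ℤ.* U))) (cong₂ _+_ (ι-* V V) (trans (ι-neg (U ℤ.* U)) (cong -_ (ι-* U U))))

      ι-P₊ : ι (V ℤ.* V ℤ.+ U ℤ.* U) ≡ P₊
      ι-P₊ = trans (ι-+ (V ℤ.* V) (U ℤ.* U)) (cong₂ _+_ (ι-* V V) (ι-* U U))

      ι-E : ι E ≡ e
      ι-E = trans (ι-* (ℤ.+ 2 ℤ.* U ℤ.* V) ((V ℤ.* V ℤ.- U ℤ.* U) ℤ.* (V ℤ.* V ℤ.+ U ℤ.* U)))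
        (cong₂ _*_ (trans (ι-* (ℤ.+ 2 ℤ.* U) V) (cong (_* y) (ι-* (ℤ.+ 2) U)))
          (trans (ι-* (V ℤ.* V ℤ.- U ℤ.* U) (V ℤ.* V ℤ.+ U ℤ.* U)) (cong₂ _*_ ι-P₋ ι-P₊)))

      x≢0 : x ≢ 0#
      x≢0 = ι≢0 (∤⇒≢0 17∤U)
      y≢0 : y ≢ 0#
      y≢0 = ι≢0 (∤⇒≢0 17∤V)
      2≢0 : two ≢ 0#
      2≢0 = ι≢0 {ℤ.+ 2} λ ()
      P₋≢0 : P₋ ≢ 0#
      P₋≢0 = subst (_≢ 0#) ι-P₋ (ι≢0 (∤⇒≢0 17∤P₋))
      P₊≢0 : P₊ ≢ 0#
      P₊≢0 = subst (_≢ 0#) ι-P₊ (ι≢0 (∤⇒≢0 17∤P₊))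
      e≢0 : e ≢ 0#
      e≢0 = *-≢0 (*-≢0 (*-≢0 2≢0 x≢0) y≢0) (*-≢0 P₋≢0 P₊≢0)
      E≢0 : E ≢ ℤ.0ℤ
      E≢0 p = e≢0 (trans (sym ι-E) (cong ι p))

      curveF : y * y * (y * y) + x * x * (y * y) - x * x * (x * x) ≡ m * θ * (m * θ)
      curveF = trans (sym (trans (ι-+ (V ℤ.* V ℤ.* (V ℤ.* V) ℤ.+ U ℤ.* U ℤ.* (V ℤ.* V)) (ℤ.- (U ℤ.* U ℤ.* (U ℤ.* U))))
          (cong₂ _+_ (trans (ι-+ (V ℤ.* V ℤ.* (V ℤ.* V)) (U ℤ.* U ℤ.* (V ℤ.* V))) (cong₂ _+_ (square V V) (square U V)))
            (trans (ι-neg (U ℤ.* U ℤ.* (U ℤ.* U))) (cong -_ (square U U))))))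
        (trans (cong ι curve) (trans (ι-* h (M ℤ.* M)) (trans (cong₂ _*_ (sym θ²) (ι-* M M)) (regroup θ m))))
        where
        square : ∀ m n → ι (m ℤ.* m ℤ.* (n ℤ.* n)) ≡ ι m * ι m * (ι n * ι n)
        square m n = trans (ι-* (m ℤ.* m) (n ℤ.* n)) (cong₂ _*_ (ι-* m m) (ι-* n n))
        regroup = solve 2 (λ θ m → θ :* θ :* (m :* m) := m :* θ :* (m :* θ)) refl

      i η : F
      i = inv e
      η = inv two

      open Formulas 𝔽 x y (m * θ) i η using (a; n; ρ; b; c; A; B; C; module Identities) public
      open Identities curveF (*-inv e e≢0) (*-inv two 2≢0) 2≢0 (*-≢0 x≢0 P₋≢0) (*-≢0 y≢0 P₊≢0)
        using (regular; order-five; 2A; A≢0) renaming (square to general-square) public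

      -- A is the rational number σ(1 - σ²)/(2(1 + σ²)), which at σ ≡ 8 is 16 modulo 17; no √h is
      -- needed in the fraction.
      res-A : Place.Res splitPlace A (ℤ.+ 16)
      res-A = (S , ℤ.0ℤ) , (R , ℤ.0ℤ) , trans (cong (_* A) (trans (⟪ι⟫ S) ι-S)) (trans (rearrange two A (y * P₊)) (trans 2A (sym (trans (⟪ι⟫ R) ι-R)))) ,
        (λ d → 17∤S (subst (ℤ.+ 17 ∣_) (ℤP.+-identityʳ S) d)) ,
        ≡ₚ-trans (≡ₚ-reflexive (ℤP.+-identityʳ R)) (≡ₚ-trans congruence (≡ₚ-reflexive (cong (ℤ.+ 16 ℤ.*_) (sym (ℤP.+-identityʳ S)))))
        where
        S R : ℤ
        S = ℤ.+ 2 ℤ.* (V ℤ.* (V ℤ.* V ℤ.+ U ℤ.* U))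
        R = U ℤ.* (V ℤ.* V ℤ.- U ℤ.* U)
        ι-S : ι S ≡ two * (y * P₊)
        ι-S = trans (ι-* (ℤ.+ 2) (V ℤ.* (V ℤ.* V ℤ.+ U ℤ.* U))) (cong (two *_) (trans (ι-* V (V ℤ.* V ℤ.+ U ℤ.* U)) (cong (y *_) ι-P₊)))
        ι-R : ι R ≡ x * P₋
        ι-R = trans (ι-* U (V ℤ.* V ℤ.- U ℤ.* U)) (cong (x *_) ι-P₋)
        rearrange = solve 3 (λ t A s → t :* s :* A := t :* A :* s) refl
        17∤S : ¬ ℤ.+ 17 ∣ S
        17∤S = ∤-* (toWitnessFalse {a? = ℤ.+ 17 ∣? ℤ.+ 2} _) (∤-* 17∤V 17∤P₊)
        congruence : R ≡ₚ ℤ.+ 16 ℤ.* S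
        congruence = modulo (subst (ℤ.+ 17 ∣_) (sym (expand U V)) (∣m∣n⇒∣m-n (∣m⇒∣m*n (ℤ.- (U ℤ.* U) ℤ.- ℤ.+ 40 ℤ.* U ℤ.* V ℤ.- ℤ.+ 319 ℤ.* V ℤ.* V) (p∣difference residue))
          (∣m⇒∣m*n {i = ℤ.+ 17} (ℤ.+ 152 ℤ.* V ℤ.* V ℤ.* V) (∣-reflexive refl))))
          where
          expand : ∀ U V → U ℤ.* (V ℤ.* V ℤ.- U ℤ.* U) ℤ.- ℤ.+ 16 ℤ.* (ℤ.+ 2 ℤ.* (V ℤ.* (V ℤ.* V ℤ.+ U ℤ.* U))) ≡
            (U ℤ.- ℤ.+ 8 ℤ.* V) ℤ.* (ℤ.- (U ℤ.* U) ℤ.- ℤ.+ 40 ℤ.* U ℤ.* V ℤ.- ℤ.+ 319 ℤ.* V ℤ.* V) ℤ.- ℤ.+ 17 ℤ.* (ℤ.+ 152 ℤ.* V ℤ.* V ℤ.* V)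
          expand = solve-∀

      over-E : ∀ {t α} T → ι T ≡ t → α ≡ t * i → ι E * α ≡ ι T
      over-E {t} T refl refl = trans (cong (_* (t * i)) ι-E) (inv-* e≢0 t)

      aNum nNum ρNum : ℤ
      aNum = ℤ.+ 4 ℤ.* (U ℤ.* U ℤ.* (U ℤ.* U)) ℤ.* (V ℤ.* V)
      nNum = ℤ.+ 2 ℤ.* ((V ℤ.* V ℤ.+ U ℤ.* U) ℤ.* (V ℤ.* V ℤ.+ U ℤ.* U) ℤ.* (V ℤ.* V ℤ.- U ℤ.* U))
      ρNum = ℤ.+ 4 ℤ.* M ℤ.* U ℤ.* (V ℤ.* V ℤ.* V)

      E*a : ι E * a ≡ ι aNum
      E*a = over-E aNum (trans (ι-* (ℤ.+ 4 ℤ.* (U ℤ.* U ℤ.* (U ℤ.* U))) (V ℤ.* V)) (cong₂ _*_ (trans (ι-* (ℤ.+ 4) (U ℤ.* U ℤ.* (U ℤ.* U)))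
        (cong (four *_) (trans (ι-* (U ℤ.* U) (U ℤ.* U)) (cong₂ _*_ (ι-* U U) (ι-* U U))))) (ι-* V V))) refl

      a-rational : Rational a
      a-rational = E , aNum , E≢0 , E*a

      n-rational : Rational n
      n-rational = E , nNum , E≢0 , over-E nNum (trans (ι-* (ℤ.+ 2) (p₊ ℤ.* p₊ ℤ.* p₋)) (cong (two *_) (trans (ι-* (p₊ ℤ.* p₊) p₋)
          (cong₂ _*_ (trans (ι-* p₊ p₊) (cong₂ _*_ ι-P₊ ι-P₊)) ι-P₋)))) refl
        where
        p₊ p₋ : ℤ
        p₊ = V ℤ.* V ℤ.+ U ℤ.* U
        p₋ = V ℤ.* V ℤ.- U ℤ.* U

      -- Being a nonzero rational multiple of √h, ρ would otherwise yield a linear relation between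
      -- 1 and θ.
      ρ-irrational : ¬ Rational ρ
      ρ-irrational (q , p , q≢0 , f) = zero-product q≢0 ρNum≢0 (proj₂ (independent (ℤ.- (E ℤ.* p)) (q ℤ.* ρNum)
          (trans (cong₂ (λ s t → s + t * θ) (trans (ι-neg (E ℤ.* p)) (cong -_ (ι-* E p))) (ι-* q ρNum))
            (cancel (ι E) (ι q) (ι p) ρ (ι ρNum) θ f E*ρ))))
        where
        ρNum≢0 : ρNum ≢ ℤ.0ℤ
        ρNum≢0 = zero-product (zero-product (zero-product {ℤ.+ 4} (λ ()) M≢0) (∤⇒≢0 17∤U)) (zero-product (zero-product (∤⇒≢0 17∤V) (∤⇒≢0 17∤V)) (∤⇒≢0 17∤V))
        ι-ρNum : ι ρNum ≡ four * m * x * (y * y * y)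
        ι-ρNum = trans (ι-* (ℤ.+ 4 ℤ.* M ℤ.* U) (V ℤ.* V ℤ.* V)) (cong₂ _*_ (trans (ι-* (ℤ.+ 4 ℤ.* M) U) (cong (_* x) (ι-* (ℤ.+ 4) M)))
          (trans (ι-* (V ℤ.* V) V) (cong (_* y) (ι-* V V))))
        E*ρ : ι E * ρ ≡ ι ρNum * θ
        E*ρ = trans (cong (_* ρ) ι-E) (trans (inv-* e≢0 (four * (m * θ) * x * (y * y * y)))
          (trans (regroup four m θ x y) (cong (_* θ) (sym ι-ρNum))))
          where
          regroup = solve 5 (λ f m θ x y → f :* (m :* θ) :* x :* (y :* y :* y) := f :* m :* x :* (y :* y :* y) :* θ)
              refl
        cancel : ∀ E q p ρ r θ → q * ρ ≡ p → E * ρ ≡ r * θ → - (E * p) + q * r * θ ≡ 0#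
        cancel E q p ρ r θ f g = linear₂ E f (- q) g (solve 6 (λ E p q r θ ρ → :- (E :* p) :+ q :* r :* θ :- con 0
            := E :* (q :* ρ :- p) :+ :- q :* (E :* ρ :- r :* θ)) refl E p q r θ ρ)

      2η : two * η ≡ 1#
      2η = *-inv two 2≢0

      ρ-from-b : ρ ≡ b + b + - a + - n
      ρ-from-b = identity a n ρ η 2η
        where
        identity : ∀ a n ρ η → two * η ≡ 1# → ρ ≡ (a + n + ρ) * η + (a + n + ρ) * η + - a + - n
        identity a n ρ η p = linear₁ (- (a + n + ρ)) p (solve 4 (λ ρ a n η → ρ :- ((a :+ n :+ ρ) :* η :+ (a :+ n :+ ρ)
            :* η :- a :- n) := :- (a :+ n :+ ρ) :* (con 2 :* η :- con 1)) refl ρ a n η)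

      ρ-from-c : ρ ≡ a + n + - (c + c)
      ρ-from-c = identity a n ρ η 2η
        where
        identity : ∀ a n ρ η → two * η ≡ 1# → ρ ≡ a + n + - ((a + n - ρ) * η + (a + n - ρ) * η)
        identity a n ρ η p = linear₁ (a + n - ρ) p (solve 4 (λ ρ a n η → ρ :- (a :+ n :- ((a :+ n :- ρ) :* η :+ (a :+ n
            :- ρ) :* η)) := (a :+ n :- ρ) :* (con 2 :* η :- con 1)) refl ρ a n η)

      b-irrational : ¬ Rational b
      b-irrational r = ρ-irrational (subst Rational (sym ρ-from-b)
        (rational-+ (rational-+ (rational-+ r r) (rational-neg a-rational)) (rational-neg n-rational)))

      c-irrational : ¬ Rational c
      c-irrational r = ρ-irrational (subst Rational (sym ρ-from-c)
        (rational-+ (rational-+ a-rational n-rational) (rational-neg (rational-+ r r))))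

      a≢b : a ≢ b
      a≢b e = b-irrational (subst Rational e a-rational)

      a≢c : a ≢ c
      a≢c e = c-irrational (subst Rational e a-rational)

      b≢c : b ≢ c
      b≢c e = ρ-irrational (ℤ.1ℤ , ℤ.0ℤ , (λ ()) , trans (*-identityˡ ρ) (identity a n ρ η 2η e))
        where
        identity : ∀ a n ρ η → two * η ≡ 1# → (a + n + ρ) * η ≡ (a + n - ρ) * η → ρ ≡ 0#
        identity a n ρ η p q = linear₂ (- ρ) p 1# q (solve 4 (λ ρ η a n → ρ :- con 0 := :- ρ :* (con 2 :* η
            :- con 1) :+ con 1 :* ((a :+ n :+ ρ) :* η :- (a :+ n :- ρ) :* η)) refl ρ η a n)

      a≢0 : a ≢ 0#
      a≢0 p = A≢0 (trans (cong (λ t → t * b * c) p) (trans (cong (_* c) (zeroˡ b)) (zeroˡ c)))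
      b≢0 : b ≢ 0#
      b≢0 p = A≢0 (trans (cong (λ t → a * t * c) p) (trans (cong (_* c) (zeroʳ a)) (zeroˡ c)))
      c≢0 : c ≢ 0#
      c≢0 p = A≢0 (trans (cong (λ t → a * b * t) p) (zeroʳ (a * b)))

      square-ab : ∃ λ t → t * t ≡ a * b + 1#
      square-ab = _ , general-square a b c regular

      square-ac : ∃ λ t → t * t ≡ a * c + 1#
      square-ac = _ , general-square a c b (trans (swap a b c) (trans regular (swap′ a b c)))
        where
        swap = solve 3 (λ a b c → (a :+ c :+ b) :* (a :+ c :+ b) := (a :+ b :+ c) :* (a :+ b :+ c)) refl
        swap′ = solve 3 (λ a b c → con 4 :* (a :* b :+ a :* c :+ b :* c) :+ con 4 := con 4 :* (a :* c :+ a :* b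
            :+ c :* b) :+ con 4) refl

      square-bc : ∃ λ t → t * t ≡ b * c + 1#
      square-bc = _ , general-square b c a (trans (swap a b c) (trans regular (swap′ a b c)))
        where
        swap = solve 3 (λ a b c → (b :+ c :+ a) :* (b :+ c :+ a) := (a :+ b :+ c) :* (a :+ b :+ c)) refl
        swap′ = solve 3 (λ a b c → con 4 :* (a :* b :+ a :* c :+ b :* c) :+ con 4 := con 4 :* (b :* c :+ b :* a
            :+ c :* a) :+ con 4) refl

      open Triple.Torsion 𝔽 splitPlace a b c a≢0 b≢0 c≢0 a≢b a≢c b≢c regular order-five res-A public
        using (ψ; ψ-homo; ψ-injective; torsion-classified; factorised)

    3^-unique : ∀ m n {x y} → ¬ ℤ.+ 3 ∣ x → ¬ ℤ.+ 3 ∣ y → (ℤ.+ 3) ℤ.^ m ℤ.* x ≡ (ℤ.+ 3) ℤ.^ n ℤ.* y → m ≡ n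
    3^-unique zero zero _ _ _ = refl
    3^-unique (suc m) (suc n) {x} {y} ∤x ∤y e = cong suc (3^-unique m n ∤x ∤y (ℤP.*-cancelˡ-≡ (ℤ.+ 3) _ _
      (trans (sym (ℤP.*-assoc (ℤ.+ 3) ((ℤ.+ 3) ℤ.^ m) x)) (trans e (ℤP.*-assoc (ℤ.+ 3) ((ℤ.+ 3) ℤ.^ n) y)))))
    3^-unique zero (suc n) {x} {y} ∤x ∤y e = ⊥-elim (∤x (divides ((ℤ.+ 3) ℤ.^ n ℤ.* y) (trans (sym (ℤP.*-identityˡ x)) (trans e (move ((ℤ.+ 3) ℤ.^ n) y)))))
      where
      move : ∀ p y → ℤ.+ 3 ℤ.* p ℤ.* y ≡ p ℤ.* y ℤ.* ℤ.+ 3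
      move = solve-∀
    3^-unique (suc m) zero {x} {y} ∤x ∤y e = ⊥-elim (∤y (divides ((ℤ.+ 3) ℤ.^ m ℤ.* x) (trans (sym (ℤP.*-identityˡ y)) (trans (sym e) (move ((ℤ.+ 3) ℤ.^ m) x)))))
      where
      move : ∀ p y → ℤ.+ 3 ℤ.* p ℤ.* y ≡ p ℤ.* y ℤ.* ℤ.+ 3
      move = solve-∀

    -- The 3-adic valuation of a = 2σ³/(1 - σ⁴) is 3(j + 1). After cross multiplication the
    -- numerator contributes 4(j + 1), the denominator E of the same triple j + 1, and `cofactor` is
    -- prime to 3.
    a-determines-index : ∀ {j j′} (s : State h (ℤ.+ 8) j) (s′ : State h (ℤ.+ 8) j′) → OfState.a s ≡ OfState.a s′ → j ≡ j′
    a-determines-index {j} {j′} s s′ a≡a′ = ℕP.suc-injective (ℕP.*-cancelˡ-≡ (suc j) (suc j′) 3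
        (ℕP.+-cancelˡ-≡ (suc j ℕ.+ suc j′) _ _ (trans (exponents (suc j) (suc j′)) (trans (sym orders) (exponents′ (suc j) (suc j′))))))
      where
      module S = OfState s
      module S′ = OfState s′
      exponents : ∀ k k′ → k ℕ.+ k′ ℕ.+ 3 ℕ.* k ≡ k′ ℕ.+ (k ℕ.+ k ℕ.+ (k ℕ.+ k))
      exponents = ℕSolver.solve-∀
      exponents′ : ∀ k k′ → k ℕ.+ (k′ ℕ.+ k′ ℕ.+ (k′ ℕ.+ k′)) ≡ k ℕ.+ k′ ℕ.+ 3 ℕ.* k′
      exponents′ = ℕSolver.solve-∀
      cross : S′.E ℤ.* S.aNum ≡ S.E ℤ.* S′.aNum
      cross = ℤP.i-j≡0⇒i≡j _ _ (ι-injective (trans (trans (ι-+ (S′.E ℤ.* S.aNum) (ℤ.- (S.E ℤ.* S′.aNum)))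
          (cong₂ _+_ (ι-* S′.E S.aNum) (trans (ι-neg (S.E ℤ.* S′.aNum)) (cong -_ (ι-* S.E S′.aNum)))))
          (vanish _ _ _ _ _ S.E*a (trans (cong (ι S′.E *_) a≡a′) S′.E*a))))
        where
        vanish : ∀ E E′ p p′ α → E * α ≡ p → E′ * α ≡ p′ → E′ * p + - (E * p′) ≡ 0#
        vanish E E′ _ _ α refl refl = solve 3 (λ E′ E α → E′ :* (E :* α) :- E :* (E′ :* α) := con 0) refl E′ E α
      cofactor : ∀ {i i′} (s : State h (ℤ.+ 8) i) (s′ : State h (ℤ.+ 8) i′) → ℤ
      cofactor s s′ = ℤ.+ 8 ℤ.* State.u s′ ℤ.* State.V s′ ℤ.* ((State.V s′ ℤ.* State.V s′ ℤ.- State.U s′ ℤ.* State.U s′) ℤ.* (State.V s′ ℤ.* State.V s′ ℤ.+ State.U s′ ℤ.* State.U s′))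
        ℤ.* (State.u s ℤ.* State.u s ℤ.* (State.u s ℤ.* State.u s) ℤ.* (State.V s ℤ.* State.V s))
      factor : ∀ {i i′} (s : State h (ℤ.+ 8) i) (s′ : State h (ℤ.+ 8) i′) →
        OfState.E s′ ℤ.* OfState.aNum s ≡ (ℤ.+ 3) ℤ.^ (suc i′ ℕ.+ (suc i ℕ.+ suc i ℕ.+ (suc i ℕ.+ suc i))) ℤ.* cofactor s s′
      factor {i} {i′} s s′ = trans (expand (State.U s) (State.V s) (State.U s′) (State.V s′) (State.u s) (State.u s′) ((ℤ.+ 3) ℤ.^ suc i) ((ℤ.+ 3) ℤ.^ suc i′) (State.order s) (State.order s′))
        (cong (ℤ._* cofactor s s′) (sym (trans (pow (suc i′) (suc i ℕ.+ suc i ℕ.+ (suc i ℕ.+ suc i))) (cong ((ℤ.+ 3) ℤ.^ suc i′ ℤ.*_)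
          (trans (pow (suc i ℕ.+ suc i) (suc i ℕ.+ suc i)) (cong₂ ℤ._*_ (pow (suc i) (suc i)) (pow (suc i) (suc i))))))))
        where
        pow : ∀ m n → (ℤ.+ 3) ℤ.^ (m ℕ.+ n) ≡ (ℤ.+ 3) ℤ.^ m ℤ.* (ℤ.+ 3) ℤ.^ n
        pow = ℤP.^-distribˡ-+-* (ℤ.+ 3)
        expanded : ∀ V U′ V′ u u′ p p′ D → ℤ.+ 2 ℤ.* (p′ ℤ.* u′) ℤ.* V′ ℤ.* D ℤ.* (ℤ.+ 4 ℤ.* (p ℤ.* u ℤ.* (p ℤ.* u) ℤ.* (p ℤ.* u ℤ.* (p ℤ.* u))) ℤ.* (V ℤ.* V)) ≡
          p′ ℤ.* (p ℤ.* p ℤ.* (p ℤ.* p)) ℤ.* (ℤ.+ 8 ℤ.* u′ ℤ.* V′ ℤ.* D ℤ.* (u ℤ.* u ℤ.* (u ℤ.* u) ℤ.* (V ℤ.* V)))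
        expanded = solve-∀
        expand : ∀ U V U′ V′ u u′ p p′ → U ≡ p ℤ.* u → U′ ≡ p′ ℤ.* u′ → let D = (V′ ℤ.* V′ ℤ.- U′ ℤ.* U′) ℤ.* (V′ ℤ.* V′ ℤ.+ U′ ℤ.* U′) in
          ℤ.+ 2 ℤ.* U′ ℤ.* V′ ℤ.* D ℤ.* (ℤ.+ 4 ℤ.* (U ℤ.* U ℤ.* (U ℤ.* U)) ℤ.* (V ℤ.* V)) ≡
          p′ ℤ.* (p ℤ.* p ℤ.* (p ℤ.* p)) ℤ.* (ℤ.+ 8 ℤ.* u′ ℤ.* V′ ℤ.* D ℤ.* (u ℤ.* u ℤ.* (u ℤ.* u) ℤ.* (V ℤ.* V)))
        expand U V U′ V′ u u′ p p′ e e′ = trans (cong₂ (λ U W → ℤ.+ 2 ℤ.* W ℤ.* V′ ℤ.* ((V′ ℤ.* V′ ℤ.- U′ ℤ.* U′) ℤ.* (V′ ℤ.* V′ ℤ.+ U′ ℤ.* U′)) ℤ.* (ℤ.+ 4 ℤ.* (U ℤ.* U ℤ.* (U ℤ.* U)) ℤ.* (V ℤ.* V))) e e′)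
          (expanded V U′ V′ u u′ p p′ ((V′ ℤ.* V′ ℤ.- U′ ℤ.* U′) ℤ.* (V′ ℤ.* V′ ℤ.+ U′ ℤ.* U′)))
      ∤cofactor : ∀ {i i′} (s : State h (ℤ.+ 8) i) (s′ : State h (ℤ.+ 8) i′) → ¬ ℤ.+ 3 ∣ cofactor s s′
      ∤cofactor {i} {i′} s s′ = ∤* (∤* (∤* (∤* (toWitnessFalse {a? = ℤ.+ 3 ∣? ℤ.+ 8} _) (3∤u s′)) (3∤V s′)) (∤* (∤V² (ℤ.- U²) (∣m⇒∣-m 3∣U²)) (∤V² U² 3∣U²)))
        (∤* (∤* (∤* (3∤u s) (3∤u s)) (∤* (3∤u s) (3∤u s))) (∤* (3∤V s) (3∤V s)))
        where
        open State
        ∤* : ∀ {m n} → ¬ ℤ.+ 3 ∣ m → ¬ ℤ.+ 3 ∣ n → ¬ ℤ.+ 3 ∣ m ℤ.* n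
        ∤* {m} {n} = Mod3.∤-* {m} {n}
        U² = U s′ ℤ.* U s′
        3∣U : ℤ.+ 3 ∣ U s′
        3∣U = subst (ℤ.+ 3 ∣_) (sym (trans (order s′) (ℤP.*-assoc (ℤ.+ 3) ((ℤ.+ 3) ℤ.^ i′) (u s′)))) (∣m⇒∣m*n {i = ℤ.+ 3} ((ℤ.+ 3) ℤ.^ i′ ℤ.* u s′) (∣-reflexive refl))
        3∣U² : ℤ.+ 3 ∣ U²
        3∣U² = ∣n⇒∣m*n (U s′) 3∣U
        ∤V² : ∀ n → ℤ.+ 3 ∣ n → ¬ ℤ.+ 3 ∣ V s′ ℤ.* V s′ ℤ.+ n
        ∤V² n d e = ∤* (3∤V s′) (3∤V s′) (subst (ℤ.+ 3 ∣_) (cancel (V s′ ℤ.* V s′) n) (∣m∣n⇒∣m-n e d))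
          where
          cancel : ∀ a b → a ℤ.+ b ℤ.- b ≡ a
          cancel = solve-∀
      orders : suc j ℕ.+ (suc j′ ℕ.+ suc j′ ℕ.+ (suc j′ ℕ.+ suc j′)) ≡ suc j′ ℕ.+ (suc j ℕ.+ suc j ℕ.+ (suc j ℕ.+ suc j))
      orders = sym (3^-unique (suc j′ ℕ.+ (suc j ℕ.+ suc j ℕ.+ (suc j ℕ.+ suc j))) (suc j ℕ.+ (suc j′ ℕ.+ suc j′ ℕ.+ (suc j′ ℕ.+ suc j′)))
        (∤cofactor s s′) (∤cofactor s′ s) (trans (sym (factor s s′)) (trans cross (factor s′ s))))

    abstract
      family : State h (ℤ.+ 6) 0 → TripleFamily 𝔽 Rational
      family start = record
        { a = T.a ; b = T.b ; c = T.c
        ; torsionTriple = λ j → record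
          { a≢0 = T.a≢0 j ; b≢0 = T.b≢0 j ; c≢0 = T.c≢0 j ; a≢b = T.a≢b j ; a≢c = T.a≢c j ; b≢c = T.b≢c j
          ; square-ab = T.square-ab j ; square-ac = T.square-ac j ; square-bc = T.square-bc j
          ; factorised = T.factorised j (T.a j) (T.b j) (T.c j)
          ; ψ = λ u → proj₁ (T.ψ j u) ; ψ-onCurve = λ u → proj₂ (T.ψ j u) ; ψ-homo = T.ψ-homo j ; ψ-injective = T.ψ-injective j
          ; torsion-classified = T.torsion-classified j }
        ; a-rational = T.a-rational ; b-irrational = T.b-irrational ; c-irrational = T.c-irrational
        ; a-injective = λ i j e → ℕP.suc-injective (a-determines-index (TriplingStep.iterate start i) (TriplingStep.iterate start j) e) }
        where
        -- The family begins after the first tripling, where σ has reached the residue 8.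
        module T (j : ℕ) = OfState (TriplingStep.iterate start j)

-- Coprime nonsquare heights and their squarefree parts

module Radicands where
  open import Defs using (SquareFree; IsQuadraticDiscr)
  open TriplingMap using (3-prime)
  open import Data.Empty using (⊥-elim)
  open import Data.Integer as ℤ using (ℤ)
  import Data.Integer.Properties as ℤP
  open import Data.Nat as ℕ using (ℕ; zero; suc; _+_; _*_; _≤_; _<_; _∸_; z≤n; s≤s)
  open import Data.Nat.Properties
  open import Data.Nat.Divisibility
  open import Data.Nat.Induction using (<-rec)
  open import Data.Nat.Tactic.RingSolver using (solve-∀)
  open import Data.Product using (∃; _×_; _,_)
  open import Data.Sum using (_⊎_; inj₁; inj₂; [_,_]′)
  open import Relation.Binary.PropositionalEquality
  open import Relation.Nullary using (¬_; Dec; yes; no; _→-dec_; ¬?)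
  open import Relation.Nullary.Decidable using (toWitness; toWitnessFalse)
  open import Relation.Binary.Definitions using (tri<; tri≈; tri>)
  open import Data.Fin using (Fin; toℕ; fromℕ<)
  import Data.Fin.Properties as FinP
  open import Data.Nat.Primality using (euclidsLemma)

  square-divisor? : ∀ n → (∃ λ m → m < n × (2 + m) * (2 + m) ∣ n) ⊎ (∀ m → m < n → ¬ (2 + m) * (2 + m) ∣ n)
  square-divisor? n with anyUpTo? (λ m → (2 + m) * (2 + m) ∣? n) n
  ... | yes p = inj₁ p
  ... | no ¬p = inj₂ λ m m<n d → ¬p (m , m<n , d)

  -- Square divisors greater than 1 are split off as long as there are any; every quotient is
  -- smaller, and y collects the roots.
  squarefree-part : ∀ n → n ≢ 0 → ∃ λ d → ∃ λ y → n ≡ d * (y * y) × SquareFree (ℤ.+ d)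
  squarefree-part = <-rec _ step
    where
    step : ∀ n → (∀ {m} → m < n → m ≢ 0 → ∃ λ d → ∃ λ y → m ≡ d * (y * y) × SquareFree (ℤ.+ d)) →
      n ≢ 0 → ∃ λ d → ∃ λ y → n ≡ d * (y * y) × SquareFree (ℤ.+ d)
    step n rec n≢0 with square-divisor? n
    ... | inj₂ none = n , 1 , sym (*-identityʳ n) , squarefree
      where
      squarefree : SquareFree (ℤ.+ n)
      squarefree zero d = ⊥-elim (n≢0 (0∣⇒≡0 d))
      squarefree (suc zero) _ = refl
      squarefree (suc (suc m)) d = ⊥-elim (none m (≤-trans (≤-trans (n≤1+n (suc m)) (m≤m*n (2 + m) (2 + m)))
        (∣⇒≤ {{ℕ.≢-nonZero n≢0}} d)) d)
    ... | inj₁ (m , _ , divides q n≡) with rec q<n q≢0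
      where
      q≢0 : q ≢ 0
      q≢0 refl = n≢0 n≡
      q<n : q < n
      q<n = subst (q <_) (sym n≡) (m<m*n q ((2 + m) * (2 + m)) {{ℕ.≢-nonZero q≢0}} (s≤s (s≤s z≤n)))
    ...   | d , y , q≡ , sf = d , y * (2 + m) , trans n≡ (trans (cong (_* ((2 + m) * (2 + m))) q≡) (regroup d y (2 + m))) , sf
      where
      regroup : ∀ d y k → d * (y * y) * (k * k) ≡ d * (y * k * (y * k))
      regroup = solve-∀

  -- height v = v⁴(1 + σ² - σ⁴) for σ = 3/v. Each base is divisible by all earlier heights, which makes the
  -- heights coprime, and height 26 ≡ 1 mod 289.
  height : ℕ → ℕ
  height v = v * v * (v * v) + 9 * (v * v) ∸ 81

  -- The truncated subtraction is exact because 81 ≤ 9 v².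
  height+81 : ∀ v → 26 ≤ v → height v + 81 ≡ v * v * (v * v) + 9 * (v * v)
  height+81 v 26≤v = m∸n+n≡m (≤-trans (≤-trans (m≤m+n 81 _) (*-monoʳ-≤ 9 (*-mono-≤ 26≤v 26≤v))) (m≤n+m _ (v * v * (v * v))))

  base : ℕ → ℕ
  base zero = 26
  base (suc n) = base n * height (base n)

  record Admissible (v : ℕ) : Set where
    constructor mkAdmissible
    field
      q k : ℕ
      v≡ : v ≡ 26 + 289 * q
      height≡ : height v ≡ 1 + 289 * k
      3∤v : ¬ 3 ∣ v

    26≤v : 26 ≤ v
    26≤v = subst (26 ≤_) (sym v≡) (m≤m+n 26 _)

  admissible : ∀ {v q} → v ≡ 26 + 289 * q → ¬ 3 ∣ v → Admissible v
  admissible {v} {q} refl 3∤v = mkAdmissible q (36 + (205 * s + 289 * (s * s))) refl height≡ 3∤v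
    where
    -- Modulo 289: 26² = 98 + 289 · 2 and 98² + 9 · 98 = 82 + 289 · 36. The coefficient 205 is 2 ·
    -- 98 + 9, and 82 - 81 = 1.
    s = 2 + (52 * q + 289 * (q * q))
    square : ∀ t q c → (c + t * q) * (c + t * q) ≡ c * c + t * (2 * c * q + t * (q * q))
    square = solve-∀
    quartic : ∀ t s c → (c + t * s) * (c + t * s) + 9 * (c + t * s) ≡ c * c + 9 * c + t * ((2 * c + 9) * s + t * (s * s))
    quartic = solve-∀
    carry : ∀ a t b c → a + t * b + t * c ≡ a + t * (b + c)
    carry = solve-∀
    w≡ : v * v ≡ 98 + 289 * s
    w≡ = trans (square 289 q 26) (carry 98 289 2 (52 * q + 289 * (q * q)))
    height≡ : height v ≡ 1 + 289 * (36 + (205 * s + 289 * (s * s)))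
    height≡ = trans (cong (λ w → w * w + 9 * w ∸ 81) w≡) (cong (_∸ 81)
      (trans (quartic 289 s 98) (carry 82 289 36 (205 * s + 289 * (s * s)))))

  3∤height : ∀ {v} → Admissible v → ¬ 3 ∣ height v
  3∤height {v} adm d = [ [ 3∤v , 3∤v ]′ , [ 3∤v , 3∤v ]′ ]′ (Data.Sum.map (euclidsLemma v v 3-prime) (euclidsLemma v v 3-prime) (euclidsLemma (v * v) (v * v) 3-prime 3∣v⁴))
    where
    open Admissible adm
    3∣v⁴ : 3 ∣ v * v * (v * v)
    3∣v⁴ = ∣m+n∣m⇒∣n (subst (3 ∣_) (trans (height+81 v 26≤v) (+-comm _ (9 * (v * v)))) (∣m∣n⇒∣m+n d (divides 27 refl))) (∣m⇒∣m*n (v * v) (divides 3 refl))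

  -- A factor ≡ 1 modulo 289 keeps the base in the class of 26, and by `3∤height` the new factor
  -- brings in no 3.
  base-admissible : ∀ n → Admissible (base n)
  base-admissible zero = admissible {q = 0} refl (toWitnessFalse {a? = 3 ∣? 26} _)
  base-admissible (suc n) = admissible {q = q + k * base n} (trans (cong (base n *_) height≡) (trans (cong (_* (1 + 289 * k)) v≡)
      (trans (expand q k) (cong (λ v → 26 + 289 * (q + k * v)) (sym v≡)))))
    (λ d → [ 3∤v , 3∤height (base-admissible n) ]′ (euclidsLemma (base n) (height (base n)) 3-prime d))
    where
    open Admissible (base-admissible n)
    expand : ∀ q k → (26 + 289 * q) * (1 + 289 * k) ≡ 26 + 289 * (q + k * (26 + 289 * q))
    expand = solve-∀

  height∣base : ∀ {m n} → m < n → height (base m) ∣ base n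
  height∣base {m} {suc n} (s≤s m≤n) with m≤n⇒m<n∨m≡n m≤n
  ... | inj₁ m<n = ∣m⇒∣m*n (height (base n)) (height∣base m<n)
  ... | inj₂ refl = ∣n⇒∣m*n (base m) ∣-refl

  divisor-of-81 : ∀ e → e ∣ 81 → ¬ 3 ∣ e → e ≡ 1
  divisor-of-81 e d 3∤e = subst (_≡ 1) eq (toWitness {a? = check} _ (fromℕ< e<82) (subst (_∣ 81) (sym eq) d) (λ p → 3∤e (subst (3 ∣_) eq p)))
    where
    e<82 : e < 82
    e<82 = s≤s (∣⇒≤ d)
    eq : toℕ (fromℕ< e<82) ≡ e
    eq = FinP.toℕ-fromℕ< e<82
    check : Dec (∀ (i : Fin 82) → toℕ i ∣ 81 → ¬ 3 ∣ toℕ i → toℕ i ≡ 1)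
    check = FinP.all? λ i → (toℕ i ∣? 81) →-dec (¬? (3 ∣? toℕ i)) →-dec (toℕ i ℕ.≟ 1)

  -- With v = `base n`, a divisor of the earlier height divides v, so a common divisor divides 81 =
  -- v⁴ + 9 v² - height v; but heights are prime to 3.
  heights-coprime : ∀ {m n e} → m < n → e ∣ height (base m) → e ∣ height (base n) → e ≡ 1
  heights-coprime {m} {n} {e} m<n d d′ = divisor-of-81 e
    (∣m+n∣m⇒∣n (subst (e ∣_) (sym (height+81 (base n) (Admissible.26≤v (base-admissible n))))
      (∣m∣n⇒∣m+n (∣m⇒∣m*n (base n * base n) e∣v²) (∣n⇒∣m*n 9 e∣v²))) d′)
    (λ p → 3∤height (base-admissible m) (∣-trans p d))
    where
    e∣v² : e ∣ base n * base n
    e∣v² = ∣m⇒∣m*n (base n) (∣-trans d (height∣base m<n))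

  -- (v² + 4)² < height v < (v² + 5)².
  height-nonsquare : ∀ {v} → 26 ≤ v → ∀ y → height v ≢ y * y
  height-nonsquare {v} 26≤v y e with y ℕ.≤? v * v + 4
  ... | yes y≤ = <⇒≱ (<-≤-trans (+-monoʳ-< ((w + 4) * (w + 4)) (s≤s (≤-refl {81}))) bound) (≤-trans (≤-reflexive (sym h+81)) (+-monoˡ-≤ 81 (≤-trans (≤-reflexive e) (*-mono-≤ y≤ y≤))))
    where
    w = v * v
    h+81 : height v + 81 ≡ w * w + 9 * w
    h+81 = height+81 v 26≤v
    expand : ∀ w → (w + 4) * (w + 4) + 82 ≡ w * w + 8 * w + 98
    expand = solve-∀
    collect : ∀ w → w * w + 8 * w + w ≡ w * w + 9 * w
    collect = solve-∀
    -- This amounts to w ≥ 98, and w ≥ 26² = 98 + 578.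
    bound : (w + 4) * (w + 4) + 82 ≤ w * w + 9 * w
    bound = ≤-trans (≤-reflexive (expand w)) (≤-trans (+-monoʳ-≤ (w * w + 8 * w) (≤-trans (m≤m+n 98 578) (*-mono-≤ 26≤v 26≤v))) (≤-reflexive (collect w)))
  ... | no y≰ = <⇒≱ (<-≤-trans (s≤s (m≤m+n (w * w + 9 * w) (w + 24))) (≤-reflexive (expand w)))
      (≤-trans (*-mono-≤ (≰⇒> y≰) (≰⇒> y≰)) (≤-trans (≤-reflexive (sym e)) (≤-trans (m≤m+n (height v) 81) (≤-reflexive (height+81 v 26≤v)))))
    where
    w = v * v
    expand : ∀ w → suc (w * w + 9 * w + (w + 24)) ≡ suc (w + 4) * suc (w + 4)
    expand = solve-∀

  record Discriminant (n : ℕ) : Set where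
    field
      d y : ℕ
      height≡ : height (base n) ≡ d * (y * y)
      squarefree : SquareFree (ℤ.+ d)

  abstract
    discriminant : ∀ n → Discriminant n
    discriminant n =
      let (d , y , e , s) = squarefree-part (height (base n)) λ e →
            height-nonsquare (Admissible.26≤v (base-admissible n)) 0 e
      in record { d = d ; y = y ; height≡ = e ; squarefree = s }

  radicand : ℕ → ℕ
  radicand n = Discriminant.d (discriminant n)

  -- A common squarefree part would divide two coprime heights, hence be 1, and a height would be a
  -- square.
  radicand-distinct : ∀ {m n} → m < n → radicand m ≢ radicand n
  radicand-distinct {m} {n} m<n e = height-nonsquare (Admissible.26≤v (base-admissible m)) (y (discriminant m))
      (trans (height≡ (discriminant m)) (trans (cong (_* y² m) (heights-coprime m<n d∣m d∣n)) (*-identityˡ _)))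
    where
    open Discriminant
    y² : ℕ → ℕ
    y² n = y (discriminant n) * y (discriminant n)
    d∣m : radicand m ∣ height (base m)
    d∣m = divides (y² m) (trans (height≡ (discriminant m)) (*-comm (radicand m) (y² m)))
    d∣n : radicand m ∣ height (base n)
    d∣n = divides (y² n) (trans (height≡ (discriminant n)) (trans (cong (_* y² n) (sym e)) (*-comm (radicand m) (y² n))))

  radicand-injective : ∀ m n → radicand m ≡ radicand n → m ≡ n
  radicand-injective m n e with <-cmp m n
  ... | tri≈ _ m≡n _ = m≡n
  ... | tri< m<n _ _ = ⊥-elim (radicand-distinct m<n e)
  ... | tri> _ _ n<m = ⊥-elim (radicand-distinct n<m (sym e))

  isQuadraticDiscr : ∀ n → IsQuadraticDiscr (ℤ.+ radicand n)
  isQuadraticDiscr n = (λ e → nonzero (ℤP.+-injective e)) , (λ e → nonone (ℤP.+-injective e)) , squarefree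
    where
    open Discriminant (discriminant n)
    nonsquare = height-nonsquare (Admissible.26≤v (base-admissible n))
    nonzero : d ≢ 0
    nonzero e = nonsquare 0 (trans height≡ (cong (_* (y * y)) e))
    nonone : d ≢ 1
    nonone e = nonsquare y (trans height≡ (trans (cong (_* (y * y)) e) (*-identityˡ _)))

-- The concrete field ℚ(√d) and its curve

module QuadraticFields where
  open FieldSolver
  open EllipticCurves
  open SplitPrime using (SquareRoot)
  open import Defs
  open import Algebra.Structures using (IsCommutativeRing)
  open import Algebra.Bundles using (CommutativeRing)
  open import Data.Empty using (⊥-elim)
  open import Data.Integer as ℤ using (ℤ; -[1+_])
  import Data.Integer.Properties as ℤP
  open import Data.Integer.Tactic.RingSolver using (solve-∀)
  open import Data.Nat as ℕ using (ℕ; zero; suc)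
  import Data.Nat.Properties as ℕP
  import Data.Nat.Divisibility as ℕD
  import Data.Nat.GCD as ℕGCD
  import Data.Nat.Coprimality as Coprimality
  import Data.Nat.DivMod as ℕDM
  import Data.Nat.Tactic.RingSolver as ℕSolver
  open import Data.Product using (∃; _×_; _,_; proj₁; proj₂)
  open import Data.Rational as ℚ using (ℚ; 0ℚ; 1ℚ; ↥_; ↧_)
  import Data.Rational.Properties as ℚP
  import Data.Rational.Unnormalised as ℚᵘ
  import Data.Rational.Unnormalised.Properties as ℚᵘP
  open import Data.Rational.Literals using (fromℤ)
  open import Data.Sum using ([_,_]′)
  open import Relation.Binary.PropositionalEquality
  open import Relation.Nullary using (yes; no)

  -- In lowest terms the denominator divides the square of the numerator, so it is 1 and d is a
  -- square; squarefreeness finishes the argument.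
  squarefree-ratio : ∀ {d} → SquareFree (ℤ.+ d) → ∀ x z → z ≢ 0 → x ℕ.* x ≡ d ℕ.* (z ℕ.* z) → d ≡ 1
  squarefree-ratio {d} sf x z z≢0 e = trans d≡x′² (cong (λ t → t ℕ.* t) (sf x′ (subst (x′ ℕ.* x′ ℕD.∣_) (sym d≡x′²) ℕD.∣-refl)))
    where
    g = ℕGCD.gcd x z
    g∣x = ℕGCD.gcd[m,n]∣m x z
    g∣z = ℕGCD.gcd[m,n]∣n x z
    g≢0 : g ≢ 0
    g≢0 p = z≢0 (ℕD.0∣⇒≡0 (subst (ℕD._∣ z) p g∣z))
    instance
      g-nonZero : ℕ.NonZero g
      g-nonZero = ℕ.≢-nonZero g≢0
    x′ = x ℕDM./ g
    z′ = z ℕDM./ g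
    x≡ : x ≡ x′ ℕ.* g
    x≡ = sym (ℕDM.m/n*n≡m g∣x)
    z≡ : z ≡ z′ ℕ.* g
    z≡ = sym (ℕDM.m/n*n≡m g∣z)
    coprime : Coprimality.Coprime x′ z′
    coprime = Coprimality.coprime-/gcd x z
    regroup : ∀ x g → x ℕ.* g ℕ.* (x ℕ.* g) ≡ g ℕ.* g ℕ.* (x ℕ.* x)
    regroup = ℕSolver.solve-∀
    regroup′ : ∀ d z g → d ℕ.* (z ℕ.* g ℕ.* (z ℕ.* g)) ≡ g ℕ.* g ℕ.* (d ℕ.* (z ℕ.* z))
    regroup′ = ℕSolver.solve-∀
    e′ : x′ ℕ.* x′ ≡ d ℕ.* (z′ ℕ.* z′)
    e′ = ℕP.*-cancelˡ-≡ _ _ (g ℕ.* g) {{ℕP.m*n≢0 g g}} (trans (sym (regroup x′ g)) (trans (cong (λ t → t ℕ.* t) (sym x≡))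
      (trans e (trans (cong (λ t → d ℕ.* (t ℕ.* t)) z≡) (regroup′ d z′ g)))))
    z′∣x′² : z′ ℕD.∣ x′ ℕ.* x′
    z′∣x′² = subst (z′ ℕD.∣_) (sym e′) (ℕD.∣n⇒∣m*n d (ℕD.∣m⇒∣m*n z′ ℕD.∣-refl))
    z′≡1 : z′ ≡ 1
    z′≡1 = coprime (Coprimality.coprime-divisor (Coprimality.sym coprime) z′∣x′² , ℕD.∣-refl)
    d≡x′² : d ≡ x′ ℕ.* x′
    d≡x′² = sym (trans e′ (trans (cong (λ t → d ℕ.* (t ℕ.* t)) z′≡1) (ℕP.*-identityʳ d)))

  -- For δ = `dℚ` the operations agree by definition with those of `Field`. Over an arbitrary base
  -- field the ring laws become polynomial identities in the components.
  module QuadraticExtension (𝔽 : DecField) (δ : DecField.F 𝔽) where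
    open DecField 𝔽
    open FieldLemmas 𝔽
    open FromIntegers isCommutativeRing using (ι)

    E : Set
    E = F × F

    _+ₑ_ _*ₑ_ : E → E → E
    (a , b) +ₑ (c , e) = a + c , b + e
    (a , b) *ₑ (c , e) = a * c + δ * (b * e) , a * e + b * c

    -ₑ_ : E → E
    -ₑ (a , b) = - a , - b

    0ₑ 1ₑ : E
    0ₑ = 0# , 0#
    1ₑ = 1# , 0#

    isCommutativeRingₑ : IsCommutativeRing _≡_ _+ₑ_ _*ₑ_ -ₑ_ 0ₑ 1ₑ
    isCommutativeRingₑ = record
      { isRing = record
        { +-isAbelianGroup = record
          { isGroup = record
            { isMonoid = record
              { isSemigroup = record
                { isMagma = record { isEquivalence = isEquivalence ; ∙-cong = cong₂ _+ₑ_ }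
                ; assoc = λ (a , b) (c , e) (f , g) → cong₂ _,_ (+-assoc a c f) (+-assoc b e g) }
              ; identity = (λ (a , b) → cong₂ _,_ (+-identityˡ a) (+-identityˡ b)) , (λ (a , b) → cong₂ _,_ (+-identityʳ a) (+-identityʳ b)) }
            ; inverse = (λ (a , b) → cong₂ _,_ (-‿inverseˡ a) (-‿inverseˡ b)) , (λ (a , b) → cong₂ _,_ (-‿inverseʳ a) (-‿inverseʳ b))
            ; ⁻¹-cong = cong -ₑ_ }
          ; comm = λ (a , b) (c , e) → cong₂ _,_ (+-comm a c) (+-comm b e) }
        ; *-cong = cong₂ _*ₑ_
        ; *-assoc = λ (a , b) (c , e) (f , g) → cong₂ _,_ (assoc₁ δ a b c e f g) (assoc₂ δ a b c e f g)
        ; *-identity = (λ (a , b) → cong₂ _,_ (id₁ δ a b) (id₂ a b)) , (λ (a , b) → cong₂ _,_ (id₃ δ a b) (id₄ a b))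
        ; distrib = (λ (a , b) (c , e) (f , g) → cong₂ _,_ (dist₁ δ a b c e f g) (dist₂ a b c e f g)) ,
            (λ (a , b) (c , e) (f , g) → cong₂ _,_ (dist₃ δ a b c e f g) (dist₄ a b c e f g)) }
      ; *-comm = λ (a , b) (c , e) → cong₂ _,_ (comm₁ δ a b c e) (comm₂ a b c e) }
      where

      open CommutativeRing commutativeRing using (+-assoc)
      assoc₁ = solve 7 (λ δ a b c e f g → (a :* c :+ δ :* (b :* e)) :* f :+ δ :* ((a :* e :+ b :* c) :* g) := a :* (c
          :* f :+ δ :* (e :* g)) :+ δ :* (b :* (c :* g :+ e :* f))) refl
      assoc₂ = solve 7 (λ δ a b c e f g → (a :* c :+ δ :* (b :* e)) :* g :+ (a :* e :+ b :* c) :* f := a :* (c :* g :+ e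
          :* f) :+ b :* (c :* f :+ δ :* (e :* g))) refl
      id₁ = solve 3 (λ δ a b → con 1 :* a :+ δ :* (con 0 :* b) := a) refl
      id₂ = solve 2 (λ a b → con 1 :* b :+ con 0 :* a := b) refl
      id₃ = solve 3 (λ δ a b → a :* con 1 :+ δ :* (b :* con 0) := a) refl
      id₄ = solve 2 (λ a b → a :* con 0 :+ b :* con 1 := b) refl
      dist₁ = solve 7 (λ δ a b c e f g → a :* (c :+ f) :+ δ :* (b :* (e :+ g)) := a :* c :+ δ :* (b :* e) :+ (a :* f
          :+ δ :* (b :* g))) refl
      dist₂ = solve 6 (λ a b c e f g → a :* (e :+ g) :+ b :* (c :+ f) := a :* e :+ b :* c :+ (a :* g :+ b :* f)) refl
      dist₃ = solve 7 (λ δ a b c e f g → (c :+ f) :* a :+ δ :* ((e :+ g) :* b) := c :* a :+ δ :* (e :* b) :+ (f :* a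
          :+ δ :* (g :* b))) refl
      dist₄ = solve 6 (λ a b c e f g → (c :+ f) :* b :+ (e :+ g) :* a := c :* b :+ e :* a :+ (f :* b :+ g :* a)) refl
      comm₁ = solve 5 (λ δ a b c e → a :* c :+ δ :* (b :* e) := c :* a :+ δ :* (e :* b)) refl
      comm₂ = solve 4 (λ a b c e → a :* e :+ b :* c := c :* b :+ e :* a) refl

    inverseₑ : ∀ a b → a * a - δ * (b * b) ≢ 0# → let n = inv (a * a - δ * (b * b)) in (a , b) *ₑ (a * n , - (b * n)) ≡ 1ₑ
    inverseₑ a b N≢0 = cong₂ _,_ (linear₁ 1# (*-inv (a * a - δ * (b * b)) N≢0) (first a b δ n)) (second a b n)
      where
      n = inv (a * a - δ * (b * b))
      first = solve 4 (λ a b δ n → a :* (a :* n) :+ δ :* (b :* :- (b :* n)) :- con 1 := con 1 :* ((a :* a :- δ :* (b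
          :* b)) :* n :- con 1)) refl
      second = solve 3 (λ a b n → a :* :- (b :* n) :+ b :* (a :* n) := con 0) refl

    commutativeRingₑ : CommutativeRing _ _
    commutativeRingₑ = record { isCommutativeRing = isCommutativeRingₑ }

    ιₑ : ∀ n → FromIntegers.ι isCommutativeRingₑ n ≡ (ι n , 0#)
    ιₑ (ℤ.+ n) = positive n
      where
      open import Algebra.Properties.Semiring.Mult.TCOptimised (CommutativeRing.semiring commutativeRing) using (1+×)
      open import Algebra.Properties.Semiring.Mult.TCOptimised (CommutativeRing.semiring commutativeRingₑ)
        using () renaming (1+× to 1+×ₑ)
      positive : ∀ n → FromIntegers.ι isCommutativeRingₑ (ℤ.+ n) ≡ (ι (ℤ.+ n) , 0#)
      positive zero = refl
      positive (suc n) = trans (1+×ₑ n 1ₑ) (trans (cong (1ₑ +ₑ_) (positive n)) (cong₂ _,_ (sym (1+× n 1#)) (+-identityʳ 0#)))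
    ιₑ -[1+ n ] = trans (cong -ₑ_ (ιₑ (ℤ.+ suc n))) (cong (- ι (ℤ.+ suc n) ,_) (zero-neg 0# refl))
      where
      zero-neg : ∀ z → z ≡ 0# → - z ≡ 0#
      zero-neg z p = linear₁ (- 1#) p (solve 1 (λ z → :- z :- con 0 := :- con 1 :* (z :- con 0)) refl z)

  module Rationals (d : ℤ) where
    open Field d using (invℚ; dℚ)

    ℚ-field : DecField
    ℚ-field = record
      { F = ℚ ; _+_ = ℚ._+_ ; _*_ = ℚ._*_ ; -_ = ℚ.-_ ; inv = invℚ ; 0# = 0ℚ ; 1# = 1ℚ
      ; isCommutativeRing = ℚP.+-*-isCommutativeRing ; *-inv = *-invℚ ; 1≢0 = λ () ; _≟_ = ℚP._≟_ }
      where
      *-invℚ : ∀ p → p ≢ 0ℚ → p ℚ.* invℚ p ≡ 1ℚ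
      *-invℚ p p≢0 with p ℚP.≟ 0ℚ
      ... | yes e = ⊥-elim (p≢0 e)
      ... | no ¬e = ℚP.*-inverseʳ p {{ℚ.≢-nonZero ¬e}}

    open FieldLemmas ℚ-field
    open FromIntegers ℚP.+-*-isCommutativeRing using (ι)

    fromℤ-+ : ∀ m n → fromℤ (m ℤ.+ n) ≡ fromℤ m ℚ.+ fromℤ n
    fromℤ-+ m n = ℚP.toℚᵘ-injective (ℚᵘP.≃-trans (ℚᵘ.*≡* (simplify m n)) (ℚᵘP.≃-sym (ℚP.toℚᵘ-homo-+ (fromℤ m) (fromℤ n))))
      where
      simplify : ∀ m n → (m ℤ.+ n) ℤ.* ℤ.1ℤ ≡ (m ℤ.* ℤ.1ℤ ℤ.+ n ℤ.* ℤ.1ℤ) ℤ.* ℤ.1ℤ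
      simplify = solve-∀

    -- A sum of ones hides its numerator, while `fromℤ` displays it; injectivity of ι and the
    -- clearing of denominators rest on this.
    ι≡fromℤ : ∀ n → ι n ≡ fromℤ n
    ι≡fromℤ (ℤ.+ n) = positive n
      where
      open import Algebra.Properties.Semiring.Mult.TCOptimised (CommutativeRing.semiring ℚP.+-*-commutativeRing) using (1+×)
      positive : ∀ n → ι (ℤ.+ n) ≡ fromℤ (ℤ.+ n)
      positive zero = refl
      positive (suc n) = trans (1+× n 1ℚ) (trans (cong (1ℚ ℚ.+_) (positive n)) (sym (fromℤ-+ (ℤ.+ 1) (ℤ.+ n))))
    ι≡fromℤ -[1+ n ] = cong ℚ.-_ (ι≡fromℤ (ℤ.+ suc n))

    ι-injective : ∀ {n} → ι n ≡ 0ℚ → n ≡ ℤ.0ℤ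
    ι-injective {n} e = cong ↥_ (trans (sym (ι≡fromℤ n)) e)

    d/1 : dℚ ≡ ι d
    d/1 = trans (ℚP.toℚᵘ-injective (ℚP.toℚᵘ-fromℚᵘ (ℚᵘ.mkℚᵘ d 0))) (sym (ι≡fromℤ d))

    clear-denominator : ∀ p → ι (↧ p) ℚ.* p ≡ ι (↥ p)
    clear-denominator p = trans (cong (ℚ._* p) (ι≡fromℤ (↧ p))) (trans (ℚP.toℚᵘ-injective
      (ℚᵘP.≃-trans (ℚP.toℚᵘ-homo-* (fromℤ (↧ p)) p) (cross p))) (sym (ι≡fromℤ (↥ p))))
      where
      rearrange : ∀ m n → n ℤ.* m ℤ.* ℤ.1ℤ ≡ m ℤ.* n
      rearrange = solve-∀
      cross : ∀ p → ℚ.toℚᵘ (fromℤ (↧ p)) ℚᵘ.* ℚ.toℚᵘ p ℚᵘ.≃ ℚ.toℚᵘ (fromℤ (↥ p))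
      cross p@record{} = ℚᵘ.*≡* (trans (rearrange (↥ p) (↧ p))
        (cong (λ k → ↥ p ℤ.* ℤ.+ suc k) (sym (ℕP.+-identityʳ (ℚ.denominator-1 p)))))

    ↧≢0 : ∀ p → ↧ p ≢ ℤ.0ℤ
    ↧≢0 p@record{} ()

  module Clearing (𝔽 : DecField) where
    open DecField 𝔽
    open FieldLemmas 𝔽

    cross : ∀ m n a b δ → a * a ≡ δ * (b * b) → m * a * n * (m * a * n) ≡ δ * (n * b * m * (n * b * m))
    cross m n a b δ p = linear₁ (m * m * (n * n)) p (solve 5 (λ m a n δ b → m :* a :* n :* (m :* a :* n) :- δ :* (n :* b
        :* m :* (n :* b :* m)) := m :* m :* (n :* n) :* (a :* a :- δ :* (b :* b))) refl m a n δ b)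

    first : ∀ δ m p q dp dq y np → m ≡ dp * dq * y → dp * p ≡ np → m * p + δ * (0# * q) ≡ np * dq * y
    first δ _ p q dp dq y _ refl refl = solve 6 (λ dp dq y p δ q → dp :* dq :* y :* p :+ δ :* (con 0 :* q) := dp :* p
        :* dq :* y) refl dp dq y p δ q

    second : ∀ m p q dp dq y nq → m ≡ dp * dq * y → dq * q ≡ nq → m * q + 0# * p ≡ nq * dp * y
    second _ p q dp dq y _ refl refl = solve 5 (λ dp dq y q p → dp :* dq :* y :* q :+ con 0 :* p := dq :* q :* dp
        :* y) refl dp dq y q p

  module QuadraticField (d : ℕ) (squarefree : SquareFree (ℤ.+ d)) (d≢1 : d ≢ 1) (y : ℕ) (y≢0 : y ≢ 0) where
    open Field (ℤ.+ d)
    open Rationals (ℤ.+ d)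
    open DecField ℚ-field
    open FieldLemmas ℚ-field
    open FromIntegers ℚP.+-*-isCommutativeRing using (ι; ι-*; ι-+; ι-neg)
    open QuadraticExtension ℚ-field dℚ

    integers-equal : ∀ {m n} → ι m ≡ ι n → m ≡ n
    integers-equal {m} {n} e = ℤP.i-j≡0⇒i≡j m n (ι-injective (trans (ι-+ m (ℤ.- n)) (trans (cong (ι m +_) (ι-neg n)) (x≡y⇒x-y≡0 e))))

    -- Clearing denominators gives integers with x² = d z², impossible for z ≠ 0. Because the norm
    -- form is anisotropic, `invK` inverts every nonzero element.
    anisotropic : ∀ a b → a * a - dℚ * (b * b) ≡ 0ℚ → a ≡ 0ℚ × b ≡ 0ℚ
    anisotropic a b e = a≡0 , b≡0
      where
      x z : ℤ
      x = ↥ a ℤ.* ↧ b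
      z = ↥ b ℤ.* ↧ a
      numerators : ∀ p q → ι (↥ p ℤ.* ↧ q) ≡ ι (↧ p) * p * ι (↧ q)
      numerators p q = trans (ι-* (↥ p) (↧ q)) (cong (_* ι (↧ q)) (sym (clear-denominator p)))
      scaled : ι (x ℤ.* x) ≡ ι (ℤ.+ d ℤ.* (z ℤ.* z))
      scaled = trans (ι-* x x) (trans (cong₂ _*_ (numerators a b) (numerators a b)) (trans
        (Clearing.cross ℚ-field (ι (↧ a)) (ι (↧ b)) a b dℚ (x-y≡0⇒x≡y {a * a} {dℚ * (b * b)} e))
        (sym (trans (ι-* (ℤ.+ d) (z ℤ.* z)) (cong₂ _*_ (sym d/1) (trans (ι-* z z) (cong₂ _*_ (numerators b a) (numerators b a))))))))
      absolute : ℤ.∣ x ∣ ℕ.* ℤ.∣ x ∣ ≡ d ℕ.* (ℤ.∣ z ∣ ℕ.* ℤ.∣ z ∣)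
      absolute = trans (sym (ℤP.abs-* x x)) (trans (cong ℤ.∣_∣ (integers-equal {x ℤ.* x} {ℤ.+ d ℤ.* (z ℤ.* z)} scaled))
        (trans (ℤP.abs-* (ℤ.+ d) (z ℤ.* z)) (cong (d ℕ.*_) (ℤP.abs-* z z))))
      b≡0 : b ≡ 0ℚ
      b≡0 with z ℤ.≟ ℤ.0ℤ
      ... | no z≢0 = ⊥-elim (d≢1 (squarefree-ratio squarefree ℤ.∣ x ∣ ℤ.∣ z ∣ (λ p → z≢0 (ℤP.∣i∣≡0⇒i≡0 p)) absolute))
      ... | yes z≡0 = [ ℚP.↥p≡0⇒p≡0 b , (λ p → ⊥-elim (↧≢0 a p)) ]′ (ℤP.i*j≡0⇒i≡0∨j≡0 (↥ b) z≡0)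
      a≡0 : a ≡ 0ℚ
      a≡0 with a ℚP.≟ 0ℚ
      ... | yes p = p
      ... | no a≢0 = zeroProduct {a} {a} a≢0 (trans (x-y≡0⇒x≡y {a * a} {dℚ * (b * b)} e) (trans (cong (λ b → dℚ * (b * b)) b≡0) (trans (cong (dℚ *_) (zeroˡ 0ℚ)) (zeroʳ dℚ))))

    K-field : DecField
    K-field = record
      { F = K (ℤ.+ d) ; _+_ = _+K_ ; _*_ = _*K_ ; -_ = -K_ ; inv = invK ; 0# = 0K ; 1# = 1K
      ; isCommutativeRing = isCommutativeRingₑ
      ; *-inv = λ (a , b) ≢0 → inverseₑ a b (λ N≡0 → let (p , q) = anisotropic a b N≡0 in ≢0 (cong₂ _,_ p q))
      ; 1≢0 = λ () ; _≟_ = _≟K_ }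

    ιK : ℤ → K (ℤ.+ d)
    ιK = FromIntegers.ι isCommutativeRingₑ

    -- The root y √d of h = d y²: the field is presented by the squarefree d, while the curve and
    -- the place refer to h.
    θ : K (ℤ.+ d)
    θ = 0ℚ , ι (ℤ.+ y)

    θ² : θ *K θ ≡ ιK (ℤ.+ (d ℕ.* (y ℕ.* y)))
    θ² = trans (cong₂ _,_ (trans (trans (cong (_+ dℚ * (ι (ℤ.+ y) * ι (ℤ.+ y))) (zeroˡ 0ℚ)) (+-identityˡ _)) first)
        (trans (cong₂ _+_ (zeroˡ (ι (ℤ.+ y))) (zeroʳ (ι (ℤ.+ y)))) (+-identityˡ 0ℚ))) (sym (ιₑ (ℤ.+ (d ℕ.* (y ℕ.* y)))))
      where
      first : dℚ * (ι (ℤ.+ y) * ι (ℤ.+ y)) ≡ ι (ℤ.+ (d ℕ.* (y ℕ.* y)))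
      first = trans (cong₂ _*_ d/1 (sym (ι-* (ℤ.+ y) (ℤ.+ y)))) (trans (sym (ι-* (ℤ.+ d) (ℤ.+ y ℤ.* ℤ.+ y)))
        (cong ι (trans (cong (ℤ.+ d ℤ.*_) (sym (ℤP.pos-* y y))) (sym (ℤP.pos-* d (y ℕ.* y))))))

    coordinates : ∀ x z → ιK x +K ιK z *K θ ≡ (ι x , ι z * ι (ℤ.+ y))
    coordinates x z = trans (cong₂ (λ s t → s +K t *K θ) (ιₑ x) (ιₑ z)) (cong₂ _,_
      (trans (cong (ι x +_) (trans (cong₂ _+_ (zeroʳ (ι z)) (trans (cong (dℚ *_) (zeroˡ (ι (ℤ.+ y)))) (zeroʳ dℚ))) (+-identityˡ 0ℚ))) (+-identityʳ (ι x)))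
      (trans (+-identityˡ _) (trans (cong (ι z * ι (ℤ.+ y) +_) (zeroˡ 0ℚ)) (+-identityʳ _))))

    independent : ∀ x z → ιK x +K ιK z *K θ ≡ 0K → x ≡ ℤ.0ℤ × z ≡ ℤ.0ℤ
    independent x z e = ι-injective (cong proj₁ e′) , [ (λ p → p) , (λ p → ⊥-elim (y≢0 (ℤP.+-injective p))) ]′
        (ℤP.i*j≡0⇒i≡0∨j≡0 z (ι-injective (trans (ι-* z (ℤ.+ y)) (cong proj₂ e′))))
      where
      e′ : (ι x , ι z * ι (ℤ.+ y)) ≡ 0K
      e′ = trans (sym (coordinates x z)) e

    spanned : ∀ α → ∃ λ m → ∃ λ x → ∃ λ z → m ≢ ℤ.0ℤ × ιK m *K α ≡ ιK x +K ιK z *K θ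
    spanned (p , q) = m , x , z , m≢0 , trans (cong (_*K (p , q)) (ιₑ m)) (trans (cong₂ _,_ first second) (sym (coordinates x z)))
      where
      m x z : ℤ
      -- Besides the denominators of p and q, the multiplier contains y because √d = θ/y.
      m = ↧ p ℤ.* ↧ q ℤ.* ℤ.+ y
      x = ↥ p ℤ.* ↧ q ℤ.* ℤ.+ y
      z = ↥ q ℤ.* ↧ p
      m≢0 : m ≢ ℤ.0ℤ
      m≢0 e = [ (λ e → [ ↧≢0 p , ↧≢0 q ]′ (ℤP.i*j≡0⇒i≡0∨j≡0 (↧ p) e)) , (λ e → y≢0 (ℤP.+-injective e)) ]′ (ℤP.i*j≡0⇒i≡0∨j≡0 (↧ p ℤ.* ↧ q) e)
      triple : ∀ a b c → ι (a ℤ.* b ℤ.* c) ≡ ι a * ι b * ι c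
      triple a b c = trans (ι-* (a ℤ.* b) c) (cong (_* ι c) (ι-* a b))
      first : ι m * p + dℚ * (0ℚ * q) ≡ ι x
      first = trans (Clearing.first ℚ-field dℚ (ι m) p q (ι (↧ p)) (ι (↧ q)) (ι (ℤ.+ y)) (ι (↥ p)) (triple (↧ p) (↧ q) (ℤ.+ y)) (clear-denominator p))
        (sym (triple (↥ p) (↧ q) (ℤ.+ y)))
      second : ι m * q + 0ℚ * p ≡ ι z * ι (ℤ.+ y)
      second = trans (Clearing.second ℚ-field (ι m) p q (ι (↧ p)) (ι (↧ q)) (ι (ℤ.+ y)) (ι (↥ q)) (triple (↧ p) (↧ q) (ℤ.+ y)) (clear-denominator q))
        (cong (_* ι (ℤ.+ y)) (sym (ι-* (↥ q) (↧ p))))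

    √height : SquareRoot K-field (ℤ.+ (d ℕ.* (y ℕ.* y)))
    √height = record { θ = θ ; θ² = θ² ; independent = independent ; spanned = spanned }

    module Points (t : Triple) where
      private module L = Law t
      open Curve K-field L.A L.B L.C renaming (O to Oᶜ; aff to affᶜ; OnCurve to OnCurveᶜ; _⊕_ to _⊕ᶜ_) hiding (Point)
      module CurveOf = Curve K-field L.A L.B L.C

      toCurve : Point → CurveOf.Point
      toCurve O = Oᶜ
      toCurve (aff x y) = affᶜ x y

      fromCurve : CurveOf.Point → Point
      fromCurve Oᶜ = O
      fromCurve (affᶜ x y) = aff x y

      to∘from : ∀ P → toCurve (fromCurve P) ≡ P
      to∘from Oᶜ = refl
      to∘from (affᶜ x y) = refl

      from∘to : ∀ P → fromCurve (toCurve P) ≡ P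
      from∘to O = refl
      from∘to (aff x y) = refl

      opaque
        unfolding Curve._⊕_

        -- Both laws split into the same cases, and `ofℕ 2` and `ofℕ 3` compute to the sums of ones
        -- of the abstract law.
        to-⊕ : ∀ P Q → toCurve (P L.⊕ Q) ≡ toCurve P ⊕ᶜ toCurve Q
        to-⊕ O Q = refl
        to-⊕ (aff x y) O = refl
        to-⊕ (aff x₁ y₁) (aff x₂ y₂) with x₁ ≟K x₂
        ... | no _ = refl
        ... | yes _ with (y₁ +K y₂) ≟K 0K
        ...   | yes _ = refl
        ...   | no _ = refl

-- Assembly for one field

module Solutions where
  open SplitPrime
  open TriplingMap
  open TripleFamilies
  open QuadraticFields
  open Radicands
  open import Defs
  open import Data.Empty using (⊥-elim)
  open import Data.Integer as ℤ using (ℤ)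
  import Data.Integer.Properties as ℤP
  open import Data.Integer.Divisibility.Signed using (divides; _∣?_; ∣⇒∣ᵤ)
  open import Data.Nat as ℕ using (ℕ; zero; suc)
  import Data.Nat.Properties as ℕP
  open import Data.Product using (Σ; ∃; _×_; _,_)
  open import Data.Sum using (_⊎_; inj₁; inj₂)
  open import Relation.Binary.PropositionalEquality
  open import Relation.Nullary.Decidable using (toWitnessFalse)

  module Solution (n : ℕ) where
    open Discriminant (discriminant n)
    open Admissible (base-admissible n) using (q; k; v≡; 3∤v; 26≤v) renaming (height≡ to height≡1+289k)
    open TriplingStep using (State; mkState)
    open Modulo17

    v h : ℕ
    v = base n
    h = d ℕ.* (y ℕ.* y)

    nonsquare = height-nonsquare 26≤v

    y≢0 : y ≢ 0
    y≢0 e = nonsquare 0 (trans height≡ (trans (cong (λ y → d ℕ.* (y ℕ.* y)) e) (ℕP.*-zeroʳ d)))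

    d≢1 : d ≢ 1
    d≢1 e = nonsquare y (trans height≡ (trans (cong (ℕ._* (y ℕ.* y)) e) (ℕP.*-identityˡ _)))

    h≡ : ℤ.+ h ≡ ℤ.1ℤ ℤ.+ ℤ.+ 289 ℤ.* ℤ.+ k
    h≡ = trans (cong (λ t → ℤ.+ t) (trans (sym height≡) height≡1+289k)) (cong (λ t → ℤ.1ℤ ℤ.+ t) (ℤP.pos-* 289 k))

    open Field (ℤ.+ d)
    open QuadraticField d squarefree d≢1 y y≢0
    open FieldTriple K-field (ℤ.+ h) (ℤ.+ k) h≡ √height

    -- The point σ = 3/v with M = 1: its curve equation is the formula for the height of v.
    start : State (ℤ.+ h) (ℤ.+ 6) 0
    start = mkState (ℤ.+ 3) V ℤ.1ℤ ℤ.1ℤ curve refl (toWitnessFalse {a? = ℤ.+ 3 ∣? ℤ.1ℤ} _) (λ d → 3∤v (∣⇒∣ᵤ d))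
        -- The witness -9 comes from 3 - 6 · 26 = -9 · 17.
        (≡ₚ-trans (modulo (divides (ℤ.- ℤ.+ 9) refl)) (≡ₚ-sym (*-congₚ (≡ₚ-reflexive {ℤ.+ 6} refl) V≡26)))
        (λ d → toWitnessFalse {a? = ℤ.+ 17 ∣? ℤ.+ 26} _ (∣-resp V≡26 d))
      where
      V : ℤ
      V = ℤ.+ v
      V≡26 : V ≡ₚ ℤ.+ 26
      V≡26 = modulo (divides (ℤ.+ 17 ℤ.* ℤ.+ q) (trans (cong (λ v → ℤ.+ v ℤ.- ℤ.+ 26) v≡) (trans (cong (λ t → ℤ.+ 26 ℤ.+ t ℤ.- ℤ.+ 26) (ℤP.pos-* 289 q)) (cancel (ℤ.+ q)))))
        where
        open import Data.Integer.Tactic.RingSolver using (solve-∀)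
        cancel : ∀ q → ℤ.+ 26 ℤ.+ ℤ.+ 289 ℤ.* q ℤ.- ℤ.+ 26 ≡ ℤ.+ 17 ℤ.* q ℤ.* ℤ.+ 17
        cancel = solve-∀
      curve : V ℤ.* V ℤ.* (V ℤ.* V) ℤ.+ ℤ.+ 9 ℤ.* (V ℤ.* V) ℤ.- ℤ.+ 81 ≡ ℤ.+ h ℤ.* ℤ.1ℤ
      curve = trans (cong (ℤ._- ℤ.+ 81) (sym integers)) (trans (cancel (ℤ.+ h)) (sym (ℤP.*-identityʳ (ℤ.+ h))))
        where
        open import Data.Integer.Tactic.RingSolver using (solve-∀)
        cancel : ∀ h → h ℤ.+ ℤ.+ 81 ℤ.- ℤ.+ 81 ≡ h
        cancel = solve-∀
        integers : ℤ.+ h ℤ.+ ℤ.+ 81 ≡ V ℤ.* V ℤ.* (V ℤ.* V) ℤ.+ ℤ.+ 9 ℤ.* (V ℤ.* V)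
        integers = trans (cong (λ t → ℤ.+ t) (trans (cong (ℕ._+ 81) (sym height≡)) (height+81 v 26≤v)))
          (cong₂ ℤ._+_ (trans (ℤP.pos-* (v ℕ.* v) (v ℕ.* v)) (cong₂ ℤ._*_ (ℤP.pos-* v v) (ℤP.pos-* v v)))
            (trans (ℤP.pos-* 9 (v ℕ.* v)) (cong (ℤ.+ 9 ℤ.*_) (ℤP.pos-* v v))))

    open TripleFamily (family start)
    module T (j : ℕ) = TorsionTriple (torsionTriple j)

    triple : ℕ → Triple
    triple j = a j , b j , c j

    diophantine : ∀ j → IsDiophantineTriple (triple j)
    diophantine j = a≢0 , b≢0 , c≢0 , a≢b , a≢c , b≢c , square-ab , square-ac , square-bc
      where open T j

    torsion : ∀ j → TorsionIsZ2×Z10 (ℤ.+ d) (triple j)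
    torsion j = (λ u → fromCurve (T.ψ j u)) , on-curve , homomorphism , injective , surjective
      where
      open Points (triple j)
      module L = Law (triple j)
      on-curve-from : ∀ P → CurveOf.OnCurve P → OnCurve (triple j) (fromCurve P)
      on-curve-from CurveOf.O _ = _
      on-curve-from (CurveOf.aff x y) p = trans p (sym (T.factorised j x))
      on-curve-to : ∀ P → OnCurve (triple j) P → CurveOf.OnCurve (toCurve P)
      on-curve-to O _ = _
      on-curve-to (aff x y) p = trans p (T.factorised j x)
      on-curve : ∀ u → OnCurve (triple j) (fromCurve (T.ψ j u))
      on-curve u = on-curve-from (T.ψ j u) (T.ψ-onCurve j u)
      homomorphism : ∀ u v → fromCurve (T.ψ j (u ⊞ v)) ≡ fromCurve (T.ψ j u) L.⊕ fromCurve (T.ψ j v)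
      homomorphism u v = trans (cong fromCurve (trans (T.ψ-homo j u v)
          (sym (trans (to-⊕ (fromCurve (T.ψ j u)) (fromCurve (T.ψ j v))) (cong₂ CurveOf._⊕_ (to∘from _) (to∘from _))))))
        (from∘to _)
      injective : ∀ u v → fromCurve (T.ψ j u) ≡ fromCurve (T.ψ j v) → u ≡ v
      injective u v e = T.ψ-injective j u v (trans (sym (to∘from _)) (trans (cong toCurve e) (to∘from _)))
      to-mul : ∀ n P → toCurve (L.mul n P) ≡ CurveOf.mul n (toCurve P)
      to-mul zero P = refl
      to-mul (suc n) P = trans (to-⊕ P (L.mul n P)) (cong (toCurve P CurveOf.⊕_) (to-mul n P))
      surjective : ∀ P → L.IsTorsion P → ∃ λ u → fromCurve (T.ψ j u) ≡ P
      surjective P (p , n , e) =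
        let (u , ψu≡P) = T.torsion-classified j (on-curve-to P p) n (trans (sym (to-mul (suc n) P)) (cong toCurve e))
        in u , trans (cong fromCurve ψu≡P) (from∘to P)

    distinct : ∀ i j → SameSet (triple i) (triple j) → i ≡ j
    distinct i j (f , _) = cases (f (a i) (inj₁ refl))
      where
      cases : a i ≡ a j ⊎ a i ≡ b j ⊎ a i ≡ c j → i ≡ j
      cases (inj₁ e) = a-injective i j e
      cases (inj₂ (inj₁ e)) = ⊥-elim (b-irrational j (subst Rational e (a-rational i)))
      cases (inj₂ (inj₂ e)) = ⊥-elim (c-irrational j (subst Rational e (a-rational i)))

    infinitelyManyTriples : InfinitelyManyTriples (ℤ.+ d)
    infinitelyManyTriples = triple , (λ j → diophantine j , torsion j) , distinct

theorem1 : Σ (ℕ → ℤ) λ g →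
    (∀ n → IsQuadraticDiscr (g n) × InfinitelyManyTriples (g n)) ×
    (∀ m n → g m ≡ g n → m ≡ n)
theorem1 = discriminant , (λ n → isQuadraticDiscr n , Solution.infinitelyManyTriples n) ,
    λ m n e → radicand-injective m n (ℤP.+-injective e)
  where
  open import Data.Product using (_,_)
  import Data.Integer as ℤ
  import Data.Integer.Properties as ℤP
  open Radicands using (radicand; radicand-injective; isQuadraticDiscr)
  open Solutions using (module Solution)
  discriminant : ℕ → ℤ
  discriminant n = ℤ.+ radicand n
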